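{- Let $f:\{0,1\}^r\to\mathbb{N}$ and let $Div$ be the Venn $f$-diversity measure. Given a cliquewidth decomposition $\mathcal{D}$ of width $\omega$ of a graph $G$ and integers $k,r,d>0$, one can determine whether $G$ admits $r$ vertex covers $S_1,\dots,S_r$, each of size at most $k$, with $Div(S_1,\dots,S_r)\ge d$, in time $\mathcal{O}(|V(\mathcal{D})|\cdot(k+1)^{2r\omega}\cdot r\omega)$.
   Context: All graphs are finite, simple and undirected. A vertex cover of $G$ is a set $S\subseteq V(G)$ such that every edge has an endpoint in $S$. For $v\in V(G)$ and $S_1,\dots,S_r\subseteq V(G)$, the membership vector $m(S_1,\dots,S_r,v)\in\{0,1\}^r$ has $i$-th entry $1$ iff $v\in S_i$; the Venn $f$-diversity is $Div(S_1,\dots,S_r)=\sum_{v\in V(G)}f(m(S_1,\dots,S_r,v))$. A cliquewidth decomposition of width $\omega$ is a rooted tree $\mathcal{D}$ whose nodes are of the types $intro(v,a)$ with $a\in[\omega]$ (a leaf building the one-vertex graph with vertex $v$ of color $a$), $t_1\oplus t_2$ (disjoint union of the colored graphs built at its two children), $recolor(t',a\to b)$ (recolor all vertices of color $a$ to color $b$) and $addEdges(t',a,b)$ (add all edges between vertices of color $a$ and vertices of color $b$); it is a decomposition of $G$ if $G$ is isomorphic to the graph built at the root. -}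

module Defs where

open import Level using (0ℓ)
open import Data.Bool.Base using (Bool; true; false; if_then_else_)
open import Data.Empty using (⊥)
open import Data.Fin.Base using (Fin; toℕ)
import Data.Fin.Properties as Fin
open import Data.Fin.Subset using (Subset; _∈_; ∣_∣)
open import Data.List.Base using (List; []; _∷_; _++_)
open import Data.Nat.Base using (ℕ; zero; suc; _+_; _*_; _∸_; _^_; _≤_; _≡ᵇ_)
open import Data.Product using (Σ-syntax; _×_; _,_)
open import Data.Sum.Base using (_⊎_; inj₁; inj₂)
open import Data.Vec.Base as Vec using (Vec; []; _∷_; lookup; tabulate)
open import Function.Base using (_∘_)
open import Function.Bundles using (_↔_; _⇔_; Inverse)
open import Relation.Binary.Core using (Rel)
open import Relation.Binary.Definitions using (Symmetric; Irreflexive)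
open import Relation.Binary.PropositionalEquality using (_≡_; _≢_; refl; sym)
open import Relation.Nullary.Decidable using (yes; no)
open import Relation.Nullary.Negation using (¬_)

record Graph (V : Set) : Set₁ where
  field
    Adj        : Rel V 0ℓ
    Adj-sym    : Symmetric Adj
    Adj-irrefl : Irreflexive _≡_ Adj

record _≅_ {V W : Set} (G : Graph V) (H : Graph W) : Set where
  field
    vertices : V ↔ W
    edges    : ∀ u v → Graph.Adj G u v ⇔ Graph.Adj H (Inverse.to vertices u) (Inverse.to vertices v)

IsVertexCover : ∀ {n} → Graph (Fin n) → Subset n → Set
IsVertexCover G S = ∀ u v → Graph.Adj G u v → u ∈ S ⊎ v ∈ S

membership : ∀ {r n} → (Fin r → Subset n) → Fin n → Vec Bool r
membership S v = tabulate (λ i → lookup (S i) v)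

Div : ∀ {r n} → (Vec Bool r → ℕ) → (Fin r → Subset n) → ℕ
Div f S = Vec.sum (tabulate (λ v → f (membership S v)))

HasDiverseVertexCovers : ∀ {r n} → (Vec Bool r → ℕ) → Graph (Fin n) → (k d : ℕ) → Set
HasDiverseVertexCovers {r} {n} f G k d =
  Σ[ S ∈ (Fin r → Subset n) ]
    (∀ i → IsVertexCover G (S i)) × (∀ i → ∣ S i ∣ ≤ k) × d ≤ Div f S

data Decomposition (ω : ℕ) : Set where
  intro    : (v : ℕ) (a : Fin ω) → Decomposition ω
  _⊕_      : (t₁ t₂ : Decomposition ω) → Decomposition ω
  recolor  : (t : Decomposition ω) (a b : Fin ω) → Decomposition ω
  addEdges : (t : Decomposition ω) (a b : Fin ω) → Decomposition ω

size : ∀ {ω} → Decomposition ω → ℕ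
size (intro v a)      = 1
size (t₁ ⊕ t₂)        = suc (size t₁ + size t₂)
size (recolor t a b)  = suc (size t)
size (addEdges t a b) = suc (size t)

-- Since unions are disjoint, a label v introduced at two different leaves
-- yields two different vertices.
Vertex : ∀ {ω} → Decomposition ω → Set
Vertex (intro v a)      = Σ[ u ∈ ℕ ] u ≡ v
Vertex (t₁ ⊕ t₂)        = Vertex t₁ ⊎ Vertex t₂
Vertex (recolor t a b)  = Vertex t
Vertex (addEdges t a b) = Vertex t

color : ∀ {ω} (t : Decomposition ω) → Vertex t → Fin ω
color (intro v a)      x        = a
color (t₁ ⊕ t₂)        (inj₁ x) = color t₁ x
color (t₁ ⊕ t₂)        (inj₂ x) = color t₂ x
color (recolor t a b)  x with color t x Fin.≟ a
... | yes _ = b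
... | no  _ = color t x
color (addEdges t a b) x        = color t x

-- a and b may coincide in addEdges; x ≢ y keeps the graph simple in that case.
Edge : ∀ {ω} (t : Decomposition ω) → Rel (Vertex t) 0ℓ
Edge (intro v a)      x        y        = ⊥
Edge (t₁ ⊕ t₂)        (inj₁ x) (inj₁ y) = Edge t₁ x y
Edge (t₁ ⊕ t₂)        (inj₁ x) (inj₂ y) = ⊥
Edge (t₁ ⊕ t₂)        (inj₂ x) (inj₁ y) = ⊥
Edge (t₁ ⊕ t₂)        (inj₂ x) (inj₂ y) = Edge t₂ x y
Edge (recolor t a b)  x        y        = Edge t x y
Edge (addEdges t a b) x        y        =
  Edge t x y ⊎
  (x ≢ y × ((color t x ≡ a × color t y ≡ b) ⊎ (color t x ≡ b × color t y ≡ a)))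

Edge-sym : ∀ {ω} (t : Decomposition ω) → Symmetric (Edge t)
Edge-sym (t₁ ⊕ t₂) {inj₁ x} {inj₁ y} e = Edge-sym t₁ e
Edge-sym (t₁ ⊕ t₂) {inj₂ x} {inj₂ y} e = Edge-sym t₂ e
Edge-sym (recolor t a b) e = Edge-sym t e
Edge-sym (addEdges t a b) (inj₁ e) = inj₁ (Edge-sym t e)
Edge-sym (addEdges t a b) (inj₂ (x≢y , inj₁ (x≡a , y≡b))) = inj₂ (x≢y ∘ sym , inj₂ (y≡b , x≡a))
Edge-sym (addEdges t a b) (inj₂ (x≢y , inj₂ (x≡b , y≡a))) = inj₂ (x≢y ∘ sym , inj₁ (y≡a , x≡b))

Edge-irrefl : ∀ {ω} (t : Decomposition ω) → Irreflexive _≡_ (Edge t)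
Edge-irrefl (t₁ ⊕ t₂)        {inj₁ x} refl e        = Edge-irrefl t₁ refl e
Edge-irrefl (t₁ ⊕ t₂)        {inj₂ x} refl e        = Edge-irrefl t₂ refl e
Edge-irrefl (recolor t a b)  refl e                 = Edge-irrefl t refl e
Edge-irrefl (addEdges t a b) refl (inj₁ e)          = Edge-irrefl t refl e
Edge-irrefl (addEdges t a b) refl (inj₂ (x≢x , _)) = x≢x refl

graph : ∀ {ω} (t : Decomposition ω) → Graph (Vertex t)
graph t = record
  { Adj        = Edge t
  ; Adj-sym    = Edge-sym t
  ; Adj-irrefl = Edge-irrefl t
  }

_IsDecompositionOf_ : ∀ {ω n} → Decomposition ω → Graph (Fin n) → Set
D IsDecompositionOf G = G ≅ graph D

-- Unit-cost random access machines with structured control flow.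
-- A program mentions finitely many registers and addresses the memory
-- indirectly.  The only arithmetic is addition and truncated subtraction:
-- with unit-cost multiplication on unbounded cells a machine could be
-- exponentially more powerful than a Turing machine.
record State : Set where
  constructor ⟨_,_⟩
  field
    reg : ℕ → ℕ
    mem : ℕ → ℕ

open State public

infixl 6 _⊞_ _⊟_
infix  4 _≔_ [_]≔_ ifnz_then_else_ whilenz_loop_
infixr 3 _⨾_

data Expr : Set where
  lit     : ℕ → Expr
  var     : ℕ → Expr
  [_]     : Expr → Expr
  _⊞_ _⊟_ : Expr → Expr → Expr

data Program : Set where
  skip            : Program
  _≔_             : ℕ → Expr → Program
  [_]≔_           : Expr → Expr → Program
  _⨾_             : Program → Program → Program
  ifnz_then_else_ : Expr → Program → Program → Program
  whilenz_loop_   : Expr → Program → Program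

eval : Expr → State → ℕ
eval (lit c)   s = c
eval (var x)   s = reg s x
eval [ e ]     s = mem s (eval e s)
eval (e₁ ⊞ e₂) s = eval e₁ s + eval e₂ s
eval (e₁ ⊟ e₂) s = eval e₁ s ∸ eval e₂ s

cost : Expr → ℕ
cost (lit c)   = 1
cost (var x)   = 1
cost [ e ]     = suc (cost e)
cost (e₁ ⊞ e₂) = suc (cost e₁ + cost e₂)
cost (e₁ ⊟ e₂) = suc (cost e₁ + cost e₂)

_[_↦_] : (ℕ → ℕ) → ℕ → ℕ → (ℕ → ℕ)
(g [ x ↦ v ]) y = if y ≡ᵇ x then v else g y

-- run p s t s′: started in s, the program p halts in s′ after time t.
data run : Program → State → ℕ → State → Set where
  run-skip   : ∀ {s} → run skip s 1 s
  run-≔      : ∀ {x e s} →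
               run (x ≔ e) s (suc (cost e)) ⟨ reg s [ x ↦ eval e s ] , mem s ⟩
  run-[]≔    : ∀ {e₁ e₂ s} →
               run ([ e₁ ]≔ e₂) s (suc (cost e₁ + cost e₂))
                   ⟨ reg s , mem s [ eval e₁ s ↦ eval e₂ s ] ⟩
  run-⨾      : ∀ {p q s s′ s″ t t′} →
               run p s t s′ → run q s′ t′ s″ → run (p ⨾ q) s (t + t′) s″
  run-then   : ∀ {e p q s s′ t} → eval e s ≢ 0 →
               run p s t s′ → run (ifnz e then p else q) s (suc (cost e + t)) s′
  run-else   : ∀ {e p q s s′ t} → eval e s ≡ 0 →
               run q s t s′ → run (ifnz e then p else q) s (suc (cost e + t)) s′
  run-repeat : ∀ {e p s s′ s″ t t′} → eval e s ≢ 0 →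
               run p s t s′ → run (whilenz e loop p) s′ t′ s″ →
               run (whilenz e loop p) s (suc (cost e + t + t′)) s″
  run-stop   : ∀ {e p s} → eval e s ≡ 0 →
               run (whilenz e loop p) s (suc (cost e)) s

-- The input occupies an initial segment of the memory; all else is zero.
contents : List ℕ → ℕ → ℕ
contents []       i       = 0
contents (x ∷ xs) zero    = x
contents (x ∷ xs) (suc i) = contents xs i

initial : List ℕ → State
initial xs = ⟨ (λ _ → 0) , contents xs ⟩

-- The answer is left in register 0.
Answers : State → Set → Set
Answers s P = (reg s 0 ≡ 1 × P) ⊎ (reg s 0 ≡ 0 × ¬ P)

-- The 2 ^ r values of f, in lexicographic order of the argument.
valueTable : ∀ r → (Vec Bool r → ℕ) → List ℕ
valueTable zero    f = f [] ∷ []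
valueTable (suc r) f = valueTable r (f ∘ (false ∷_)) ++ valueTable r (f ∘ (true ∷_))

-- Postorder, three cells per node; unused cells are zero.
encode : ∀ {ω} → Decomposition ω → List ℕ
encode (intro v a)      = 0 ∷ v ∷ toℕ a ∷ []
encode (t₁ ⊕ t₂)        = encode t₁ ++ encode t₂ ++ 1 ∷ 0 ∷ 0 ∷ []
encode (recolor t a b)  = encode t ++ 2 ∷ toℕ a ∷ toℕ b ∷ []
encode (addEdges t a b) = encode t ++ 3 ∷ toℕ a ∷ toℕ b ∷ []

input : ∀ {r ω} → (Vec Bool r → ℕ) → Decomposition ω → (k d : ℕ) → List ℕ
input {r} {ω} f D k d =
  size D ∷ ω ∷ k ∷ r ∷ d ∷ valueTable r f ++ encode D

{-# OPTIONS --safe #-}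
module Submission where

open import Data.Bool.Base using (Bool; true; false; T; _∧_; if_then_else_)
open import Data.Bool.Properties using (T-∧; T-≡)
open import Data.Empty using (⊥; ⊥-elim)
open import Data.Fin.Base using (Fin; zero; suc; toℕ; fromℕ<; _↑ˡ_; _↑ʳ_)
import Data.Fin.Properties as Fin
open import Data.Fin.Subset using (Subset; ∣_∣; _∈_)
open import Data.List.Base using (List; []; _∷_; _++_; length)
open import Data.List.Properties using (length-++)
open import Data.Nat.Base
open import Data.Nat.DivMod
open import Data.Nat.Divisibility using (divides-refl)
open import Data.Nat.Properties
open import Data.Nat.Tactic.RingSolver using (solve-∀)
open import Data.Product using (Σ-syntax; ∃-syntax; _×_; _,_; proj₁; proj₂)
import Data.Product as Product
open import Data.Sum.Base using (_⊎_; inj₁; inj₂; [_,_]′)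
import Data.Sum.Base as Sum
open import Data.Sum.Function.Propositional using (_⊎-↔_)
open import Data.Sum.Properties using (inj₁-injective; inj₂-injective)
open import Data.Unit.Base using (⊤; tt)
open import Data.Vec.Base as Vec using (Vec; []; _∷_; lookup; tabulate)
open import Data.Vec.Properties
  using (lookup∘tabulate; tabulate∘lookup; tabulate-cong; []=⇒lookup; lookup⇒[]=)
open import Function.Base using (id; _∘_)
open import Function.Bundles using (Equivalence; Inverse; _⇔_; _↔_; mk⇔; mk↔ₛ′)
open import Function.Construct.Composition using (_↔-∘_)
open import Function.Construct.Symmetry using (↔-sym)
open import Relation.Binary.Definitions using (tri<; tri≈; tri>)
open import Relation.Binary.PropositionalEquality
open import Relation.Nullary.Decidable using (yes; no)
open import Relation.Nullary.Negation using (¬_)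
open import Algebra.Properties.CommutativeMonoid.Sum +-0-commutativeMonoid
  using (sum; sum-permute; sum-cong-≗)
open import Algebra.Properties.CommutativeSemigroup +-commutativeSemigroup using (interchange)
open import Defs

-- Dynamic programming over the decomposition tree.  The profile of r vertex sets
-- records, for each set and each color, how many vertices of that color the set
-- contains.  With counts at most k there are n = (k+1)^(rω) profiles, which are
-- numbered in base k + 1, and every node gets a table of the best diversity for
-- each profile.  At a union the profiles of the children add up; recoloring moves
-- counts; and whether new edges are covered depends only on the counts and on the
-- sizes of the color classes.  All four cases fill the table by one loop over pairs
-- of profiles that compares digits, which costs n² · rω steps per node.

-- The machine can neither multiply nor divide, so a profile number cannot be decoded when its
-- digits are needed. The digits of all profiles are written to memory once, by counting up in base
-- `k + 1`; `n` is never computed as a power but is the count reached when the counter overflows.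
-- The numbers are useful beside the digits because subtraction of numerals without borrowing is
-- digitwise: the partner of `x` in a union is simply `y ∸ x`.
--
-- Counts bounded by `k` do not bound a set, as they may add up to more than `k`; the size of every
-- target set is therefore checked at every node, from digits that are being read anyway.
--
-- Later edges cannot tell vertices of one color apart, which is why counts suffice. Comparing them
-- with whole color classes requires the class sizes, which are stored with each table.
--
-- One program serves all `r`, `ω` and `k`, so sets and colors are loops and not program text. The
-- four node types differ only in the expressions plugged into one verified loop nest. Each loop
-- contributes one factor to the time; additive constants are absorbed because every factor is
-- positive, `ω` included, since a decomposition has a leaf.

open Equivalence

-- Hoare logic with time bounds

record Exec (p : Program) (s : State) (t : ℕ) (Q : State → Set) : Set where
  constructor exec
  field
    {time}  : ℕ
    {final} : State
    halts   : run p s time final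
    fast    : time ≤ t
    post    : Q final

mapExec : ∀ {p s t Q Q′} → (∀ {s′} → Q s′ → Q′ s′) → Exec p s t Q → Exec p s t Q′
mapExec g (exec h f q) = exec h f (g q)

within : ∀ {p s t t′ Q} → t ≤ t′ → Exec p s t Q → Exec p s t′ Q
within le (exec h f q) = exec h (≤-trans f le) q

infixr 3 _▸_
_▸_ : ∀ {p q s t t′ Q R} → Exec p s t Q → (∀ {s′} → Q s′ → Exec q s′ t′ R) →
  Exec (p ⨾ q) s (t + t′) R
exec h f q ▸ k with k q
... | exec h′ f′ q′ = exec (run-⨾ h h′) (+-mono-≤ f f′) q′

doSkip : ∀ {s Q} → Q s → Exec skip s 1 Q
doSkip q = exec run-skip ≤-refl q

assign : ∀ {x e s Q} → Q ⟨ reg s [ x ↦ eval e s ] , mem s ⟩ → Exec (x ≔ e) s (suc (cost e)) Q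
assign q = exec run-≔ ≤-refl q

store : ∀ {e₁ e₂ s Q} → Q ⟨ reg s , mem s [ eval e₁ s ↦ eval e₂ s ] ⟩ →
        Exec ([ e₁ ]≔ e₂) s (suc (cost e₁ + cost e₂)) Q
store q = exec run-[]≔ ≤-refl q

-- Unlike `_▸_`, this passes on the exact next state instead of an intermediate assertion, so what a
-- register holds after straight-line code is found by reduction alone.
assign⨾ : ∀ {x e q s t Q} → Exec q ⟨ reg s [ x ↦ eval e s ] , mem s ⟩ t Q →
          Exec (x ≔ e ⨾ q) s (suc (cost e) + t) Q
assign⨾ (exec h f q) = exec (run-⨾ run-≔ h) (+-monoʳ-≤ _ f) q

store⨾ : ∀ {e₁ e₂ q s t Q} → Exec q ⟨ reg s , mem s [ eval e₁ s ↦ eval e₂ s ] ⟩ t Q →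
         Exec ([ e₁ ]≔ e₂ ⨾ q) s (suc (cost e₁ + cost e₂) + t) Q
store⨾ (exec h f q) = exec (run-⨾ run-[]≔ h) (+-monoʳ-≤ _ f) q

branch-then : ∀ {e p q s t Q} → eval e s ≢ 0 → Exec p s t Q →
  Exec (ifnz e then p else q) s (suc (cost e + t)) Q
branch-then ne (exec h f q) = exec (run-then ne h) (s≤s (+-monoʳ-≤ _ f)) q

branch-else : ∀ {e p q s t Q} → eval e s ≡ 0 → Exec q s t Q →
  Exec (ifnz e then p else q) s (suc (cost e + t)) Q
branch-else eq (exec h f q) = exec (run-else eq h) (s≤s (+-monoʳ-≤ _ f)) q

-- Adding the costs of the branches, where their maximum would do, loses only a constant factor and
-- keeps the time bounds polynomial expressions.
branch : ∀ {e p q s t t′ Q} → (eval e s ≢ 0 → Exec p s t Q) → (eval e s ≡ 0 → Exec q s t′ Q) →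
         Exec (ifnz e then p else q) s (suc (cost e + (t + t′))) Q
branch {e} {s = s} {t} {t′} k₁ k₂ with eval e s ≟ 0
... | yes eq = within (s≤s (+-monoʳ-≤ (cost e) (m≤n+m t′ t))) (branch-else eq (k₂ eq))
... | no  ne = within (s≤s (+-monoʳ-≤ (cost e) (m≤m+n t t′))) (branch-then ne (k₁ ne))

-- Registers are numbered by nesting depth: a loop writes no register below
-- its own counter, so what it preserves is read off the program text.

above : ℕ → Program → Bool
above n skip                     = true
above n (x ≔ e)                  = n ≤ᵇ x
above n ([ e₁ ]≔ e₂)             = true
above n (p ⨾ q)                  = above n p ∧ above n q
above n (ifnz e then p else q)   = above n p ∧ above n q
above n (whilenz e loop p)       = above n p

-- The bound on `x` is Boolean: for literal register numbers it reduces to the unit type and is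
-- filled in automatically. Being a record, `Same` lets `n` and both states be inferred.
record Same (n : ℕ) (s s′ : State) : Set where
  constructor same
  field
    at : ∀ x {x<n : T (x <ᵇ n)} → reg s′ x ≡ reg s x

open Same

≡ᵇ-false : ∀ {m n} → m ≢ n → (m ≡ᵇ n) ≡ false
≡ᵇ-false {m} {n} m≢n with m ≡ᵇ n in eq
... | true  = ⊥-elim (m≢n (≡ᵇ⇒≡ m n (subst T (sym eq) tt)))
... | false = refl

≡ᵇ-refl : ∀ n → (n ≡ᵇ n) ≡ true
≡ᵇ-refl n = Equivalence.to T-≡ (≡⇒≡ᵇ n n refl)

update-other : ∀ (g : ℕ → ℕ) {x y} v → y ≢ x → (g [ x ↦ v ]) y ≡ g y
update-other g v y≢x rewrite ≡ᵇ-false y≢x = refl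

update-at : ∀ (g : ℕ → ℕ) x v → (g [ x ↦ v ]) x ≡ v
update-at g x v rewrite ≡ᵇ-refl x = refl

same-refl : ∀ {n s} → Same n s s
same-refl = same λ x → refl

same-trans : ∀ {n s s′ s″} → Same n s s′ → Same n s′ s″ → Same n s s″
same-trans a b = same λ x {x<n} → trans (at b x {x<n}) (at a x {x<n})

same-below : ∀ m {n} {m≤n : T (m ≤ᵇ n)} {s s′} → Same n s s′ → Same m s s′
same-below m {n} {m≤n} a = same λ x {x<m} →
  at a x {<⇒<ᵇ (<-≤-trans (<ᵇ⇒< x m x<m) (≤ᵇ⇒≤ m n m≤n))}

same-set : ∀ {n s s′ x v m} {n≤x : T (n ≤ᵇ x)} → Same n s s′ → Same n s ⟨ reg s′ [ x ↦ v ] , m ⟩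
same-set {n} {s′ = s′} {x} {v} {n≤x = n≤x} a = same λ y {y<n} →
  trans (update-other (reg s′) v (<⇒≢ (<-≤-trans (<ᵇ⇒< y n y<n) (≤ᵇ⇒≤ n x n≤x)))) (at a y {y<n})

same-put : ∀ {n s s′ x v} {n≤x : T (n ≤ᵇ x)} → Same n s s′ → Same n s ⟨ reg s′ [ x ↦ v ] , mem s′ ⟩
same-put {n≤x = n≤x} = same-set {n≤x = n≤x}

unwritten : ∀ {n p s t s′} → run p s t s′ → T (above n p) → Same n s s′
unwritten run-skip         ok = same-refl
unwritten run-≔            ok = same-set {n≤x = ok} same-refl
unwritten run-[]≔          ok = same λ x → refl
unwritten (run-⨾ h h′)     ok with Equivalence.to T-∧ ok
... | ok₁ , ok₂ = same-trans (unwritten h ok₁) (unwritten h′ ok₂)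
unwritten (run-then _ h)   ok = unwritten h (proj₁ (Equivalence.to T-∧ ok))
unwritten (run-else _ h)   ok = unwritten h (proj₂ (Equivalence.to T-∧ ok))
unwritten (run-repeat _ h h′) ok = same-trans (unwritten h ok) (unwritten h′ ok)
unwritten (run-stop _)     ok = same-refl

infix 4 for_upto_loop_
for_upto_loop_ : ℕ → ℕ → Program → Program
for x upto y loop p = x ≔ lit 0 ⨾ whilenz (var y ⊟ var x) loop (p ⨾ x ≔ var x ⊞ lit 1)

module _ {x y : ℕ} {p : Program} {s : State} {n t : ℕ} (I : ℕ → State → Set)
         {p-ok : T (above (suc x) p)} {y<x : T (y <ᵇ x)} (y≡n : reg s y ≡ n)
         (body : ∀ i s′ → i < n → Same x s s′ → reg s′ x ≡ i → I i s′ →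
                 Exec p s′ t (λ s″ → I (suc i) ⟨ reg s″ [ x ↦ suc i ] , mem s″ ⟩))
         where

  private
    later : ∀ j i s′ → j + i ≡ n → Same x s s′ → reg s′ x ≡ i → I i s′ →
            Exec (whilenz (var y ⊟ var x) loop (p ⨾ x ≔ var x ⊞ lit 1)) s′ (4 + j * (8 + t))
                 (λ s″ → Same x s s″ × I n s″)
    later zero i s′ refl s~s′ x≡i inv = exec (run-stop stop) ≤-refl (s~s′ , inv)
      where stop : reg s′ y ∸ reg s′ x ≡ 0
            stop rewrite at s~s′ y {y<x} | y≡n | x≡i = n∸n≡0 i
    later (suc j) i s′ refl s~s′ x≡i inv
      with body i s′ (s≤s (m≤n+m i j)) s~s′ x≡i inv
    ... | exec {t₁} {s″} h f inv′ with
            later j (suc i) ⟨ reg s″ [ x ↦ reg s″ x + 1 ] , mem s″ ⟩ (+-suc j i)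
              (same-set {n≤x = ≤⇒≤ᵇ (≤-refl {x})}
                (same-trans s~s′ (same-below x {suc x} {≤⇒≤ᵇ (n≤1+n x)} s′~s″)))
              (trans (update-at (reg s″) x _) x+1)
              (subst (λ v → I (suc i) ⟨ reg s″ [ x ↦ v ] , mem s″ ⟩) (sym x+1) inv′)
      where s′~s″ : Same (suc x) s′ s″
            s′~s″ = unwritten h p-ok
            x+1 : reg s″ x + 1 ≡ suc i
            x+1 = trans (+-comm (reg s″ x) 1) (cong suc (trans (at s′~s″ x {<⇒<ᵇ (n<1+n x)}) x≡i))
    ...   | exec {t₂} h′ f′ q =
      exec (run-repeat go (run-⨾ h run-≔) h′) bound q
      where go : reg s′ y ∸ reg s′ x ≢ 0
            go rewrite at s~s′ y {y<x} | y≡n | x≡i | m+n∸n≡m (suc j) i = λ ()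
            open ≤-Reasoning
            bound : suc (3 + (t₁ + 4) + t₂) ≤ 4 + suc j * (8 + t)
            bound = begin
              4 + (t₁ + 4 + t₂)                ≤⟨ +-monoʳ-≤ 4 (+-mono-≤ (+-monoˡ-≤ 4 f) f′) ⟩
              4 + (t + 4 + (4 + j * (8 + t)))  ≡⟨ cong (4 +_) (+-assoc t 4 _) ⟩
              4 + (t + (8 + j * (8 + t)))      ≡⟨ cong (4 +_) (sym (+-assoc t 8 _)) ⟩
              4 + (t + 8 + j * (8 + t))        ≡⟨ cong (λ u → 4 + (u + j * (8 + t))) (+-comm t 8) ⟩
              4 + suc j * (8 + t)              ∎

  -- Beside its body an iteration pays 4 for the test and 4 for the increment. Initialization (2)
  -- and the last test (4) add 6 once; since `1 ≤ n`, that can be charged to every iteration, whence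
  -- 14.
  for-rule : 1 ≤ n → I 0 ⟨ reg s [ x ↦ 0 ] , mem s ⟩ →
             Exec (for x upto y loop p) s (n * (14 + t)) (λ s′ → Same x s s′ × I n s′)
  for-rule 1≤n inv = within bound (assign⨾ (later n 0 _ (+-identityʳ n)
      (same-set {n≤x = ≤⇒≤ᵇ (≤-refl {x})} same-refl) (update-at (reg s) x 0) inv))
    where open ≤-Reasoning
          bound : 2 + (4 + n * (8 + t)) ≤ n * (14 + t)
          bound = begin
            6 + n * (8 + t)      ≤⟨ +-monoˡ-≤ _ (m≤n*m 6 n ⦃ >-nonZero 1≤n ⦄) ⟩
            n * 6 + n * (8 + t)  ≡⟨ *-distribˡ-+ n 6 (8 + t) ⟨
            n * (14 + t)         ∎

-- The shape of a loop body: a prologue `a`, an inner loop of `n` rounds, an epilogue `c`. With both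
-- constants moved under the factor `n`, the time of nested loops is always a product of round
-- numbers and one closed constant.
fit : ∀ n a b c → 1 ≤ n → a + (n * b + c) ≤ n * (a + (b + c))
fit n a b c 1≤n = begin
  a + (n * b + c)          ≤⟨ +-mono-≤ (m≤n*m a n) (+-monoʳ-≤ (n * b) (m≤n*m c n)) ⟩
  n * a + (n * b + n * c)  ≡⟨ cong (n * a +_) (*-distribˡ-+ n b c) ⟨
  n * a + n * (b + c)      ≡⟨ *-distribˡ-+ n a (b + c) ⟨
  n * (a + (b + c))        ∎
  where open ≤-Reasoning
        instance _ = >-nonZero 1≤n

-- The program at a node

-- The loop counters `#y`, `#x`, `#i`, `#c` are 17, 20, 23 and 26, each below all that its body
-- writes. Hence registers below 17 are constant while a frame is built, and those below 10
-- throughout the loop over the nodes.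
pattern #ans  = 0
pattern #ω    = 1
pattern #k    = 2
pattern #r    = 3
pattern #d    = 4
pattern #l    = 5
pattern #m    = 6
pattern #dg   = 7
pattern #fs   = 8
pattern #size = 9
pattern #j    = 10
pattern #pc   = 11
pattern #top  = 12
pattern #to   = 13
pattern #from = 14
pattern #t₁   = 15
pattern #t₂   = 16
pattern #y    = 17
pattern #py   = 18
pattern #gmax = 19
pattern #x    = 20
pattern #px   = 21
pattern #best = 22
pattern #i    = 23
pattern #o    = 24
pattern #acc  = 25
pattern #c    = 26
pattern #bad  = 27
pattern #sz   = 28

-- The entry of a node's table at a target profile y is the maximum of value over
-- the source profiles x for which test holds at every set i and color c, and
-- guard holds.  The new count of a color is kept (if keepIf ≠ 0) plus added (if
-- addUnless = 0).
record Code : Set where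
  field
    test guard value                 : Expr
    keepIf kept addUnless added      : Expr
    origin                           : Expr

open Code

colorStep : Code → Program
colorStep q =
  #bad ≔ var #bad ⊞ test q ⨾
  #sz ≔ var #sz ⊞ [ var #py ⊞ var #o ⊞ var #c ]

-- `#bad` collects failed tests and excess sizes alike; as nothing is ever subtracted from it, it
-- ends at zero iff everything passed. `#acc` reads the digits of color `#to` as bits by Horner's
-- rule, which at a leaf yields the position of the membership vector in the value table.
setStep : Code → Program
setStep q =
  #sz ≔ lit 0 ⨾
  (for #c upto #ω loop colorStep q) ⨾
  #bad ≔ var #bad ⊞ (var #sz ⊟ var #k) ⨾
  #acc ≔ var #acc ⊞ var #acc ⊞ [ var #py ⊞ var #o ⊞ var #to ] ⨾
  #o ≔ var #o ⊞ var #ω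

-- For lack of a maximum operation, `a ⊞ (b ⊟ a)` is used: truncated subtraction makes it the larger
-- of `a` and `b`. The added 1 is the shift that reserves 0 for an empty set of candidates.
sourceStep : Code → Program
sourceStep q =
  #o ≔ lit 0 ⨾
  #acc ≔ lit 0 ⨾
  #bad ≔ lit 0 ⨾
  (for #i upto #r loop setStep q) ⨾
  (ifnz var #bad ⊞ guard q
   then skip
   else (#best ≔ value q ⊞ lit 1 ⊞ (var #best ⊟ (value q ⊞ lit 1)))) ⨾
  #px ≔ var #px ⊞ var #l

-- `#gmax` is the maximum over all target profiles of the current node. It is reset for each frame;
-- after the root, the last node in postorder, it decides the answer.
targetStep : Code → Program
targetStep q =
  #px ≔ var #dg ⨾
  #best ≔ lit 0 ⨾
  (for #x upto #m loop sourceStep q) ⨾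
  [ var #top ⊞ var #y ]≔ var #best ⨾
  #gmax ≔ var #best ⊞ (var #gmax ⊟ var #best) ⨾
  #py ≔ var #py ⊞ var #l

countStep : Code → Program
countStep q =
  (ifnz keepIf q then (#sz ≔ kept q) else (#sz ≔ lit 0)) ⨾
  (ifnz addUnless q then skip else (#sz ≔ var #sz ⊞ added q)) ⨾
  [ var #top ⊞ var #m ⊞ var #c ]≔ var #sz

-- A frame consists of the table, the color counts, and the address where the
-- frames of the whole subtree begin: the frame of the left child of a union ends
-- where those of the right subtree begin.
frame : Code → Program
frame q =
  #gmax ≔ lit 0 ⨾
  #py ≔ var #dg ⨾
  (for #y upto #m loop targetStep q) ⨾
  (for #c upto #ω loop countStep q) ⨾
  [ var #top ⊞ var #m ⊞ var #ω ]≔ origin q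

-- Bounded sums, binary evaluation and maxima

sum< : ℕ → (ℕ → ℕ) → ℕ
sum< zero    g = 0
sum< (suc n) g = sum< n g + g n

-- Binary evaluation with `h 0` as the most significant digit, in agreement with the lexicographic
-- order of the value table.
horner : (ℕ → ℕ) → ℕ → ℕ
horner h zero    = 0
horner h (suc n) = horner h n + horner h n + h n

-- Maxima are shifted by one: 0 stands for the maximum of the empty set.
Best : (ℕ → Set) → ℕ → Set
Best P b = (∀ v → P v → v < b) × (∀ v → b ≡ suc v → P v)

best-none : ∀ {P} → (∀ v → ¬ P v) → Best P 0
best-none ¬P = (λ v p → ⊥-elim (¬P v p)) , (λ v ())

best-transfer : ∀ {P Q b} → (∀ v → P v → ∃[ u ] v ≤ u × Q u) → (∀ v → Q v → P v) →
  Best Q b → Best P b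
best-transfer up down (ub , at) =
  (λ v p → let u , v≤u , q = up v p in ≤-<-trans v≤u (ub u q)) ,
  (λ v eq → down v (at v eq))

m+[n∸m]-cases : ∀ m n → (m + (n ∸ m) ≡ m × n ≤ m) ⊎ (m + (n ∸ m) ≡ n × m ≤ n)
m+[n∸m]-cases m n with ≤-total n m
... | inj₁ n≤m = inj₁ (trans (cong (m +_) (m≤n⇒m∸n≡0 n≤m)) (+-identityʳ m) , n≤m)
... | inj₂ m≤n = inj₂ (m+[n∸m]≡n m≤n , m≤n)

-- `c + (b ∸ c)` is the maximum in the form in which the program computes it. Thanks to the shift,
-- an empty side has bound 0 and needs no case of its own.
best-⊎ : ∀ {P Q b c} → Best P b → Best Q c → Best (λ v → P v ⊎ Q v) (c + (b ∸ c))
best-⊎ {b = b} {c} (ubP , atP) (ubQ , atQ) with m+[n∸m]-cases c b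
... | inj₁ (eq , b≤c) rewrite eq =
  (λ { v (inj₁ p) → <-≤-trans (ubP v p) b≤c ; v (inj₂ p) → ubQ v p }) , λ v e → inj₂ (atQ v e)
... | inj₂ (eq , c≤b) rewrite eq =
  (λ { v (inj₁ p) → ubP v p ; v (inj₂ p) → <-≤-trans (ubQ v p) c≤b }) , λ v e → inj₁ (atP v e)

best-single : ∀ v → Best (_≡ v) (suc v)
best-single v = (λ { _ refl → ≤-refl }) , λ { u refl → refl }

best-cong : ∀ {P Q b} → (∀ v → P v → Q v) → (∀ v → Q v → P v) → Best P b → Best Q b
best-cong f g = best-transfer (λ v q → v , ≤-refl , g v q) f

sum-zero : ∀ m n → m + n ≡ 0 ⇔ (m ≡ 0 × n ≡ 0)
sum-zero m n = mk⇔ (λ e → m+n≡0⇒m≡0 m e , m+n≡0⇒n≡0 m e) λ { (refl , refl) → refl }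

monus-zero : ∀ m n → m ∸ n ≡ 0 ⇔ m ≤ n
monus-zero m n = mk⇔ m∸n≡0⇒m≤n m≤n⇒m∸n≡0

-- The numerals are the costs of straight-line code; 14 is the overhead of one
-- iteration in for-rule.
module Cost (q : Code) where
  colorCost setCost updateCost sourceCost targetCost countCost frameCost : ℕ
  colorCost  = 14 + (suc (cost (var #bad ⊞ test q)) + 9)
  setCost    = 14 + (2 + (colorCost + 21) + 0)
  updateCost = suc (cost (var #bad ⊞ guard q) +
                    (1 + suc (cost (value q ⊞ lit 1 ⊞ (var #best ⊟ (value q ⊞ lit 1))))))
  sourceCost = 14 + (6 + (setCost + (updateCost + 4)) + 0)
  targetCost = 14 + (4 + (sourceCost + 15) + 0)
  countCost  = 14 + (suc (cost (keepIf q) + (suc (cost (kept q)) + 2)) +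
                    (suc (cost (addUnless q) + (1 + suc (cost (var #sz ⊞ added q)))) + 7))
  frameCost  = 4 + (targetCost + (countCost + (6 + cost (origin q))))

-- Correctness and running time of the frame program

record Consts (s : State) (r ω k n l dg top α : ℕ) : Set where
  field
    is-r   : reg s #r ≡ r
    is-ω   : reg s #ω ≡ ω
    is-k   : reg s #k ≡ k
    is-m   : reg s #m ≡ n
    is-l   : reg s #l ≡ l
    is-dg  : reg s #dg ≡ dg
    is-top : reg s #top ≡ top
    is-a   : reg s #to ≡ α

below-suc : ∀ {P : ℕ → Set} {n} → (∀ i → i < n → P i) → P n → ∀ i → i < suc n → P i
below-suc {P} {n} f p i i<1+n with i ≟ n
... | yes refl = p
... | no  i≢n  = f i (≤∧≢⇒< (≤-pred i<1+n) i≢n)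

Some< : ℕ → (ℕ → ℕ → Set) → ℕ → Set
Some< n P v = Σ[ x ∈ ℕ ] (x < n × P x v)

some-step : ∀ {P n v} → Some< n P v → Some< (suc n) P v
some-step (x , x<n , p) = x , m<n⇒m<1+n x<n , p

some-last : ∀ {P n v} → Some< (suc n) P v → Some< n P v ⊎ P n v
some-last {n = n} (x , x<1+n , p) with x ≟ n
... | yes refl = inj₂ p
... | no  x≢n  = inj₁ (x , ≤∧≢⇒< (≤-pred x<1+n) x≢n , p)

-- All stores go to `top` and beyond, whereas by `static` the digits lie below `top`; so no digit is
-- overwritten before it is read. `α` is the color whose digits are accumulated as bits, and `α<ω`
-- keeps that read within the row of its set.
module Frame
  (q : Code) (s₀ : State) (r ω k n l dg top α : ℕ)
  (consts : Consts s₀ r ω k n l dg top α)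
  (1≤r : 1 ≤ r) (1≤ω : 1 ≤ ω) (1≤n : 1 ≤ n) (α<ω : α < ω)
  (cell : ℕ → ℕ → ℕ → ℕ)
  (static : ∀ y i c → y < n → i < r → c < ω →
            dg + y * l + i * ω + c < top × mem s₀ (dg + y * l + i * ω + c) ≡ cell y i c)
  where

  open Consts consts
  open Cost q public

  Unchanged : State → Set
  Unchanged s = ∀ a → a < top → mem s a ≡ mem s₀ a

  fetch : ∀ {s y i c} → Unchanged s → y < n → i < r → c < ω →
    mem s (dg + y * l + i * ω + c) ≡ cell y i c
  fetch {y = y} {i} {c} unch y<n i<r c<ω = let a<top ,
                                                 eq = static y i c y<n i<r c<ω in trans
                                                   (unch _ a<top) eq

  record Pair (s : State) (x y : ℕ) : Set where
    field
      consts-x  : Same 17 s₀ s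
      unchanged : Unchanged s
      is-x      : reg s #x ≡ x
      is-px     : reg s #px ≡ dg + x * l
      is-y      : reg s #y ≡ y
      is-py     : reg s #py ≡ dg + y * l

  Selection : ℕ → ℕ → ℕ → ℕ
  Selection y c = horner (λ i → cell y i c)

  module Correct
    (Pass : (x y i c : ℕ) → Set) (Ok : (x y : ℕ) → Set) (val : (x y : ℕ) → ℕ)
      (old new : ℕ → ℕ) (org : ℕ)
    (test-ok : ∀ {s x y i c} → Pair s x y → reg s #o ≡ i * ω → reg s #c ≡ c →
               x < n → y < n → i < r → c < ω → eval (test q) s ≡ 0 ⇔ Pass x y i c)
    (guard-ok : ∀ {s x y} → Pair s x y → x < n → y < n → eval (guard q) s ≡ 0 ⇔ Ok x y)
    -- Unless all digits pass, value may read outside the value table.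
    (value-ok : ∀ {s x y} → Pair s x y → reg s #acc ≡ Selection y α r → x < n → y < n →
                (∀ i → i < r → (∀ c → c < ω → Pass x y i c) × sum< ω (cell y i) ≤ k) →
                eval (value q) s ≡ val x y)
    (kept-ok : ∀ {s c} → Same 17 s₀ s → Unchanged s → reg s #c ≡ c → c < ω →
               (eval (keepIf q) s ≢ 0 → eval (kept q) s ≡ old c) ×
                 (eval (keepIf q) s ≡ 0 → 0 ≡ old c))
    (added-ok : ∀ {s c} → Same 17 s₀ s → Unchanged s → reg s #c ≡ c → c < ω →
                (eval (addUnless q) s ≢ 0 → 0 ≡ new c) ×
                  (eval (addUnless q) s ≡ 0 → eval (added q) s ≡ new c))
    (origin-ok : ∀ {s} → Same 17 s₀ s → Unchanged s → eval (origin q) s ≡ org)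
    where

    SizeOk : ℕ → ℕ → Set
    SizeOk y i = sum< ω (cell y i) ≤ k

    pair-set : ∀ {s x y z v} → T (22 ≤ᵇ z) → Pair s x y → Pair ⟨ reg s [ z ↦ v ] , mem s ⟩ x y
    pair-set {s} {z = z} {v} 22≤z p = record
      { consts-x = same-put {n≤x = ≤⇒≤ᵇ (≤-trans (≤ᵇ⇒≤ 17 22 tt) (≤ᵇ⇒≤ 22 z 22≤z))} consts-x
      ; unchanged = unchanged
      ; is-x = trans (at s~ #x) is-x ; is-px = trans (at s~ #px) is-px
      ; is-y = trans (at s~ #y) is-y ; is-py = trans (at s~ #py) is-py }
      where open Pair p
            s~ : Same 22 s ⟨ reg s [ z ↦ v ] , mem s ⟩
            s~ = same-put {n≤x = 22≤z} same-refl

    pair-same : ∀ {s s′ x y} → Same 22 s s′ → mem s′ ≡ mem s → Pair s x y → Pair s′ x y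
    pair-same s~ refl p = record
      { consts-x = same-trans consts-x (same-below 17 s~)
      ; unchanged = unchanged
      ; is-x = trans (at s~ #x) is-x ; is-px = trans (at s~ #px) is-px
      ; is-y = trans (at s~ #y) is-y ; is-py = trans (at s~ #py) is-py }
      where open Pair p

    color-loop : ∀ {s x y i} → Pair s x y → reg s #o ≡ i * ω → x < n → y < n → i < r →
      reg s #sz ≡ 0 →
      Exec (for #c upto #ω loop colorStep q) s (ω * colorCost)
        (λ s′ → Same 26 s s′ × mem s′ ≡ mem s ×
                (reg s′ #bad ≡ 0 ⇔ (reg s #bad ≡ 0 × (∀ c → c < ω → Pass x y i c))) ×
                reg s′ #sz ≡ sum< ω (cell y i))
    color-loop {s} {x} {y} {i} p o≡ x<n y<n i<r sz≡0 =
      for-rule I (trans (at (Pair.consts-x p) #ω) is-ω) body 1≤ω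
        (refl , mk⇔ (λ e → e , λ _ ()) proj₁ , sz≡0)
      where
        I : ℕ → State → Set
        I c s′ = mem s′ ≡ mem s ×
                 (reg s′ #bad ≡ 0 ⇔ (reg s #bad ≡ 0 × (∀ c′ → c′ < c → Pass x y i c′))) ×
                 reg s′ #sz ≡ sum< c (cell y i)
        body : ∀ c s′ → c < ω → Same 26 s s′ → reg s′ #c ≡ c → I c s′ →
               Exec (colorStep q) s′ (suc (cost (var #bad ⊞ test q)) + 9)
                    (λ s″ → I (suc c) ⟨ reg s″ [ #c ↦ suc c ] , mem s″ ⟩)
        body c s′ c<ω s~ c≡ (m≡ , bad⇔ , sz≡) =
          assign⨾ (assign (m≡ , bad′ , cong₂ _+_ sz≡ cell≡))
          where
            p′ : Pair s′ x y
            p′ = pair-same (same-below 22 s~) m≡ p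
            o≡′ : reg s′ #o ≡ i * ω
            o≡′ = trans (at s~ #o) o≡
            test⇔ : eval (test q) s′ ≡ 0 ⇔ Pass x y i c
            test⇔ = test-ok p′ o≡′ c≡ x<n y<n i<r c<ω
            bad′ : reg s′ #bad + eval (test q) s′ ≡ 0 ⇔
                   (reg s #bad ≡ 0 × (∀ c′ → c′ < suc c → Pass x y i c′))
            bad′ = mk⇔
              (λ e → let e₁ , e₂ = to (sum-zero _ _) e ; b , f = to bad⇔ e₁ in
                     b , below-suc f (to test⇔ e₂))
              (λ (b , f) → from (sum-zero _ _)
                (from bad⇔ (b , λ c′ c′<c → f c′ (m<n⇒m<1+n c′<c)) , from test⇔ (f c (n<1+n c))))
            cell≡ : mem s′ (reg s′ #py + reg s′ #o + reg s′ #c) ≡ cell y i c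
            cell≡ rewrite Pair.is-py p′ | o≡′ | c≡ = fetch {s′} (Pair.unchanged p′) y<n i<r c<ω

    set-loop : ∀ {s x y} → Pair s x y → reg s #o ≡ 0 → reg s #acc ≡ 0 → reg s #bad ≡ 0 →
      x < n → y < n →
      Exec (for #i upto #r loop setStep q) s (r * (ω * setCost))
        (λ s′ → Same 23 s s′ × mem s′ ≡ mem s ×
                (reg s′ #bad ≡ 0 ⇔ (∀ i → i < r → (∀ c → c < ω → Pass x y i c) × SizeOk y i)) ×
                reg s′ #acc ≡ Selection y α r)
    set-loop {s} {x} {y} p o≡0 acc≡0 bad≡0 x<n y<n =
      -- The overhead 14 of an iteration over the sets is absorbed into the `ω` rounds of its body;
      -- the summand 0 merely gives the body the shape that `fit` expects.
      within (*-monoʳ-≤ r (fit ω 14 (2 + (colorCost + 21)) 0 1≤ω))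
       (mapExec (λ (s~ , m≡ , _ , acc≡ , bad⇔) → s~ , m≡ , bad⇔ , acc≡)
       (for-rule I (trans (at (Pair.consts-x p) #r) is-r) body 1≤r
        (refl , o≡0 , acc≡0 , mk⇔ (λ _ _ ()) (λ _ → bad≡0))))
      where
        I : ℕ → State → Set
        I i s′ = mem s′ ≡ mem s × reg s′ #o ≡ i * ω × reg s′ #acc ≡ Selection y α i ×
                 (reg s′ #bad ≡ 0 ⇔ (∀ i′ → i′ < i → (∀ c → c < ω → Pass x y i′ c) × SizeOk y i′))
        body : ∀ i s′ → i < r → Same 23 s s′ → reg s′ #i ≡ i → I i s′ →
               Exec (setStep q) s′ (ω * (2 + (colorCost + 21)) + 0)
                    (λ s″ → I (suc i) ⟨ reg s″ [ #i ↦ suc i ] , mem s″ ⟩)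
        body i s′ i<r s~ i≡ (m≡ , o≡ , acc≡ , bad⇔) =
          within (≤-trans (fit ω 2 colorCost 21 1≤ω) (m≤m+n _ 0))
          (assign⨾ (color-loop (pair-set tt p′) o≡ x<n y<n i<r refl ▸
            λ {s″} (s~₂ , m≡₂ , bad⇔₂ , sz≡) →
           let u≡ = trans m≡₂ m≡
               cell≡ : mem s″ (reg s″ #py + reg s″ #o + reg s″ #to) ≡ cell y i α
               cell≡ = trans (cong₂ (λ f a → f a) u≡
                         (cong₂ _+_ (cong₂ _+_ (trans (at s~₂ #py) (Pair.is-py p′))
                           (trans (at s~₂ #o) o≡))
                                    (trans (at s~₂ #to) (trans (at (Pair.consts-x p′) #to) is-a))))
                         (fetch {s} (Pair.unchanged p) y<n i<r α<ω)
               bad′ : reg s″ #bad + (reg s″ #sz ∸ reg s″ #k) ≡ 0 ⇔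
                      (∀ i′ → i′ < suc i → (∀ c → c < ω → Pass x y i′ c) × SizeOk y i′)
               bad′ = subst₂ (λ u v → reg s″ #bad + (u ∸ v) ≡ 0 ⇔
                        (∀ i′ → i′ < suc i → (∀ c → c < ω → Pass x y i′ c) × SizeOk y i′))
                        (sym sz≡) (sym (trans (at s~₂ #k) (trans (at (Pair.consts-x p′) #k) is-k)))
                        (mk⇔
                          (λ e → let e₁ , e₂ = to (sum-zero _ _) e ; b , f = to bad⇔₂ e₁ in
                                 below-suc (to bad⇔ b) (f , to (monus-zero _ _) e₂))
                          (λ f → from (sum-zero _ _)
                            (from bad⇔₂ (from bad⇔ (λ i′ i′<i → f i′ (m<n⇒m<1+n i′<i)) ,
                              proj₁ (f i (n<1+n i))) ,
                             from (monus-zero _ _) (proj₂ (f i (n<1+n i))))))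
           in assign⨾ (assign⨾ (assign
                ( u≡
                , trans (cong₂ _+_ (trans (at s~₂ #o) o≡)
                  (trans (at s~₂ #ω) (trans (at (Pair.consts-x p′) #ω) is-ω)))
                        (+-comm (i * ω) ω)
                , cong₂ _+_ (cong₂ _+_ (trans (at s~₂ #acc) acc≡) (trans (at s~₂ #acc) acc≡)) cell≡
                , bad′)))))
          where p′ : Pair s′ x y
                p′ = pair-same (same-below 22 s~) m≡ p

    Selected : ℕ → ℕ → ℕ → Set
    Selected y x v = (∀ i → i < r → (∀ c → c < ω → Pass x y i c) × SizeOk y i) ×
      Ok x y × v ≡ val x y

    source-loop : ∀ {s y} → Same 17 s₀ s → Unchanged s → reg s #y ≡ y → reg s #py ≡ dg + y * l →
      reg s #px ≡ dg → reg s #best ≡ 0 → y < n →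
      Exec (for #x upto #m loop sourceStep q) s (n * (r * ω) * sourceCost)
        (λ s′ → Same 20 s s′ × mem s′ ≡ mem s × Best (Some< n (Selected y)) (reg s′ #best))
    source-loop {s} {y} s₀~s unch y≡ py≡ px≡ best≡ y<n =
      within (≤-trans (*-monoʳ-≤ n (fit (r * ω) 14 (6 + (setCost + (updateCost + 4))) 0 1≤rω))
                      (≤-reflexive (sym (*-assoc n (r * ω) sourceCost))))
        (mapExec (λ (s~ , m≡ , _ , b) → s~ , m≡ , b)
          (for-rule I (trans (at s₀~s #m) is-m) body 1≤n
            (refl , trans px≡ (sym (+-identityʳ dg)) ,
             subst (Best (Some< 0 (Selected y))) (sym best≡) (best-none λ { v (_ , () , _) }))))
      where
        1≤rω : 1 ≤ r * ω
        1≤rω = *-mono-≤ 1≤r 1≤ω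
        I : ℕ → State → Set
        I x s′ = mem s′ ≡ mem s × reg s′ #px ≡ dg + x * l ×
          Best (Some< x (Selected y)) (reg s′ #best)
        body : ∀ x s′ → x < n → Same 20 s s′ → reg s′ #x ≡ x → I x s′ →
               Exec (sourceStep q) s′ (r * ω * (6 + (setCost + (updateCost + 4))) + 0)
                    (λ s″ → I (suc x) ⟨ reg s″ [ #x ↦ suc x ] , mem s″ ⟩)
        body x s′ x<n s~ x≡ (m≡ , px≡ , best) =
          within (≤-trans (≤-trans (+-monoʳ-≤ 6
            (+-monoˡ-≤ (updateCost + 4) (≤-reflexive (sym (*-assoc r ω setCost)))))
                                   (fit (r * ω) 6 setCost (updateCost + 4) 1≤rω)) (m≤m+n _ 0))
          (assign⨾ (assign⨾ (assign⨾ (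
            set-loop (pair-set tt (pair-set tt (pair-set tt p))) refl refl refl x<n y<n ▸
            λ {s″} (s~₂ , m≡₂ , bad⇔ , acc≡) →
              let p″ : Pair s″ x y
                  p″ = pair-same (same-below 22 s~₂) m≡₂ (pair-set tt (pair-set tt (pair-set tt p)))
                  best″ : Best (Some< x (Selected y)) (reg s″ #best)
                  best″ = subst (Best _) (sym (at s~₂ #best)) best
                  val≡ : reg s″ #bad ≡ 0 → eval (value q) s″ + 1 ≡ suc (val x y)
                  val≡ bad≡0 = trans (+-comm _ 1)
                    (cong suc (value-ok p″ acc≡ x<n y<n (to bad⇔ bad≡0)))
                  next : ∀ {s‴} → mem s‴ ≡ mem s″ → Same 22 s″ s‴ →
                         Best (Some< (suc x) (Selected y)) (reg s‴ #best) →
                         Exec (#px ≔ var #px ⊞ var #l) s‴ 4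
                              (λ s″ → I (suc x) ⟨ reg s″ [ #x ↦ suc x ] , mem s″ ⟩)
                  next m≡₃ s~₃ b = assign (trans m≡₃ (trans m≡₂ m≡) ,
                    trans (cong₂ _+_ (trans (at s~₃ #px) (Pair.is-px p″))
                            (trans (at s~₃ #l) (trans (at (Pair.consts-x p″) #l) is-l)))
                          (trans (+-assoc dg (x * l) l) (cong (dg +_) (+-comm (x * l) l))) , b)
              in _▸_ {Q = λ s‴ → mem s‴ ≡ mem s″ × Same 22 s″ s‴ ×
                                   Best (Some< (suc x) (Selected y)) (reg s‴ #best)}
                 (branch
                   -- A rejected source leaves the maximum valid: were it selected, `#bad` and the
                   -- guard would both vanish, against the branch taken.
                   (λ ne → doSkip (refl , same-refl , best-cong (λ v → some-step {P = Selected y})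
                      (λ v → λ { (x′ , x′<1+x , sel) → [ id ,
                          (λ { (all , ok , _) → ⊥-elim
                            (ne (from (sum-zero _ _) (from bad⇔ all ,
                              from (guard-ok p″ x<n y<n) ok))) }) ]′
                        (some-last {P = Selected y} (x′ , x′<1+x , sel)) }) best″))
                   (λ eq → assign (refl , same-put same-refl ,
                      subst (λ u → Best (Some< (suc x) (Selected y)) (u + (reg s″ #best ∸ u)))
                        (sym (val≡ (proj₁ (to (sum-zero _ _) eq))))
                        (best-cong (λ v → [ some-step {P = Selected y} ,
                          (λ { refl → x , n<1+n x , to bad⇔ (proj₁ (to (sum-zero _ _) eq)) ,
                             to (guard-ok p″ x<n y<n) (proj₂ (to (sum-zero _ _) eq)) , refl }) ]′)
                          (λ v h → [ inj₁ , (λ { (_ , _ , e) → inj₂ e }) ]′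
                            (some-last {P = Selected y} h))
                          (best-⊎ best″ (best-single (val x y)))))))
                 λ (m≡₃ , s~₃ , b) → next m≡₃ s~₃ b))))
          where p : Pair s′ x y
                p = record
                  { consts-x = same-trans s₀~s (same-below 17 s~)
                  ; unchanged = λ a a<top → trans (cong (λ f → f a) m≡) (unch a a<top)
                  ; is-x = x≡ ; is-px = px≡
                  ; is-y = trans (at s~ #y) y≡ ; is-py = trans (at s~ #py) py≡ }

    Table : ℕ → (ℕ → ℕ) → Set
    Table y m = ∀ y′ → y′ < y → Best (Some< n (Selected y′)) (m (top + y′))

    Overall : ℕ → ℕ → Set
    Overall y v = Some< y (λ y′ → Some< n (Selected y′)) v

    top-store : ∀ {s a v} → Unchanged s → Unchanged ⟨ reg s , mem s [ top + a ↦ v ] ⟩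
    top-store {s} {a} unch b b<top =
      trans (update-other (mem s) _ (<⇒≢ (<-≤-trans b<top (m≤m+n top a)))) (unch b b<top)

    target-loop : ∀ {s} → Same 17 s₀ s → Unchanged s → reg s #py ≡ dg → reg s #gmax ≡ 0 →
      Exec (for #y upto #m loop targetStep q) s (n * (n * (r * ω)) * targetCost)
        (λ s′ → Same 17 s s′ × Unchanged s′ × Table n (mem s′) × Best (Overall n) (reg s′ #gmax))
    target-loop {s} s₀~s unch py≡ gmax≡ =
      within (≤-trans (*-monoʳ-≤ n (fit (n * (r * ω)) 14 (4 + (sourceCost + 15)) 0 1≤w))
                      (≤-reflexive (sym (*-assoc n (n * (r * ω)) targetCost))))
        (mapExec (λ (s~ , u , _ , t , b) → s~ , u , t , b)
          (for-rule I (trans (at s₀~s #m) is-m) body 1≤n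
            (unch , trans py≡ (sym (+-identityʳ dg)) , (λ y ()) ,
             subst (Best (Overall 0)) (sym gmax≡) (best-none λ { v (_ , () , _) }))))
      where
        1≤w : 1 ≤ n * (r * ω)
        1≤w = *-mono-≤ 1≤n (*-mono-≤ 1≤r 1≤ω)
        I : ℕ → State → Set
        I y s′ = Unchanged s′ × reg s′ #py ≡ dg + y * l × Table y (mem s′) ×
          Best (Overall y) (reg s′ #gmax)
        body : ∀ y s′ → y < n → Same 17 s s′ → reg s′ #y ≡ y → I y s′ →
               Exec (targetStep q) s′ (n * (r * ω) * (4 + (sourceCost + 15)) + 0)
                    (λ s″ → I (suc y) ⟨ reg s″ [ #y ↦ suc y ] , mem s″ ⟩)
        body y s′ y<n s~ y≡ (unch′ , py≡′ , table , gmax) =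
          within (≤-trans (fit (n * (r * ω)) 4 sourceCost 15 1≤w) (m≤m+n _ 0))
          (assign⨾ (assign⨾ (
            source-loop (same-put (same-put (same-trans s₀~s s~))) unch′ y≡ py≡′
                        (trans (at s~ #dg) (trans (at s₀~s #dg) is-dg)) refl y<n ▸
            λ {s″} (s~₂ , m≡₂ , best) →
              let s₀~s″ : Same 17 s₀ s″
                  s₀~s″ = same-trans (same-put (same-put (same-trans s₀~s s~))) (same-below 17 s~₂)
                  unch″ : Unchanged s″
                  unch″ = λ a a<top → trans (cong (λ f → f a) m≡₂) (unch′ a a<top)
                  addr≡ : top + y ≡ reg s″ #top + reg s″ #y
                  addr≡ = sym (cong₂ _+_ (trans (at s₀~s″ #top) is-top) (trans (at s~₂ #y) y≡))
                  m‴ : ℕ → ℕ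
                  m‴ = mem s″ [ reg s″ #top + reg s″ #y ↦ reg s″ #best ]
                  table′ : Table (suc y) m‴
                  table′ = subst (λ a → Table (suc y) (mem s″ [ a ↦ reg s″ #best ])) addr≡
                    (below-suc
                      (λ y′ y′<y → subst (Best _)
                         (sym (trans (update-other (mem s″) _
                           (λ e → <⇒≢ y′<y (+-cancelˡ-≡ top _ _ e)))
                             (cong (λ f → f (top + y′)) m≡₂)))
                         (table y′ y′<y))
                      (subst (Best _) (sym (update-at (mem s″) (top + y) _)) best))
              in store⨾ (assign⨾ (assign
                   ( subst (λ a → Unchanged ⟨ reg s″ , mem s″ [ a ↦ reg s″ #best ] ⟩) addr≡
                     (top-store {s″} unch″)
                   , trans (cong₂ _+_ (trans (at s~₂ #py) py≡′) (trans (at s₀~s″ #l) is-l))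
                           (trans (+-assoc dg (y * l) l) (cong (dg +_) (+-comm (y * l) l)))
                   , table′
                   , best-cong (λ v → [ some-step {P = λ y′ → Some< n (Selected y′)} ,
                     (λ h → y , n<1+n y , h) ]′)
                               (λ v → some-last {P = λ y′ → Some< n (Selected y′)})
                               (best-⊎ (subst (Best _) (sym (at s~₂ #gmax)) gmax) best)))))))

    count-loop : ∀ {s} → Same 17 s₀ s → Unchanged s → Table n (mem s) →
      Exec (for #c upto #ω loop countStep q) s (ω * countCost)
        (λ s′ → Same 26 s s′ × Unchanged s′ × Table n (mem s′) ×
                (∀ c → c < ω → mem s′ (top + n + c) ≡ old c + new c))
    count-loop {s} s₀~s unch table =
      for-rule I (trans (at s₀~s #ω) is-ω) body 1≤ω (unch , table , λ c ())
      where
        I : ℕ → State → Set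
        I c s′ = Unchanged s′ × Table n (mem s′) ×
          (∀ c′ → c′ < c → mem s′ (top + n + c′) ≡ old c′ + new c′)
        body : ∀ c s′ → c < ω → Same 26 s s′ → reg s′ #c ≡ c → I c s′ →
               Exec (countStep q) s′ (suc (cost (keepIf q) + (suc (cost (kept q)) + 2)) +
                      (suc (cost (addUnless q) + (1 + suc (cost (var #sz ⊞ added q)))) + 7))
                    (λ s″ → I (suc c) ⟨ reg s″ [ #c ↦ suc c ] , mem s″ ⟩)
        body c s′ c<ω s~ c≡ (unch′ , table′ , counts) =
          _▸_ {Q = λ s″ → Same 28 s′ s″ × mem s″ ≡ mem s′ × reg s″ #sz ≡ old c}
            (branch (λ ne → assign (same-put same-refl , refl ,
              proj₁ (kept-ok s₀~s′ unch′ c≡ c<ω) ne))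
                    (λ eq → assign (same-put same-refl , refl ,
                      proj₂ (kept-ok s₀~s′ unch′ c≡ c<ω) eq)))
            λ {s″} (s~₂ , m≡₂ , sz≡) →
              let s₀~s″ = same-trans s₀~s′ (same-below 17 s~₂)
                  unch″ : Unchanged s″
                  unch″ = λ a a<top → trans (cong (λ f → f a) m≡₂) (unch′ a a<top)
                  c≡″ = trans (at s~₂ #c) c≡
              in _▸_ {Q = λ s‴ → Same 28 s′ s‴ × mem s‴ ≡ mem s′ × reg s‴ #sz ≡ old c + new c}
                 (branch (λ ne → doSkip (s~₂ , m≡₂ , trans sz≡ (trans (sym (+-identityʳ (old c)))
                                   (cong (old c +_) (proj₁ (added-ok s₀~s″ unch″ c≡″ c<ω) ne)))))
                         (λ eq → assign (same-put s~₂ , m≡₂ ,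
                                   cong₂ _+_ sz≡ (proj₂ (added-ok s₀~s″ unch″ c≡″ c<ω) eq))))
                 λ {s‴} (s~₃ , m≡₃ , sz≡₃) →
                   let addr≡ : top + n + c ≡ reg s‴ #top + reg s‴ #m + reg s‴ #c
                       addr≡ = sym (cong₂ _+_ (cong₂ _+_
                         (trans (at s~₃ #top) (trans (at s₀~s′ #top) is-top))
                                                         (trans (at s~₃ #m) (trans
                                                           (at s₀~s′ #m) is-m)))
                                              (trans (at s~₃ #c) c≡))
                       keep : ∀ {a} → a ≢ top + n + c →
                         (mem s‴ [ top + n + c ↦ reg s‴ #sz ]) a ≡ mem s′ a
                       keep {a} a≢ = trans (update-other (mem s‴) _ a≢) (cong (λ f → f a) m≡₃)
                   in store (subst (λ a → I (suc c) ⟨ reg s‴ [ #c ↦ suc c ] ,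
                     mem s‴ [ a ↦ reg s‴ #sz ] ⟩) addr≡
                     ( (λ a a<top → trans (keep
                       (<⇒≢ (<-≤-trans a<top (≤-trans (m≤m+n top n) (m≤m+n (top + n) c)))))
                         (unch′ a a<top))
                     , (λ y y<n → subst (Best _)
                       (sym (keep (<⇒≢ (<-≤-trans (+-monoʳ-< top y<n) (m≤m+n (top + n) c)))))
                         (table′ y y<n))
                     , below-suc (λ c′ c′<c → trans
                       (keep (λ e → <⇒≢ c′<c (+-cancelˡ-≡ (top + n) _ _ e))) (counts c′ c′<c))
                                 (trans (update-at (mem s‴) _ _) sz≡₃)))
          where s₀~s′ : Same 17 s₀ s′
                s₀~s′ = same-trans s₀~s (same-below 17 s~)

    record Framed (s : State) : Set where
      field
        constants : Same 17 s₀ s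
        unchanged : Unchanged s
        table     : ∀ y → y < n → Best (Some< n (Selected y)) (mem s (top + y))
        counts    : ∀ c → c < ω → mem s (top + n + c) ≡ old c + new c
        start     : mem s (top + n + ω) ≡ org
        overall   : Best (Overall n) (reg s #gmax)

    frame-ok : Exec (frame q) s₀ (n * (n * (r * ω)) * frameCost) Framed
    frame-ok = within bound
      (assign⨾ (assign⨾ (target-loop (same-put (same-put same-refl)) (λ a _ → refl) is-dg refl ▸
        λ {s} (s~ , unch , table , gmax) →
          let s₀~s = same-trans (same-put (same-put same-refl)) s~ in
          count-loop s₀~s unch table ▸ λ {s′} (s~′ , unch′ , table′ , counts) →
          let s₀~s′ = same-trans s₀~s (same-below 17 s~′)
              addr≡ : top + n + ω ≡ reg s′ #top + reg s′ #m + reg s′ #ω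
              addr≡ = sym (cong₂ _+_ (cong₂ _+_ (trans (at s₀~s′ #top) is-top)
                (trans (at s₀~s′ #m) is-m))
                                     (trans (at s₀~s′ #ω) is-ω))
              keep : ∀ {a} → a < top + n + ω →
                (mem s′ [ reg s′ #top + reg s′ #m + reg s′ #ω ↦ eval (origin q) s′ ]) a ≡ mem s′ a
              keep {a} a< = update-other (mem s′) _ (<⇒≢ (subst (a <_) addr≡ a<))
          in store record
            { constants = same-trans s₀~s′ (same λ x → refl)
            ; unchanged = λ a a<top →
              trans (keep (<-≤-trans a<top (≤-trans (m≤m+n top n) (m≤m+n (top + n) ω))))
                (unch′ a a<top)
            ; table     = λ y y<n → subst (Best _)
              (sym (keep (<-≤-trans (+-monoʳ-< top y<n) (m≤m+n (top + n) ω)))) (table′ y y<n)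
            ; counts    = λ c c<ω → trans (keep (+-monoʳ-< (top + n) c<ω)) (counts c c<ω)
            ; start     = trans (cong
              (mem s′ [ reg s′ #top + reg s′ #m + reg s′ #ω ↦ eval (origin q) s′ ]) addr≡)
                                (trans (update-at (mem s′) _ _) (origin-ok s₀~s′ unch′))
            ; overall   = subst (Best _) (sym (at s~′ #gmax)) gmax
            })))
      where
        open ≤-Reasoning
        w = n * (n * (r * ω))
        1≤nr : 1 ≤ n * (n * r)
        1≤nr = *-mono-≤ 1≤n (*-mono-≤ 1≤n 1≤r)
        1≤w : 1 ≤ w
        1≤w = *-mono-≤ 1≤n (*-mono-≤ 1≤n (*-mono-≤ 1≤r 1≤ω))
        ω≤w : ω ≤ w
        ω≤w = subst₂ _≤_ (*-identityˡ ω) (trans (*-assoc n (n * r) ω) (cong (n *_) (*-assoc n r ω)))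
          (*-monoˡ-≤ ω 1≤nr)
        bound : 2 + (2 + (w * targetCost + (ω * countCost + (6 + cost (origin q))))) ≤ w * frameCost
        bound = begin
          4 + (w * targetCost + (ω * countCost + (6 + cost (origin q))))
            ≤⟨ +-monoʳ-≤ 4 (+-monoʳ-≤ (w * targetCost)
              (+-mono-≤ (*-monoˡ-≤ countCost ω≤w)
                (m≤n*m (6 + cost (origin q)) w ⦃ >-nonZero 1≤w ⦄))) ⟩
          4 + (w * targetCost + (w * countCost + w * (6 + cost (origin q))))
            ≡⟨ cong (λ u → 4 + (w * targetCost + u))
              (*-distribˡ-+ w countCost (6 + cost (origin q))) ⟨
          4 + (w * targetCost + w * (countCost + (6 + cost (origin q))))
            ≡⟨ cong (4 +_) (*-distribˡ-+ w targetCost _) ⟨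
          4 + w * (targetCost + (countCost + (6 + cost (origin q))))
            ≤⟨ +-monoˡ-≤ _ (m≤n*m 4 w ⦃ >-nonZero 1≤w ⦄) ⟩
          w * 4 + w * (targetCost + (countCost + (6 + cost (origin q))))
            ≡⟨ *-distribˡ-+ w 4 _ ⟨
          w * frameCost ∎

-- Membership vectors as sequences of bits

one : Bool → ℕ
one true  = 1
one false = 0

one≤1 : ∀ b → one b ≤ 1
one≤1 true  = ≤-refl
one≤1 false = z≤n

bit : ∀ {r} → Vec Bool r → ℕ → ℕ
bit []       i       = 0
bit (b ∷ bs) zero    = one b
bit (b ∷ bs) (suc i) = bit bs i

bit≤1 : ∀ {r} (m : Vec Bool r) i → bit m i ≤ 1
bit≤1 []       i       = z≤n
bit≤1 (b ∷ bs) zero    = one≤1 b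
bit≤1 (b ∷ bs) (suc i) = bit≤1 bs i

-- Lexicographic positions in the value table

-- `horner` recurses on the last digit, the value table on the first. Splitting off the leading
-- digit turns it into the choice between the two halves of the table, which have length `2 ^ n`
-- each.
horner-head : ∀ h n → horner h (suc n) ≡ h 0 * 2 ^ n + horner (h ∘ suc) n
horner-head h zero    = sym (trans (+-identityʳ _) (*-identityʳ (h 0)))
horner-head h (suc n) rewrite horner-head h n = begin
  u + v + (u + v) + w        ≡⟨ cong (_+ w) (interchange u v u v) ⟩
  u + u + (v + v) + w        ≡⟨ +-assoc (u + u) (v + v) w ⟩
  u + u + (v + v + w)        ≡⟨ cong (_+ (v + v + w)) (*-distribˡ-+ (h 0) (2 ^ n) (2 ^ n)) ⟨
  h 0 * (2 ^ n + 2 ^ n) + (v + v + w) ≡⟨ cong (λ z → h 0 * (2 ^ n + z) + (v + v + w))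
    (+-identityʳ (2 ^ n)) ⟨
  h 0 * 2 ^ suc n + (v + v + w) ∎
  where open ≡-Reasoning
        u = h 0 * 2 ^ n
        v = horner (h ∘ suc) n
        w = h (suc n)

length-valueTable : ∀ r f → length (valueTable r f) ≡ 2 ^ r
length-valueTable zero    f = refl
length-valueTable (suc r) f = trans (length-++ (valueTable r (f ∘ (false ∷_))))
  (cong₂ _+_ (length-valueTable r _) (trans (length-valueTable r _) (sym (+-identityʳ _))))

contents-++ˡ : ∀ xs {ys i} → i < length xs → contents (xs ++ ys) i ≡ contents xs i
contents-++ˡ (x ∷ xs) {i = zero}  i<n = refl
contents-++ˡ (x ∷ xs) {i = suc i} i<n = contents-++ˡ xs (≤-pred i<n)

contents-++ʳ : ∀ xs {ys} i → contents (xs ++ ys) (length xs + i) ≡ contents ys i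
contents-++ʳ []       i = refl
contents-++ʳ (x ∷ xs) i = contents-++ʳ xs i

horner-cong : ∀ {g h} n → (∀ i → i < n → g i ≡ h i) → horner g n ≡ horner h n
horner-cong zero    eq = refl
horner-cong (suc n) eq = cong₂ _+_ (cong₂ _+_ ih ih) (eq n ≤-refl)
  where ih = horner-cong n λ i i<n → eq i (m<n⇒m<1+n i<n)

horner-bit : ∀ {r} (m : Vec Bool r) → horner (bit m) r < 2 ^ r
horner-bit []               = s≤s z≤n
horner-bit {suc r} (b ∷ bs) = begin-strict
  horner (bit (b ∷ bs)) (suc r)           ≡⟨ horner-head (bit (b ∷ bs)) r ⟩
  one b * 2 ^ r + horner (bit bs) r       <⟨ +-mono-≤-< (*-monoˡ-≤ (2 ^ r) (one≤1 b))
    (horner-bit bs) ⟩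
  1 * 2 ^ r + 2 ^ r                       ≡⟨ +-comm (1 * 2 ^ r) (2 ^ r) ⟩
  2 ^ suc r                               ∎
  where open ≤-Reasoning

valueTable-lookup : ∀ {r} f (m : Vec Bool r) → contents (valueTable r f) (horner (bit m) r) ≡ f m
valueTable-lookup f [] = refl
valueTable-lookup {suc r} f (false ∷ bs) rewrite horner-head (bit (false ∷ bs)) r =
  trans (contents-++ˡ (valueTable r (f ∘ (false ∷_)))
           (subst (horner (bit bs) r <_) (sym (length-valueTable r _)) (horner-bit bs)))
        (valueTable-lookup (f ∘ (false ∷_)) bs)
valueTable-lookup {suc r} f (true ∷ bs) rewrite horner-head
  (bit (true ∷ bs)) r | +-identityʳ (2 ^ r) =
  trans (cong (λ z → contents (valueTable (suc r) f) (z + horner (bit bs) r))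
    (sym (length-valueTable r (f ∘ (false ∷_)))))
  (trans (contents-++ʳ (valueTable r (f ∘ (false ∷_))) (horner (bit bs) r))
    (valueTable-lookup (f ∘ (true ∷_)) bs))

fromBits : (r : ℕ) → (ℕ → ℕ) → Vec Bool r
fromBits zero    h = []
fromBits (suc r) h = (0 <ᵇ h 0) ∷ fromBits r (h ∘ suc)

bit-fromBits : ∀ r h i → i < r → h i ≤ 1 → bit (fromBits r h) i ≡ h i
bit-fromBits (suc r) h zero    i<r h≤1 with h 0 | h≤1
... | zero  | _       = refl
... | suc _ | s≤s z≤n = refl
bit-fromBits (suc r) h (suc i) i<r h≤1 = bit-fromBits r (h ∘ suc) i (≤-pred i<r) h≤1

-- Sums over the vertices of the built graph

-- Summing along the tree, and not over an enumeration of vertices, makes a sum split at a union and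
-- pass through the unary nodes definitionally.
sumV : ∀ {ω} (t : Decomposition ω) → (Vertex t → ℕ) → ℕ
sumV (intro v a)      g = g (v , refl)
sumV (t₁ ⊕ t₂)        g = sumV t₁ (g ∘ inj₁) + sumV t₂ (g ∘ inj₂)
sumV (recolor t a b)  g = sumV t g
sumV (addEdges t a b) g = sumV t g

sumV-cong : ∀ {ω} (t : Decomposition ω) {g h} → (∀ x → g x ≡ h x) → sumV t g ≡ sumV t h
sumV-cong (intro v a)      eq = eq _
sumV-cong (t₁ ⊕ t₂)        eq = cong₂ _+_ (sumV-cong t₁ (eq ∘ inj₁)) (sumV-cong t₂ (eq ∘ inj₂))
sumV-cong (recolor t a b)  eq = sumV-cong t eq
sumV-cong (addEdges t a b) eq = sumV-cong t eq

sumV-+ : ∀ {ω} (t : Decomposition ω) g h → sumV t (λ x → g x + h x) ≡ sumV t g + sumV t h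
sumV-+ (intro v a)      g h = refl
sumV-+ (t₁ ⊕ t₂)        g h =
  trans (cong₂ _+_ (sumV-+ t₁ (g ∘ inj₁) (h ∘ inj₁)) (sumV-+ t₂ (g ∘ inj₂) (h ∘ inj₂)))
        (interchange (sumV t₁ (g ∘ inj₁)) _ _ _)
sumV-+ (recolor t a b)  g h = sumV-+ t g h
sumV-+ (addEdges t a b) g h = sumV-+ t g h

sumV-0 : ∀ {ω} (t : Decomposition ω) → sumV t (λ _ → 0) ≡ 0
sumV-0 (intro v a)      = refl
sumV-0 (t₁ ⊕ t₂)        = cong₂ _+_ (sumV-0 t₁) (sumV-0 t₂)
sumV-0 (recolor t a b)  = sumV-0 t
sumV-0 (addEdges t a b) = sumV-0 t

sumV-mono : ∀ {ω} (t : Decomposition ω) {g h} → (∀ x → g x ≤ h x) → sumV t g ≤ sumV t h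
sumV-mono (intro v a)      le = le _
sumV-mono (t₁ ⊕ t₂)        le = +-mono-≤ (sumV-mono t₁ (le ∘ inj₁)) (sumV-mono t₂ (le ∘ inj₂))
sumV-mono (recolor t a b)  le = sumV-mono t le
sumV-mono (addEdges t a b) le = sumV-mono t le

sumV-≥ : ∀ {ω} (t : Decomposition ω) g x → g x ≤ sumV t g
sumV-≥ (intro v a)      g (_ , refl) = ≤-refl
sumV-≥ (t₁ ⊕ t₂)        g (inj₁ x)   = ≤-trans (sumV-≥ t₁ (g ∘ inj₁) x) (m≤m+n _ _)
sumV-≥ (t₁ ⊕ t₂)        g (inj₂ x)   = ≤-trans (sumV-≥ t₂ (g ∘ inj₂) x) (m≤n+m _ _)
sumV-≥ (recolor t a b)  g x          = sumV-≥ t g x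
sumV-≥ (addEdges t a b) g x          = sumV-≥ t g x

sumV-≥₂ : ∀ {ω} (t : Decomposition ω) g x y → x ≢ y → g x + g y ≤ sumV t g
sumV-≥₂ (intro v a)      g (_ , refl) (_ , refl) x≢y = ⊥-elim (x≢y refl)
sumV-≥₂ (t₁ ⊕ t₂)        g (inj₁ x)   (inj₁ y)   x≢y =
  ≤-trans (sumV-≥₂ t₁ (g ∘ inj₁) x y (x≢y ∘ cong inj₁)) (m≤m+n _ _)
sumV-≥₂ (t₁ ⊕ t₂)        g (inj₁ x)   (inj₂ y)   x≢y = +-mono-≤ (sumV-≥ t₁ (g ∘ inj₁) x)
  (sumV-≥ t₂ (g ∘ inj₂) y)
sumV-≥₂ (t₁ ⊕ t₂)        g (inj₂ x)   (inj₁ y)   x≢y =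
  ≤-trans (≤-reflexive (+-comm (g (inj₂ x)) (g (inj₁ y))))
    (+-mono-≤ (sumV-≥ t₁ (g ∘ inj₁) y) (sumV-≥ t₂ (g ∘ inj₂) x))
sumV-≥₂ (t₁ ⊕ t₂)        g (inj₂ x)   (inj₂ y)   x≢y =
  ≤-trans (sumV-≥₂ t₂ (g ∘ inj₂) x y (x≢y ∘ cong inj₂)) (m≤n+m _ _)
sumV-≥₂ (recolor t a b)  g x y x≢y = sumV-≥₂ t g x y x≢y
sumV-≥₂ (addEdges t a b) g x y x≢y = sumV-≥₂ t g x y x≢y

sumV-witness : ∀ {ω} (t : Decomposition ω) g → 1 ≤ sumV t g → ∃[ x ] 1 ≤ g x
sumV-witness (intro v a)      g pos = (v , refl) , pos
sumV-witness (t₁ ⊕ t₂)        g pos with sumV t₁ (g ∘ inj₁) in eq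
... | zero  = let x , p = sumV-witness t₂ (g ∘ inj₂) pos in inj₂ x , p
... | suc _ = let x , p = sumV-witness t₁ (g ∘ inj₁) (subst (1 ≤_) (sym eq) (s≤s z≤n)) in inj₁ x , p
sumV-witness (recolor t a b)  g pos = sumV-witness t g pos
sumV-witness (addEdges t a b) g pos = sumV-witness t g pos

-- As `g` is at most 1, no single vertex accounts for a sum of 2. This produces two missed vertices
-- of one color, that is, an uncovered edge of a clique arising from equal colors.
sumV-witness₂ : ∀ {ω} (t : Decomposition ω) g → (∀ x → g x ≤ 1) → 2 ≤ sumV t g →
                ∃[ x ] ∃[ y ] (x ≢ y × 1 ≤ g x × 1 ≤ g y)
sumV-witness₂ (intro v a)      g g≤1 big = ⊥-elim (<⇒≱ big (g≤1 _))
sumV-witness₂ (t₁ ⊕ t₂)        g g≤1 big with sumV t₁ (g ∘ inj₁) in eq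
... | zero =
  let x , y , x≢y , p = sumV-witness₂ t₂ (g ∘ inj₂) (g≤1 ∘ inj₂) big in
  inj₂ x , inj₂ y , x≢y ∘ inj₂-injective , p
... | suc zero =
  let x , p = sumV-witness t₁ (g ∘ inj₁) (subst (1 ≤_) (sym eq) (s≤s z≤n))
      y , q = sumV-witness t₂ (g ∘ inj₂) (≤-pred big) in
  inj₁ x , inj₂ y , (λ ()) , p , q
... | suc (suc _) =
  let x , y , x≢y , p = sumV-witness₂ t₁ (g ∘ inj₁) (g≤1 ∘ inj₁)
        (subst (2 ≤_) (sym eq) (s≤s (s≤s z≤n))) in
  inj₁ x , inj₁ y , x≢y ∘ inj₁-injective , p
sumV-witness₂ (recolor t a b)  g g≤1 big = sumV-witness₂ t g g≤1 big
sumV-witness₂ (addEdges t a b) g g≤1 big = sumV-witness₂ t g g≤1 big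

-- Counts per color and their change under recoloring

δ : ℕ → ℕ → ℕ
δ m n = if m ≡ᵇ n then 1 else 0

δ-refl : ∀ n → δ n n ≡ 1
δ-refl n rewrite ≡ᵇ-refl n = refl

δ-≢ : ∀ {m n} → m ≢ n → δ m n ≡ 0
δ-≢ m≢n rewrite ≡ᵇ-false m≢n = refl

δ≤1 : ∀ m n → δ m n ≤ 1
δ≤1 m n with m ≡ᵇ n
... | true  = ≤-refl
... | false = z≤n

col : ∀ {ω} (t : Decomposition ω) → Vertex t → ℕ
col t x = toℕ (color t x)

-- With the indicator of a set as `w` this is a count of its profile; with the constant 1 it is the
-- size of a color class. Both obey the same laws.
weigh : ∀ {ω} (t : Decomposition ω) → (Vertex t → ℕ) → ℕ → ℕ
weigh t w c = sumV t (λ x → δ (col t x) c * w x)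

weigh≤sumV : ∀ {ω} (t : Decomposition ω) w c → weigh t w c ≤ sumV t w
weigh≤sumV t w c = sumV-mono t λ x →
  subst (δ (col t x) c * w x ≤_) (*-identityˡ (w x)) (*-monoˡ-≤ (w x) (δ≤1 (col t x) c))

sum<-cong : ∀ n {g h} → (∀ c → c < n → g c ≡ h c) → sum< n g ≡ sum< n h
sum<-cong zero    eq = refl
sum<-cong (suc n) eq = cong₂ _+_ (sum<-cong n λ c c<n → eq c (m<n⇒m<1+n c<n)) (eq n ≤-refl)

sum<-sumV : ∀ {ω} (t : Decomposition ω) n (g : ℕ → Vertex t → ℕ) →
            sum< n (λ c → sumV t (g c)) ≡ sumV t (λ x → sum< n (λ c → g c x))
sum<-sumV t zero    g = sym (sumV-0 t)
sum<-sumV t (suc n) g = trans (cong (_+ sumV t (g n)) (sum<-sumV t n g)) (sym (sumV-+ t _ _))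

sum<-δ-≥ : ∀ n m w → n ≤ m → sum< n (λ c → δ m c * w) ≡ 0
sum<-δ-≥ zero    m w le = refl
sum<-δ-≥ (suc n) m w le rewrite sum<-δ-≥ n m w (<⇒≤ le) | δ-≢ (<⇒≢ le ∘ sym) = refl

sum<-δ : ∀ n m w → m < n → sum< n (λ c → δ m c * w) ≡ w
sum<-δ (suc n) m w m<1+n with m ≟ n
... | yes refl rewrite sum<-δ-≥ n n w ≤-refl | δ-refl n = +-identityʳ w
... | no  m≢n  rewrite sum<-δ n m w (≤∧≢⇒< (≤-pred m<1+n) m≢n) | δ-≢ m≢n = +-identityʳ w

-- Every vertex has exactly one of the `ω` colors. Hence the digits that belong to a set add up to
-- its size, and the size check can be made on the profile.
sum-weigh : ∀ {ω} (t : Decomposition ω) w → sum< ω (weigh t w) ≡ sumV t w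
sum-weigh {ω} t w = trans (sum<-sumV t ω (λ c x → δ (col t x) c * w x))
  (sumV-cong t λ x → sum<-δ ω (col t x) (w x) (Fin.toℕ<n (color t x)))

-- Color `a` is emptied and its old count credited to `b` by separate summands, so the formula is
-- also right when `a` and `b` coincide.
rename : ℕ → ℕ → (ℕ → ℕ) → ℕ → ℕ
rename a b h c = (if c ≡ᵇ a then 0 else h c) + (if c ≡ᵇ b then h a else 0)

rename-cong : ∀ a b (g h : ℕ → ℕ) c → g a ≡ h a → g c ≡ h c → rename a b g c ≡ rename a b h c
rename-cong a b g h c ea ec rewrite ea | ec = refl

sumV-if : ∀ {ω} (t : Decomposition ω) b g h →
          sumV t (λ x → if b then g x else h x) ≡ (if b then sumV t g else sumV t h)
sumV-if t true  g h = refl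
sumV-if t false g h = refl

weigh-recolor : ∀ {ω} (t : Decomposition ω) a b w c →
                weigh (recolor t a b) w c ≡ rename (toℕ a) (toℕ b) (weigh t w) c
weigh-recolor t a b w c = begin
  weigh (recolor t a b) w c
    ≡⟨ sumV-cong t pointwise ⟩
  sumV t (λ x → (if c ≡ᵇ toℕ a then 0 else δ (col t x) c * w x) +
                (if c ≡ᵇ toℕ b then δ (col t x) (toℕ a) * w x else 0))
    ≡⟨ sumV-+ t _ _ ⟩
  sumV t (λ x → if c ≡ᵇ toℕ a then 0 else δ (col t x) c * w x) +
  sumV t (λ x → if c ≡ᵇ toℕ b then δ (col t x) (toℕ a) * w x else 0)
    ≡⟨ cong₂ _+_ (trans (sumV-if t (c ≡ᵇ toℕ a) _ _)
      (cong (λ z → if c ≡ᵇ toℕ a then z else weigh t w c) (sumV-0 t)))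
                 (trans (sumV-if t (c ≡ᵇ toℕ b) _ _)
                   (cong (λ z → if c ≡ᵇ toℕ b then weigh t w (toℕ a) else z) (sumV-0 t))) ⟩
  rename (toℕ a) (toℕ b) (weigh t w) c ∎
  where
    open ≡-Reasoning
    sym-δ : ∀ m n → δ m n ≡ δ n m
    sym-δ m n with m ≟ n
    ... | yes refl = refl
    ... | no  m≢n  = trans (δ-≢ m≢n) (sym (δ-≢ (m≢n ∘ sym)))
    pointwise : ∀ x → δ (col (recolor t a b) x) c * w x ≡
                (if c ≡ᵇ toℕ a then 0 else δ (col t x) c * w x) +
                (if c ≡ᵇ toℕ b then δ (col t x) (toℕ a) * w x else 0)
    pointwise x with color t x Fin.≟ a
    pointwise x | yes eq rewrite eq | δ-refl (toℕ a) | sym-δ (toℕ b) c | sym-δ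
      (toℕ a) c with c ≡ᵇ toℕ a | c ≡ᵇ toℕ b
    ... | true  | true  = refl
    ... | true  | false = refl
    ... | false | true  = refl
    ... | false | false = refl
    pointwise x | no  ne rewrite δ-≢ (ne ∘ Fin.toℕ-injective) with c ≟ toℕ a
    ... | yes refl rewrite ≡ᵇ-refl (toℕ a) | δ-≢ (ne ∘ Fin.toℕ-injective) with toℕ a ≡ᵇ toℕ b
    ...   | true  = refl
    ...   | false = refl
    pointwise x | no  ne | no c≢a rewrite ≡ᵇ-false c≢a with c ≡ᵇ toℕ b
    ...   | true  = sym (+-identityʳ _)
    ...   | false = sym (+-identityʳ _)

-- Profiles as numerals in base k + 1

numeral : ℕ → ℕ → (ℕ → ℕ) → ℕ
numeral b zero    d = 0
numeral b (suc n) d = numeral b n d + d n * b ^ n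

numeral-cong : ∀ b n {d e} → (∀ j → j < n → d j ≡ e j) → numeral b n d ≡ numeral b n e
numeral-cong b zero    eq = refl
numeral-cong b (suc n) eq =
  cong₂ (λ u v → u + v * b ^ n) (numeral-cong b n λ j j<n → eq j (m<n⇒m<1+n j<n)) (eq n ≤-refl)

numeral-+ : ∀ b n d e → numeral b n (λ j → d j + e j) ≡ numeral b n d + numeral b n e
numeral-+ b zero    d e = refl
numeral-+ b (suc n) d e rewrite numeral-+ b n d e | *-distribʳ-+ (b ^ n) (d n) (e n) =
  interchange (numeral b n d) (numeral b n e) (d n * b ^ n) (e n * b ^ n)

numeral-0 : ∀ b n → numeral b n (λ _ → 0) ≡ 0
numeral-0 b zero    = refl
numeral-0 b (suc n) = trans (+-identityʳ _) (numeral-0 b n)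

numeral-< : ∀ k n {d} → (∀ j → j < n → d j ≤ k) → numeral (suc k) n d < suc k ^ n
numeral-< k zero    le = s≤s z≤n
numeral-< k (suc n) le =
  +-mono-<-≤ (numeral-< k n λ j j<n → le j (m<n⇒m<1+n j<n)) (*-monoˡ-≤ (suc k ^ n) (le n ≤-refl))

leading-≮ : ∀ {b u v} P → u < P → v < P → ∀ {x} → b < x → u + b * P ≢ v + x * P
leading-≮ {b} {u} {v} P u<P v<P {x} b<x eq = <-irrefl eq (begin-strict
  u + b * P  <⟨ +-monoˡ-< (b * P) u<P ⟩
  suc b * P  ≤⟨ *-monoˡ-≤ P b<x ⟩
  x * P      ≤⟨ m≤n+m (x * P) v ⟩
  v + x * P  ∎)
  where open ≤-Reasoning

-- The lower digits contribute less than `suc k ^ n`, so they cannot make up for unequal leading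
-- digits; equal ones cancel.
numeral-injective : ∀ k n {d e} → (∀ j → j < n → d j ≤ k) → (∀ j → j < n → e j ≤ k) →
                    numeral (suc k) n d ≡ numeral (suc k) n e → ∀ j → j < n → d j ≡ e j
numeral-injective k (suc n) {d} {e} d≤ e≤ eq = below-suc
    (numeral-injective k n d≤′ e≤′
      (+-cancelʳ-≡ (e n * suc k ^ n) _ _ (subst (λ z → _ + z * suc k ^ n ≡ _) last eq)))
    last
  where
    d≤′ = λ j j<n → d≤ j (m<n⇒m<1+n j<n)
    e≤′ = λ j j<n → e≤ j (m<n⇒m<1+n j<n)
    last : d n ≡ e n
    last with <-cmp (d n) (e n)
    ... | tri< lt _ _ = ⊥-elim (leading-≮ (suc k ^ n) (numeral-< k n d≤′) (numeral-< k n e≤′) lt eq)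
    ... | tri≈ _ p _  = p
    ... | tri> _ _ gt = ⊥-elim
      (leading-≮ (suc k ^ n) (numeral-< k n e≤′) (numeral-< k n d≤′) gt (sym eq))

-- What the recurrences need of the digit table: digits are looked up and never computed from `y`,
-- so it must be known that row `y` spells `y`.
record Numbering (k l n : ℕ) (dig : ℕ → ℕ → ℕ) : Set where
  field
    total   : n ≡ suc k ^ l
    bounded : ∀ y → y < n → ∀ j → j < l → dig y j ≤ k
    denotes : ∀ y → y < n → numeral (suc k) l (dig y) ≡ y

module Profiles
  {r ω k n : ℕ} .⦃ _ : NonZero ω ⦄ (digit : ℕ → ℕ → ℕ → ℕ) {dig : ℕ → ℕ → ℕ}
  (dig≡ : ∀ y i c → dig y (i * ω + c) ≡ digit y i c)
  (numbering : Numbering k (r * ω) n dig) where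

  open Numbering numbering

  pos< : ∀ {i c} → i < r → c < ω → i * ω + c < r * ω
  pos< {i} {c} i<r c<ω = begin-strict
    i * ω + c  <⟨ +-monoʳ-< (i * ω) c<ω ⟩
    i * ω + ω  ≡⟨ +-comm (i * ω) ω ⟩
    suc i * ω  ≤⟨ *-monoˡ-≤ ω i<r ⟩
    r * ω      ∎
    where open ≤-Reasoning

  at-pos : ∀ {P : ℕ → Set} → (∀ i c → i < r → c < ω → P (i * ω + c)) → ∀ j → j < r * ω → P j
  at-pos {P} h j j< = subst P (trans (+-comm (j / ω * ω) (j % ω)) (sym (m≡m%n+[m/n]*n j ω)))
                       (h (j / ω) (j % ω) (m<n*o⇒m/o<n j<) (m%n<n j ω))

  digit≤ : ∀ {y i c} → y < n → i < r → c < ω → digit y i c ≤ k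
  digit≤ {y} {i} {c} y<n i<r c<ω = subst (_≤ k) (dig≡ y i c) (bounded y y<n _ (pos< i<r c<ω))

  -- The witness is the numeral with digits `p`. The table row of that number has the same value, so
  -- by uniqueness of bounded digits it is `p`.
  profile-of : (p : ℕ → ℕ → ℕ) → (∀ i c → i < r → c < ω → p i c ≤ k) →
               Σ[ y ∈ ℕ ] (y < n × (∀ i c → i < r → c < ω → digit y i c ≡ p i c))
  profile-of p p≤ = y , y<n , λ i c i<r c<ω → trans (sym (dig≡ y i c))
      (trans (numeral-injective k (r * ω) (bounded y y<n) d≤ (denotes y y<n) (i * ω + c)
        (pos< i<r c<ω))
             (cong₂ p (quot i c c<ω) (rem i c c<ω)))
    where
      d : ℕ → ℕ
      d j = p (j / ω) (j % ω)
      d≤ : ∀ j → j < r * ω → d j ≤ k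
      d≤ j j< = p≤ (j / ω) (j % ω) (m<n*o⇒m/o<n j<) (m%n<n j ω)
      y = numeral (suc k) (r * ω) d
      y<n = subst (y <_) (sym total) (numeral-< k (r * ω) d≤)
      rem : ∀ i c → c < ω → (i * ω + c) % ω ≡ c
      rem i c c<ω = trans (cong (_% ω) (+-comm (i * ω) c))
        (trans ([m+kn]%n≡m%n c i ω) (m<n⇒m%n≡m c<ω))
      quot : ∀ i c → c < ω → (i * ω + c) / ω ≡ i
      quot i c c<ω = trans (+-distrib-/-∣ˡ c (divides-refl i))
        (trans (cong₂ _+_ (m*n/n≡m i ω) (m<n⇒m/n≡0 c<ω)) (+-identityʳ i))

  add : ∀ {x y z} → x < n → y < n → z < n →
        (∀ i c → i < r → c < ω → digit x i c + digit z i c ≡ digit y i c) → x + z ≡ y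
  add {x} {y} {z} x<n y<n z<n h = begin
    x + z  ≡⟨ cong₂ _+_ (denotes x x<n) (denotes z z<n) ⟨
    numeral (suc k) (r * ω) (dig x) + numeral (suc k) (r * ω) (dig z)  ≡⟨ numeral-+ (suc k) (r * ω)
      (dig x) (dig z) ⟨
    numeral (suc k) (r * ω) (λ j → dig x j + dig z j)
      ≡⟨ numeral-cong (suc k) (r * ω) (at-pos λ i c i<r c<ω →
           trans (cong₂ _+_ (dig≡ x i c) (dig≡ z i c)) (trans (h i c i<r c<ω) (sym (dig≡ y i c)))) ⟩
    numeral (suc k) (r * ω) (dig y)  ≡⟨ denotes y y<n ⟩
    y  ∎
    where open ≡-Reasoning

  -- Subtraction of numerals is digitwise when nothing is borrowed.
  subtract : ∀ {x y} → x < n → y < n → (∀ i c → i < r → c < ω → digit x i c ≤ digit y i c) →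
             y ∸ x < n × (∀ i c → i < r → c < ω → digit x i c + digit (y ∸ x) i c ≡ digit y i c)
  subtract {x} {y} x<n y<n le with
    profile-of (λ i c → digit y i c ∸ digit x i c)
               (λ i c i<r c<ω → ≤-trans (m∸n≤m _ (digit x i c)) (digit≤ y<n i<r c<ω))
  ... | z , z<n , z≡ = subst (_< n) z≡y∸x z<n ,
    subst (λ u → ∀ i c → i < r → c < ω → digit x i c + digit u i c ≡ digit y i c) z≡y∸x sums
    where
      sums : ∀ i c → i < r → c < ω → digit x i c + digit z i c ≡ digit y i c
      sums i c i<r c<ω = trans (cong (digit x i c +_) (z≡ i c i<r c<ω)) (m+[n∸m]≡n (le i c i<r c<ω))
      z≡y∸x : z ≡ y ∸ x
      z≡y∸x = trans (sym (m+n∸m≡n x z)) (cong (_∸ x) (add x<n y<n z<n sums))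

  -- Q may omit values of P that it exceeds, so the two have the same maximum.
  Refines : (P Q : ℕ → Set) → Set
  Refines P Q = (∀ v → P v → ∃[ u ] v ≤ u × Q u) × (∀ v → Q v → P v)

  -- Definitionally the selection predicate of the frame program, so each recurrence below can be
  -- applied to the table that the program leaves.
  Chosen : (Pass : (x y i c : ℕ) → Set) (Ok : (x y : ℕ) → Set) (val : (x y : ℕ) → ℕ) →
    ℕ → ℕ → ℕ → Set
  Chosen Pass Ok val y x v =
    (∀ i → i < r → (∀ c → c < ω → Pass x y i c) × sum< ω (digit y i) ≤ k) × Ok x y × v ≡ val x y

  -- Partial solutions and the recurrences at the four node types

  module _ (f : Vec Bool r → ℕ) where

    record Feasible (t : Decomposition ω) (y v : ℕ) : Set where
      field
        σ       : Vertex t → Vec Bool r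
        cover   : ∀ i → i < r → ∀ x z → Edge t x z → 1 ≤ bit (σ x) i ⊎ 1 ≤ bit (σ z) i
        small   : ∀ i → i < r → sumV t (λ x → bit (σ x) i) ≤ k
        profile : ∀ i c → i < r → c < ω → digit y i c ≡ weigh t (λ x → bit (σ x) i) c
        diversity   : sumV t (f ∘ σ) ≡ v

    open Feasible

    size≡ : ∀ {t : Decomposition ω} {y i} (g : Vertex t → ℕ) →
            (∀ c → c < ω → digit y i c ≡ weigh t g c) → sum< ω (digit y i) ≡ sumV t g
    size≡ {t} g eq = trans (sum<-cong ω eq) (sum-weigh t g)

    sizeOk : ∀ {t y v} → Feasible t y v → ∀ i → i < r → sum< ω (digit y i) ≤ k
    sizeOk {t} F i i<r = subst (_≤ k) (sym (size≡ {t} _ λ c → profile F i c i<r)) (small F i i<r)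

    locate : (t : Decomposition ω) (σ : Vertex t → Vec Bool r) →
      (∀ i → i < r → sumV t (λ x → bit (σ x) i) ≤ k) →
             Σ[ x ∈ ℕ ] (x < n × (∀ i c → i < r → c < ω →
               digit x i c ≡ weigh t (λ x → bit (σ x) i) c))
    locate t σ small = profile-of (λ i → weigh t (λ x → bit (σ x) i))
      (λ i c i<r _ → ≤-trans (weigh≤sumV t _ c) (small i i<r))

    Tabulates : Decomposition ω → (ℕ → ℕ) → Set
    Tabulates t m = ∀ y → y < n → Best (Feasible t y) (m y)

    pred-suc : ∀ {m} → 1 ≤ m → m ≡ suc (m ∸ 1)
    pred-suc (s≤s _) = refl

    introSel : Fin ω → ℕ → ℕ → ℕ → Set
    introSel a =
      Chosen (λ x y i c → (c ≡ toℕ a ⊎ digit y i c ≡ 0) × digit y i c ≤ 1) (λ x y → ⊤)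
        (λ x y → contents (valueTable r f) (horner (λ i → digit y i (toℕ a)) r))

    intro-refines : ∀ {u a y} → 1 ≤ k → 1 ≤ n →
      Refines (Feasible (intro u a) y)
              (Some< n (introSel a y))
    intro-refines {u} {a} {y} 1≤k 1≤n = up , down
      where
        t = intro u a
        table : ∀ m → (∀ i → i < r → digit y i (toℕ a) ≡ bit m i) →
                contents (valueTable r f) (horner (λ i → digit y i (toℕ a)) r) ≡ f m
        table m eq = trans (cong (contents (valueTable r f)) (horner-cong r eq))
          (valueTable-lookup f m)
        own : ∀ b → δ (toℕ a) (toℕ a) * b ≡ b
        own b rewrite δ-refl (toℕ a) = +-identityʳ b
        up : ∀ v → Feasible t y v → ∃[ w ] v ≤ w × Some< n (introSel a y) w
        -- A leaf has no child to take a source profile from, and the conditions speak only of the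
        -- target; profile 0 is a source that always exists.
        up v F = v , ≤-refl , 0 , 1≤n ,
          (λ i i<r → (λ c c<ω → zero-or-own i c i<r c<ω ,
            subst (_≤ 1) (sym (profile F i c i<r c<ω))
              (≤-trans (weigh≤sumV t (λ x → bit (σ F x) i) c) (bit≤1 (σ F _) i))) ,
            sizeOk F i i<r) ,
          tt , sym (trans (table (σ F _) λ i i<r →
            trans (profile F i (toℕ a) i<r (Fin.toℕ<n a)) (own _)) (diversity F))
          where
            zero-or-own : ∀ i c → i < r → c < ω → c ≡ toℕ a ⊎ digit y i c ≡ 0
            zero-or-own i c i<r c<ω with c ≟ toℕ a
            ... | yes eq = inj₁ eq
            ... | no  ne = inj₂ (trans (profile F i c i<r c<ω)
              (cong (_* bit (σ F _) i) (δ-≢ (ne ∘ sym))))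
        down : ∀ v → Some< n (introSel a y) v → Feasible t y v
        down v (x , x<n , all , _ , v≡) = record
          { σ = λ _ → m
          ; cover = λ i i<r x z ()
          ; small = λ i _ → ≤-trans (bit≤1 m i) 1≤k
          ; profile = λ i c i<r c<ω → prof i c i<r c<ω
          ; diversity = sym (trans v≡ (table m λ i i<r → sym (bits i i<r))) }
          where
            m = fromBits r (λ i → digit y i (toℕ a))
            bits : ∀ i → i < r → bit m i ≡ digit y i (toℕ a)
            bits i i<r = bit-fromBits r _ i i<r (proj₂ (proj₁ (all i i<r) (toℕ a) (Fin.toℕ<n a)))
            prof : ∀ i c → i < r → c < ω → digit y i c ≡ δ (toℕ a) c * bit m i
            prof i c i<r c<ω with c ≟ toℕ a
            ... | yes refl = sym (trans (own _) (bits i i<r))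
            ... | no  ne with proj₁ (proj₁ (all i i<r) c c<ω)
            ...   | inj₁ eq = ⊥-elim (ne eq)
            ...   | inj₂ eq = trans eq (sym (cong (_* bit m i) (δ-≢ (ne ∘ sym))))

    ⊕Sel : (m₁ m₂ : ℕ → ℕ) → ℕ → ℕ → ℕ → Set
    ⊕Sel m₁ m₂ =
      Chosen (λ x y i c → digit x i c ≤ digit y i c) (λ x y → 1 ≤ m₁ x × 1 ≤ m₂ (y ∸ x))
        (λ x y → (m₁ x ∸ 1) + (m₂ (y ∸ x) ∸ 1))

    -- Cut a solution at the union. Its left half has some profile `x`, and since counts add up, the
    -- right half has the digitwise difference, whose number is `y ∸ x`. The tables may hold better
    -- halves than these, so the value found is only at least `v`. Conversely, attained halves can
    -- be glued because no edge joins the two sides.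
    ⊕-refines : ∀ {t₁ t₂ y m₁ m₂} → Tabulates t₁ m₁ → Tabulates t₂ m₂ → y < n →
      Refines (Feasible (t₁ ⊕ t₂) y)
              (Some< n (⊕Sel m₁ m₂ y))
    ⊕-refines {t₁} {t₂} {y} {m₁} {m₂} tab₁ tab₂ y<n = up , down
      where
        up : ∀ v → Feasible (t₁ ⊕ t₂) y v → ∃[ w ] v ≤ w × Some< n (⊕Sel m₁ m₂ y) w
        up v F with locate t₁ (σ F ∘ inj₁) (λ i i<r → ≤-trans (m≤m+n _ _) (small F i i<r))
        ... | x , x<n , x≡ =
          _ , v≤ , x , x<n , (λ i i<r → (λ c c<ω → le i c i<r c<ω) , sizeOk F i i<r) ,
          (≤-trans (s≤s z≤n) b₁ , ≤-trans (s≤s z≤n) b₂) , refl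
          where
            le : ∀ i c → i < r → c < ω → digit x i c ≤ digit y i c
            le i c i<r c<ω = subst₂ _≤_ (sym (x≡ i c i<r c<ω))
              (sym (profile F i c i<r c<ω)) (m≤m+n _ _)
            z = subtract x<n y<n le
            F₁ : Feasible t₁ x (sumV t₁ (f ∘ σ F ∘ inj₁))
            F₁ = record { σ = σ F ∘ inj₁ ; cover = λ i i<r x z → cover F i i<r (inj₁ x) (inj₁ z)
                        ; small = λ i i<r → ≤-trans (m≤m+n _ _) (small F i i<r)
                        ; profile = x≡ ; diversity = refl }
            F₂ : Feasible t₂ (y ∸ x) (sumV t₂ (f ∘ σ F ∘ inj₂))
            F₂ = record { σ = σ F ∘ inj₂ ; cover = λ i i<r x z → cover F i i<r (inj₂ x) (inj₂ z)
                        ; small = λ i i<r → ≤-trans (m≤n+m _ _) (small F i i<r)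
                        ; profile = λ i c i<r c<ω → +-cancelˡ-≡ (digit x i c) _ _
                            (trans (proj₂ z i c i<r c<ω) (trans (profile F i c i<r c<ω)
                              (cong (_+ weigh t₂ (λ u → bit (σ F (inj₂ u)) i) c)
                                (sym (x≡ i c i<r c<ω)))))
                        ; diversity = refl }
            b₁ = proj₁ (tab₁ x x<n) _ F₁
            b₂ = proj₁ (tab₂ (y ∸ x) (proj₁ z)) _ F₂
            v≤ : v ≤ (m₁ x ∸ 1) + (m₂ (y ∸ x) ∸ 1)
            v≤ = subst (_≤ _) (diversity F) (+-mono-≤ (∸-monoˡ-≤ 1 b₁) (∸-monoˡ-≤ 1 b₂))
        down : ∀ v → Some< n (⊕Sel m₁ m₂ y) v → Feasible (t₁ ⊕ t₂) y v
        down v (x , x<n , all , (p₁ , p₂) , refl) = record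
          { σ = τ
          ; cover = cov
          ; small = λ i i<r → subst (_≤ k) (size≡ {t₁ ⊕ t₂} (λ x → bit (τ x) i) λ c → prof i c i<r)
            (proj₂ (all i i<r))
          ; profile = prof
          ; diversity = cong₂ _+_ (diversity F₁) (diversity F₂) }
          where
            z = subtract x<n y<n (λ i c i<r c<ω → proj₁ (all i i<r) c c<ω)
            F₁ = proj₂ (tab₁ x x<n) _ (pred-suc p₁)
            F₂ = proj₂ (tab₂ (y ∸ x) (proj₁ z)) _ (pred-suc p₂)
            τ : Vertex (t₁ ⊕ t₂) → Vec Bool r
            τ = [ σ F₁ , σ F₂ ]′
            prof : ∀ i c → i < r → c < ω → digit y i c ≡ weigh (t₁ ⊕ t₂) (λ x → bit (τ x) i) c
            prof i c i<r c<ω = trans (sym (proj₂ z i c i<r c<ω))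
              (cong₂ _+_ (profile F₁ i c i<r c<ω) (profile F₂ i c i<r c<ω))
            cov : ∀ i → i < r → ∀ x z → Edge (t₁ ⊕ t₂) x z → 1 ≤ bit (τ x) i ⊎ 1 ≤ bit (τ z) i
            cov i i<r (inj₁ x) (inj₁ z) e = cover F₁ i i<r x z e
            cov i i<r (inj₂ x) (inj₂ z) e = cover F₂ i i<r x z e

    recolorSel : (a b : Fin ω) → (ℕ → ℕ) → ℕ → ℕ → ℕ → Set
    recolorSel a b m =
      Chosen (λ x y i c → digit y i c ≡ rename (toℕ a) (toℕ b) (digit x i) c) (λ x y → 1 ≤ m x)
        (λ x y → m x ∸ 1)

    -- Neither vertices nor edges change, so the same sets serve the child and the node; only their
    -- profile is renamed.
    recolor-refines : ∀ {t a b y m} → Tabulates t m → y < n →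
      Refines (Feasible (recolor t a b) y)
              (Some< n (recolorSel a b m y))
    recolor-refines {t} {a} {b} {y} {m} tab y<n = up , down
      where
        up : ∀ v → Feasible (recolor t a b) y v → ∃[ w ] v ≤ w × Some< n (recolorSel a b m y) w
        up v F with locate t (σ F) (small F)
        ... | x , x<n , x≡ = _ , ∸-monoˡ-≤ 1 b₁ , x , x<n ,
          (λ i i<r → (λ c c<ω → trans (profile F i c i<r c<ω) (trans (weigh-recolor t a b _ c)
             (rename-cong (toℕ a) (toℕ b) (weigh t (λ z → bit (σ F z) i)) (digit x i) c
               (sym (x≡ i (toℕ a) i<r (Fin.toℕ<n a))) (sym (x≡ i c i<r c<ω))))) , sizeOk F i i<r) ,
          ≤-trans (s≤s z≤n) b₁ , refl
          where
            F₁ : Feasible t x v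
            F₁ = record { σ = σ F ; cover = cover F ; small = small F ; profile = x≡ ;
              diversity = diversity F }
            b₁ = proj₁ (tab x x<n) v F₁
        down : ∀ v → Some< n (recolorSel a b m y) v → Feasible (recolor t a b) y v
        down v (x , x<n , all , p , refl) = record
          { σ = σ F ; cover = cover F ; small = small F ; diversity = diversity F
          ; profile = λ i c i<r c<ω → trans (proj₁ (all i i<r) c c<ω)
              (trans (rename-cong (toℕ a) (toℕ b) (digit x i) (weigh t (λ z → bit (σ F z) i)) c
                (profile F i (toℕ a) i<r (Fin.toℕ<n a)) (profile F i c i<r c<ω))
                     (sym (weigh-recolor t a b _ c))) }
          where F = proj₂ (tab x x<n) _ (pred-suc p)

    -- The new edges are covered iff one of two distinct colors is chosen entirely,
    -- or all but one vertex of the clique arising from a = b.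
    CoversNew : (t : Decomposition ω) (a b : Fin ω) → (ℕ → ℕ) → Set
    CoversNew t a b p =
      (toℕ a ≢ toℕ b ⊎ weigh t (λ _ → 1) (toℕ a) ≤ suc (p (toℕ a))) ×
      (toℕ a ≡ toℕ b ⊎ (weigh t (λ _ → 1) (toℕ a) ≤ p (toℕ a) ⊎ weigh t (λ _ → 1)
        (toℕ b) ≤ p (toℕ b)))

    module _ (t : Decomposition ω) (h : Vertex t → ℕ) (h≤1 : ∀ x → h x ≤ 1) where

      -- The indicator of the vertices of color `c` outside the set. By `count-split` their number
      -- is the class size minus the count, so the inequalities of `CoversNew` say that none, or at
      -- most one, is missed.
      missed : ℕ → Vertex t → ℕ
      missed c x = δ (col t x) c * (1 ∸ h x)

      count-split : ∀ c → weigh t (λ _ → 1) c ≡ weigh t h c + sumV t (missed c)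
      count-split c = trans (sumV-cong t λ x →
          trans (cong (δ (col t x) c *_) (sym (m+[n∸m]≡n (h≤1 x))))
            (*-distribˡ-+ (δ (col t x) c) (h x) (1 ∸ h x)))
        (sumV-+ t _ _)

      missed≤1 : ∀ c x → missed c x ≤ 1
      missed≤1 c x = *-mono-≤ (δ≤1 (col t x) c) (m∸n≤m 1 (h x))

      missed⇒ : ∀ {c x} → 1 ≤ missed c x → col t x ≡ c × ¬ (1 ≤ h x)
      missed⇒ {c} {x} p with col t x ≟ c | h x
      ... | no  ne   | w     = ⊥-elim (1+n≰n (subst (1 ≤_) (cong (_* (1 ∸ w)) (δ-≢ ne)) p))
      ... | yes refl | zero  = refl , λ ()
      ... | yes refl | suc u = ⊥-elim
        (1+n≰n (subst (1 ≤_) (trans (cong (δ (col t x) (col t x) *_) (0∸n≡0 u))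
          (*-zeroʳ (δ (col t x) (col t x)))) p))

      ⇒missed : ∀ {c x} → col t x ≡ c → ¬ (1 ≤ h x) → missed c x ≡ 1
      ⇒missed {x = x} refl h≱1 rewrite δ-refl (col t x) with h x
      ... | zero  = refl
      ... | suc _ = ⊥-elim (h≱1 (s≤s z≤n))

      -- Suppose both ends were missed. With distinct colors neither class is chosen entirely; with
      -- equal colors two vertices of the class are missed. Either contradicts the corresponding
      -- half of `CoversNew`.
      covers-new : ∀ {a b} → CoversNew t a b (weigh t h) → ∀ {x z} → x ≢ z → color t x ≡ a →
        color t z ≡ b → 1 ≤ h x ⊎ 1 ≤ h z
      covers-new {a} {b} (same-color , diff-color) {x} {z} x≢z refl refl with 1 ≤? h x | 1 ≤? h z
      ... | yes p | _     = inj₁ p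
      ... | no _  | yes p = inj₂ p
      ... | no p  | no q with col t x ≟ col t z
      ...   | no  ne = ⊥-elim ([ ne , [ full p refl , full q refl ]′ ]′ diff-color)
        where
          full : ∀ {c x} → ¬ (1 ≤ h x) → col t x ≡ c → ¬ (weigh t (λ _ → 1) c ≤ weigh t h c)
          full {c} {x} h≱1 eq le = <⇒≱ (begin-strict
              weigh t h c                          <⟨ n<1+n _ ⟩
              suc (weigh t h c)                    ≡⟨ +-comm 1 _ ⟩
              weigh t h c + 1                      ≡⟨ cong (weigh t h c +_) (⇒missed eq h≱1) ⟨
              weigh t h c + missed c x             ≤⟨ +-monoʳ-≤ (weigh t h c)
                (sumV-≥ t (missed c) x) ⟩
              weigh t h c + sumV t (missed c)      ≡⟨ count-split c ⟨
              weigh t (λ _ → 1) c                  ∎) le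
            where open ≤-Reasoning
      ...   | yes eq = ⊥-elim ([ (λ ne → ne eq) , (λ le → <⇒≱ (begin-strict
              suc (weigh t h c)                          <⟨ n<1+n _ ⟩
              2 + weigh t h c                            ≡⟨ +-comm 2 _ ⟩
              weigh t h c + 2                            ≡⟨ cong₂ (λ u v → weigh t h c + (u + v))
                (⇒missed refl p) (⇒missed (sym eq) q) ⟨
              weigh t h c + (missed c x + missed c z)    ≤⟨ +-monoʳ-≤ (weigh t h c)
                (sumV-≥₂ t (missed c) x z x≢z) ⟩
              weigh t h c + sumV t (missed c)            ≡⟨ count-split c ⟨
              weigh t (λ _ → 1) c                        ∎) le) ]′ same-color)
        where open ≤-Reasoning
              c = col t x

      -- By contraposition: two missed vertices of the common color, or one in each of two distinct
      -- classes, are the ends of a new edge that the set fails to cover.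
      new-covered : ∀ {a b} → (∀ x z → x ≢ z → color t x ≡ a → color t z ≡ b → 1 ≤ h x ⊎ 1 ≤ h z) →
        CoversNew t a b (weigh t h)
      new-covered {a} {b} cov = same-color , diff-color
        where
          same-color : toℕ a ≢ toℕ b ⊎ weigh t (λ _ → 1) (toℕ a) ≤ suc (weigh t h (toℕ a))
          same-color with toℕ a ≟ toℕ b | 2 ≤? sumV t (missed (toℕ a))
          ... | no  ne | _ = inj₁ ne
          ... | yes eq | yes big with sumV-witness₂ t (missed (toℕ a)) (missed≤1 (toℕ a)) big
          ...   | x , z , x≢z , p , q with missed⇒ p | missed⇒ q
          ...     | cx , hx | cz , hz =
            ⊥-elim ([ hx , hz ]′ (cov x z x≢z (Fin.toℕ-injective cx)
              (Fin.toℕ-injective (trans cz eq))))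
          same-color | yes eq | no small = inj₂ (begin
            weigh t (λ _ → 1) (toℕ a)                         ≡⟨ count-split (toℕ a) ⟩
            weigh t h (toℕ a) + sumV t (missed (toℕ a))       ≤⟨ +-monoʳ-≤ _ (≤-pred (≰⇒> small)) ⟩
            weigh t h (toℕ a) + 1                             ≡⟨ +-comm _ 1 ⟩
            suc (weigh t h (toℕ a))                           ∎)
            where open ≤-Reasoning
          none-missed : ∀ c → ¬ (1 ≤ sumV t (missed c)) → weigh t (λ _ → 1) c ≤ weigh t h c
          none-missed c none = ≤-reflexive (trans (count-split c)
            (trans (cong (weigh t h c +_) (n<1⇒n≡0 (≰⇒> none))) (+-identityʳ _)))
          diff-color : toℕ a ≡ toℕ b ⊎
            (weigh t (λ _ → 1) (toℕ a) ≤ weigh t h (toℕ a) ⊎ weigh t (λ _ → 1)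
              (toℕ b) ≤ weigh t h (toℕ b))
          diff-color with toℕ a ≟ toℕ b | 1 ≤? sumV t (missed (toℕ a)) | 1 ≤? sumV t
            (missed (toℕ b))
          ... | yes eq | _ | _ = inj₁ eq
          ... | no ne | no none | _ = inj₂ (inj₁ (none-missed (toℕ a) none))
          ... | no ne | yes _ | no none = inj₂ (inj₂ (none-missed (toℕ b) none))
          ... | no ne | yes p | yes q with sumV-witness t _ p | sumV-witness t _ q
          ...   | x , px | z , pz with missed⇒ px | missed⇒ pz
          ...     | cx , hx | cz , hz = ⊥-elim ([ hx , hz ]′
            (cov x z (λ { refl → ne (trans (sym cx) cz) }) (Fin.toℕ-injective cx)
              (Fin.toℕ-injective cz)))

    addEdgesSel : Decomposition ω → (a b : Fin ω) → (ℕ → ℕ) → ℕ → ℕ → ℕ → Set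
    addEdgesSel t a b m =
      Chosen (λ x y i c → digit x i c ≡ digit y i c × CoversNew t a b (digit x i)) (λ x y → 1 ≤ m x)
        (λ x y → m x ∸ 1)

    -- The node keeps all colors, so a solution has the same profile at the child and `y` is its own
    -- source. Old edges are covered by the child's solution, new ones by the count criterion, which
    -- is stated for one orientation and applied to the other by symmetry.
    addEdges-refines : ∀ {t a b y m} → 1 ≤ ω → Tabulates t m → y < n →
      Refines (Feasible (addEdges t a b) y)
              (Some< n (addEdgesSel t a b m y))
    addEdges-refines {t} {a} {b} {y} {m} 1≤ω tab y<n = up , down
      where
        transport : ∀ {p q} → (∀ c → c < ω → p c ≡ q c) → CoversNew t a b p → CoversNew t a b q
        transport eq = subst₂ (λ u v →
          (toℕ a ≢ toℕ b ⊎ weigh t (λ _ → 1) (toℕ a) ≤ suc u) ×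
          (toℕ a ≡ toℕ b ⊎ (weigh t (λ _ → 1) (toℕ a) ≤ u ⊎ weigh t (λ _ → 1) (toℕ b) ≤ v)))
          (eq (toℕ a) (Fin.toℕ<n a)) (eq (toℕ b) (Fin.toℕ<n b))
        up : ∀ v → Feasible (addEdges t a b) y v → ∃[ w ] v ≤ w × Some< n (addEdgesSel t a b m y) w
        up v F = _ , ∸-monoˡ-≤ 1 b₁ , y , y<n ,
          (λ i i<r → (λ c c<ω → refl , transport (λ c c<ω → sym (profile F i c i<r c<ω))
             (new-covered t (λ x → bit (σ F x) i) (λ x → bit≤1 (σ F x) i) λ x z x≢z cx cz →
               cover F i i<r x z (inj₂ (x≢z , inj₁ (cx , cz))))) , sizeOk F i i<r) ,
          ≤-trans (s≤s z≤n) b₁ , refl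
          where
            F₁ : Feasible t y v
            F₁ = record { σ = σ F ; cover = λ i i<r x z e → cover F i i<r x z (inj₁ e)
                        ; small = small F ; profile = profile F ; diversity = diversity F }
            b₁ = proj₁ (tab y y<n) v F₁
        down : ∀ v → Some< n (addEdgesSel t a b m y) v → Feasible (addEdges t a b) y v
        down v (x , x<n , all , p , refl) = record
          { σ = σ F ; small = small F ; diversity = diversity F
          ; profile = λ i c i<r c<ω →
            trans (sym (proj₁ (proj₁ (all i i<r) c c<ω))) (profile F i c i<r c<ω)
          ; cover = cov }
          where
            F = proj₂ (tab x x<n) _ (pred-suc p)
            new : ∀ i → i < r → CoversNew t a b (weigh t (λ x → bit (σ F x) i))
            new i i<r = transport (λ c c<ω → profile F i c i<r c<ω)
              -- `CoversNew` concerns a whole set but is tested along with each digit; it is read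
              -- off at color 0, which exists since `1≤ω`.
              (proj₂ (proj₁ (all i i<r) 0 1≤ω))
            cov : ∀ i → i < r → ∀ x z → Edge (addEdges t a b) x z →
              1 ≤ bit (σ F x) i ⊎ 1 ≤ bit (σ F z) i
            cov i i<r x z (inj₁ e) = cover F i i<r x z e
            cov i i<r x z (inj₂ (x≢z , inj₁ (cx , cz))) =
              covers-new t (λ x → bit (σ F x) i) (λ x → bit≤1 (σ F x) i) (new i i<r) x≢z cx cz
            cov i i<r x z (inj₂ (x≢z , inj₂ (cx , cz))) =
              Sum.swap (covers-new t (λ x → bit (σ F x) i) (λ x → bit≤1 (σ F x) i) (new i i<r)
                (x≢z ∘ sym) cz cx)

-- Tests as arithmetic expressions, and the code of each node type

infix  5 _eq_ _neq_
infixr 4 _or_ _and_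

-- Tests are expressions that vanish exactly when the test succeeds.
_eq_ _neq_ _or_ _and_ : Expr → Expr → Expr
e eq f  = (e ⊟ f) ⊞ (f ⊟ e)
e neq f = lit 1 ⊟ (e eq f)
e or f  = e ⊟ (e ⊟ f)
e and f = e ⊞ f

eq⇔ : ∀ {m n} → (m ∸ n) + (n ∸ m) ≡ 0 ⇔ m ≡ n
eq⇔ {m} {n} = mk⇔
  (λ e → let e₁ , e₂ = to (sum-zero _ _) e in ≤-antisym (to (monus-zero m n) e₁)
    (to (monus-zero n m) e₂))
  (λ { refl → cong₂ _+_ (n∸n≡0 m) (n∸n≡0 m) })

not-zero⇔ : ∀ {m} {P : Set} → (m ≡ 0 ⇔ P) → 1 ∸ m ≡ 0 ⇔ (¬ P)
not-zero⇔ {zero}  h = mk⇔ (λ ()) (λ ¬p → ⊥-elim (¬p (to h refl)))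
not-zero⇔ {suc m} h = mk⇔ (λ _ p → 1+n≢0 (from h p)) (λ _ → 0∸n≡0 m)

neq⇔ : ∀ {m n} → 1 ∸ ((m ∸ n) + (n ∸ m)) ≡ 0 ⇔ m ≢ n
neq⇔ = not-zero⇔ eq⇔

-- `m ∸ (m ∸ n)` is the minimum of `m` and `n`, which vanishes iff one of them does. A product would
-- be the obvious choice, but there is no multiplication.
or⇔ : ∀ {m n} {P Q : Set} → (m ≡ 0 ⇔ P) → (n ≡ 0 ⇔ Q) → m ∸ (m ∸ n) ≡ 0 ⇔ (P ⊎ Q)
or⇔ {m} {n} p q = mk⇔ (Sum.map (to p) (to q) ∘ split) [ left ∘ from p , right ∘ from q ]′
  where
    split : m ∸ (m ∸ n) ≡ 0 → m ≡ 0 ⊎ n ≡ 0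
    split e with ≤-total n m
    ... | inj₁ n≤m = inj₂ (trans (sym (m∸[m∸n]≡n n≤m)) e)
    ... | inj₂ m≤n = inj₁ (trans (cong (m ∸_) (sym (m≤n⇒m∸n≡0 m≤n))) e)
    left : m ≡ 0 → m ∸ (m ∸ n) ≡ 0
    left refl = 0∸n≡0 (0 ∸ n)
    right : n ≡ 0 → m ∸ (m ∸ n) ≡ 0
    right refl = n∸n≡0 m

and⇔ : ∀ {m n} {P Q : Set} → (m ≡ 0 ⇔ P) → (n ≡ 0 ⇔ Q) → m + n ≡ 0 ⇔ (P × Q)
and⇔ {m} {n} p q = mk⇔ (Product.map (to p) (to q) ∘ to (sum-zero m n))
  (from (sum-zero m n) ∘ Product.map (from p) (from q))

positive⇔ : ∀ {m} → 1 ∸ m ≡ 0 ⇔ 1 ≤ m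
positive⇔ {m} = monus-zero 1 m

⇔-trans : {P Q R : Set} → (P ⇔ Q) → (Q ⇔ R) → (P ⇔ R)
⇔-trans f g = mk⇔ (to g ∘ to f) (from f ∘ from g)

source target : Expr → Expr
source e = [ var #px ⊞ var #o ⊞ e ]
target e = [ var #py ⊞ var #o ⊞ e ]

left right leftCount rightCount : Expr → Expr
left e       = [ var #t₁ ⊞ e ]
right e      = [ var #t₂ ⊞ e ]
leftCount e  = [ var #t₁ ⊞ var #m ⊞ e ]
rightCount e = [ var #t₂ ⊞ var #m ⊞ e ]

-- In postorder the last frame written is the right child of a union or the only child of a unary
-- node, so `#t₂` serves both. The 5 in `introCode` is the address of the value table. The subtree
-- of a leaf begins with the leaf's own frame; the other nodes inherit the address from their first
-- child.
introCode ⊕Code recolorCode addEdgesCode : Code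
introCode = record
  { test = (var #c eq var #to or target (var #c)) and target (var #c) ⊟ lit 1
  ; guard = lit 0
  ; value = [ lit 5 ⊞ var #acc ]
  ; keepIf = lit 0 ; kept = lit 0
  ; addUnless = var #c eq var #to ; added = lit 1
  ; origin = var #top }
⊕Code = record
  { test = source (var #c) ⊟ target (var #c)
  ; guard = (lit 1 ⊟ left (var #x)) and (lit 1 ⊟ right (var #y ⊟ var #x))
  ; value = (left (var #x) ⊟ lit 1) ⊞ (right (var #y ⊟ var #x) ⊟ lit 1)
  ; keepIf = lit 1 ; kept = leftCount (var #c)
  ; addUnless = lit 0 ; added = rightCount (var #c)
  ; origin = leftCount (var #ω) }
recolorCode = record
  { test = (var #c neq var #from or var #c neq var #to or target (var #c) eq source (var #from)) and
           (var #c neq var #from or var #c eq var #to or target (var #c)) and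
           (var #c eq var #from or var #c neq var #to or target (var #c) eq source (var #c) ⊞ source
             (var #from)) and
           (var #c eq var #from or var #c eq var #to or target (var #c) eq source (var #c))
  ; guard = lit 1 ⊟ right (var #x)
  ; value = right (var #x) ⊟ lit 1
  ; keepIf = var #c eq var #from ; kept = rightCount (var #c)
  ; addUnless = var #c eq var #to ; added = rightCount (var #from)
  ; origin = rightCount (var #ω) }
addEdgesCode = record
  { test = (source (var #c) eq target (var #c)) and
           (var #from neq var #to or rightCount (var #from) ⊟ (lit 1 ⊞ source (var #from))) and
           (var #from eq var #to or rightCount (var #from) ⊟ source (var #from) or rightCount
             (var #to) ⊟ source (var #to))
  ; guard = lit 1 ⊟ right (var #x)
  ; value = right (var #x) ⊟ lit 1
  ; keepIf = lit 1 ; kept = rightCount (var #c)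
  ; addUnless = lit 1 ; added = lit 0
  ; origin = rightCount (var #ω) }

-- Expressions have no conditional. The two conditionals of `rename` become four implications,
-- written as disjunctions, of which exactly one has content in each case.
rename⇔ : ∀ a b c (h : ℕ → ℕ) v →
  ((c ≢ a ⊎ (c ≢ b ⊎ v ≡ h a)) ×
   (c ≢ a ⊎ (c ≡ b ⊎ v ≡ 0)) ×
   (c ≡ a ⊎ (c ≢ b ⊎ v ≡ h c + h a)) ×
   (c ≡ a ⊎ (c ≡ b ⊎ v ≡ h c))) ⇔ v ≡ rename a b h c
rename⇔ a b c h v with c ≟ a | c ≟ b
... | yes refl | yes refl rewrite ≡ᵇ-refl c =
  mk⇔ (λ { (p , _) → [ (λ ne → ⊥-elim (ne refl)) , [ (λ ne → ⊥-elim (ne refl)) , id ]′ ]′ p })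
      (λ e → inj₂ (inj₂ e) , inj₂ (inj₁ refl) , inj₁ refl , inj₁ refl)
... | yes refl | no c≢b rewrite ≡ᵇ-refl c | ≡ᵇ-false c≢b =
  mk⇔ (λ { (_ , p , _) → [ (λ ne → ⊥-elim (ne refl)) , [ (λ e → ⊥-elim (c≢b e)) , id ]′ ]′ p })
      (λ e → inj₂ (inj₁ c≢b) , inj₂ (inj₂ e) , inj₁ refl , inj₁ refl)
... | no c≢a | yes refl rewrite ≡ᵇ-refl c | ≡ᵇ-false c≢a =
  mk⇔ (λ { (_ , _ , p , _) → [ (λ e → ⊥-elim (c≢a e)) , [ (λ ne → ⊥-elim (ne refl)) , id ]′ ]′ p })
      (λ e → inj₁ c≢a , inj₁ c≢a , inj₂ (inj₂ e) , inj₂ (inj₁ refl))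
... | no c≢a | no c≢b rewrite ≡ᵇ-false c≢a | ≡ᵇ-false c≢b | +-identityʳ (h c) =
  mk⇔ (λ { (_ , _ , _ , p) → [ (λ e → ⊥-elim (c≢a e)) , [ (λ e → ⊥-elim (c≢b e)) , id ]′ ]′ p })
      (λ e → inj₁ c≢a , inj₁ c≢a , inj₂ (inj₁ c≢b) , inj₂ (inj₂ e))

-- Input and digit table, which occupy the memory below base.
record Stored (r ω k n dg base : ℕ) (f : Vec Bool r → ℕ) (m : ℕ → ℕ) : Set where
  field
    1≤r        : 1 ≤ r
    1≤ω        : 1 ≤ ω
    1≤k        : 1 ≤ k
    1≤n        : 1 ≤ n
    numbering  : Numbering k (r * ω) n (λ y j → m (dg + y * (r * ω) + j))
    digits-end : dg + n * (r * ω) ≤ base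
    values     : ∀ i → i < 2 ^ r → 5 + i < base × m (5 + i) ≡ contents (valueTable r f) i

-- The frames of the four node types

module Nodes {r ω k n dg base : ℕ} {f : Vec Bool r → ℕ} {m₁ : ℕ → ℕ}
  (stored : Stored r ω k n dg base f m₁) where

  open Stored stored

  digit : ℕ → ℕ → ℕ → ℕ
  digit y i c = m₁ (dg + y * (r * ω) + i * ω + c)

  open Profiles {r} {ω} {k} {n} ⦃ >-nonZero 1≤ω ⦄ digit
    {λ y j → m₁ (dg + y * (r * ω) + j)}
      (λ y i c → cong m₁ (sym (+-assoc (dg + y * (r * ω)) (i * ω) c))) numbering public

  record IsFrame (t : Decomposition ω) (m : ℕ → ℕ) (F top : ℕ) : Set where
    field
      table  : Tabulates f t (λ y → m (F + y))
      counts : ∀ c → c < ω → m (F + n + c) ≡ weigh t (λ _ → 1) c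
      start  : m (F + n + ω) ≡ top

  record Ready (s : State) (top α : ℕ) : Set where
    field
      consts   : Consts s r ω k n (r * ω) dg top α
      fixed    : ∀ a → a < base → mem s a ≡ m₁ a
      base≤top : base ≤ top

  record Built (t : Decomposition ω) (s : State) (top org : ℕ) (s′ : State) : Set where
    field
      constants : Same 17 s s′
      unchanged : ∀ a → a < top → mem s′ a ≡ mem s a
      isFrame   : IsFrame t (mem s′) top org
      overall   : Best (Some< n (Feasible f t)) (reg s′ #gmax)

  w : ℕ
  w = n * (n * (r * ω))

  some-refine : ∀ {P : ℕ → ℕ → Set} {Q : ℕ → ℕ → ℕ → Set} →
    (∀ y → y < n → Refines (P y) (Some< n (Q y))) →
                ∀ {b} → Best (Some< n (λ y → Some< n (Q y))) b → Best (Some< n P) b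
  some-refine ref = best-transfer
    (λ { v (y , y<n , p) → let u , v≤u , q = proj₁ (ref y y<n) v p in u , v≤u , y , y<n , q })
    (λ { v (y , y<n , q) → y , y<n , proj₂ (ref y y<n) v q })

  module Build {s top α} (ready : Ready s top α) (α<ω : α < ω) where

    open Ready ready

    static : ∀ y i c → y < n → i < r → c < ω →
             dg + y * (r * ω) + i * ω + c < top × mem s (dg + y * (r * ω) + i * ω + c) ≡ digit y i c
    static y i c y<n i<r c<ω = <-≤-trans a<base base≤top , fixed _ a<base
      where
        open ≤-Reasoning
        a<base : dg + y * (r * ω) + i * ω + c < base
        a<base = begin-strict
          dg + y * (r * ω) + i * ω + c    ≡⟨ +-assoc (dg + y * (r * ω)) (i * ω) c ⟩
          dg + y * (r * ω) + (i * ω + c)  <⟨ +-monoʳ-< (dg + y * (r * ω)) (pos< i<r c<ω) ⟩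
          dg + y * (r * ω) + r * ω        ≡⟨ +-assoc dg (y * (r * ω)) (r * ω) ⟩
          dg + (y * (r * ω) + r * ω)      ≡⟨ cong (dg +_) (+-comm (y * (r * ω)) (r * ω)) ⟩
          dg + suc y * (r * ω)            ≤⟨ +-monoʳ-≤ dg (*-monoˡ-≤ (r * ω) y<n) ⟩
          dg + n * (r * ω)                ≤⟨ digits-end ⟩
          base                            ∎

    module Fr (q : Code) = Frame q s r ω k n (r * ω) dg top α consts 1≤r 1≤ω 1≤n α<ω digit static

    Unch : State → Set
    Unch s′ = ∀ a → a < top → mem s′ a ≡ mem s a

    child-cell : ∀ {F s′ i} → F + n + ω < top → Unch s′ → i < n → mem s′ (F + i) ≡ mem s (F + i)
    child-cell {F} F< unch i<n = unch _
      (<-≤-trans (+-monoʳ-< F i<n) (≤-trans (m≤m+n (F + n) ω) (<⇒≤ F<)))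

    child-count : ∀ {F s′ c} → F + n + ω < top → Unch s′ → c < ω →
      mem s′ (F + n + c) ≡ mem s (F + n + c)
    child-count {F} F< unch c<ω = unch _ (<-trans (+-monoʳ-< (F + n) c<ω) F<)

    module _ {q x y i c s′} (p : Fr.Pair q s′ x y) (o≡ : reg s′ #o ≡ i * ω) (x<n : x < n)
      (y<n : y < n) (i<r : i < r) (c<ω : c < ω) where
      source≡ : ∀ e → eval e s′ ≡ c → eval (source e) s′ ≡ digit x i c
      source≡ e e≡ rewrite Fr.Pair.is-px p | o≡ | e≡ = Fr.fetch q {s′}
        (Fr.Pair.unchanged p) x<n i<r c<ω
      target≡ : ∀ e → eval e s′ ≡ c → eval (target e) s′ ≡ digit y i c
      target≡ e e≡ rewrite Fr.Pair.is-py p | o≡ | e≡ = Fr.fetch q {s′}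
        (Fr.Pair.unchanged p) y<n i<r c<ω

    is-a′ : ∀ {s′} → Same 17 s s′ → reg s′ #to ≡ α
    is-a′ s~ = trans (at s~ #to) (Consts.is-a consts)

    build-intro : ∀ {u a} → α ≡ toℕ a →
      Exec (frame introCode) s (w * Cost.frameCost introCode) (Built (intro u a) s top top)
    build-intro {u} {a} refl = mapExec finish
      (frame-ok (λ x y i c → (c ≡ toℕ a ⊎ digit y i c ≡ 0) × digit y i c ≤ 1) (λ x y → ⊤)
        (λ x y → contents (valueTable r f) (horner (λ i → digit y i (toℕ a)) r))
        (λ c → 0) (δ (toℕ a)) top
        (λ {s′} {x} {y} {i} {c} → test-ok {s′} {x} {y} {i} {c})
          (λ _ _ _ → mk⇔ (λ _ → tt) (λ _ → refl))
        (λ {s′} {x} {y} → value-ok {s′} {x} {y})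
        (λ _ _ _ _ → (λ ne → refl) , (λ _ → refl))
        (λ {s′} → added-ok {s′})
        (λ s~ _ → trans (at s~ #top) (Consts.is-top consts)))
      where
        open Frame introCode s r ω k n (r * ω) dg top (toℕ a) consts 1≤r 1≤ω 1≤n α<ω digit static
        open Correct using (frame-ok)
        test-ok : ∀ {s′ x y i c} → Pair s′ x y → reg s′ #o ≡ i * ω → reg s′ #c ≡ c → x < n → y < n →
          i < r → c < ω →
                  eval (Code.test introCode) s′ ≡ 0 ⇔
                    ((c ≡ toℕ a ⊎ digit y i c ≡ 0) × digit y i c ≤ 1)
        test-ok {s′} {x} {y} {i} {c} p o≡ refl x<n y<n i<r c<ω
          rewrite target≡ p o≡ x<n y<n i<r c<ω (var #c) refl | is-a′ (Pair.consts-x p) =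
          and⇔ (or⇔ eq⇔ (mk⇔ id id)) (monus-zero _ 1)
        value-ok : ∀ {s′ x y} → Pair s′ x y → reg s′ #acc ≡ horner (λ i → digit y i (toℕ a)) r →
          x < n → y < n →
          (∀ i → i < r → (∀ c → c < ω → (c ≡ toℕ a ⊎ digit y i c ≡ 0) × digit y i c ≤ 1) ×
            sum< ω (digit y i) ≤ k) →
          mem s′ (5 + reg s′ #acc) ≡ contents (valueTable r f) (horner (λ i → digit y i (toℕ a)) r)
        value-ok {s′} {x} {y} p acc≡ x<n y<n all rewrite acc≡ = trans
          (Pair.unchanged p _ (<-≤-trans (proj₁ v) base≤top)) (trans (fixed _ (proj₁ v)) (proj₂ v))
          where
            -- Passing digits are at most 1, hence genuine bits, so the accumulated position lies
            -- within the `2 ^ r` cells of the value table.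
            h<2^r : horner (λ i → digit y i (toℕ a)) r < 2 ^ r
            h<2^r = subst (_< 2 ^ r) (horner-cong r λ i i<r →
              bit-fromBits r _ i i<r (proj₂ (proj₁ (all i i<r) (toℕ a) α<ω)))
                          (horner-bit (fromBits r (λ i → digit y i (toℕ a))))
            v = values _ h<2^r
        added-ok : ∀ {s′ c} → Same 17 s s′ → Unchanged s′ → reg s′ #c ≡ c → c < ω →
          (eval (Code.addUnless introCode) s′ ≢ 0 → 0 ≡ δ (toℕ a) c) ×
            (eval (Code.addUnless introCode) s′ ≡ 0 → 1 ≡ δ (toℕ a) c)
        added-ok {s′} s~ _ refl c<ω rewrite is-a′ s~ =
          (λ ne → sym (δ-≢ {toℕ a} {reg s′ #c} λ e → ne (from (eq⇔ {reg s′ #c}) (sym e)))) ,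
          (λ e → sym (subst (λ z → δ (toℕ a) z ≡ 1) (sym (to (eq⇔ {reg s′ #c}) e))
            (δ-refl (toℕ a))))
        finish : ∀ {s′} → Correct.Framed _ _ _ _ _ _ _ _ _ _ _ _ s′ → Built (intro u a) s top top s′
        finish fr = record
          { constants = constants ; unchanged = unchanged
          ; isFrame = record
            { table = λ y y<n → let up ,
                                      down = intro-refines f {u} {a}
                                        {y} 1≤k 1≤n in best-transfer up down (table y y<n)
            ; counts = λ c c<ω → trans (counts c c<ω) (sym (*-identityʳ _))
            ; start = start }
          ; overall = some-refine (λ y y<n → intro-refines f {u} {a} {y} 1≤k 1≤n) overall }
          where open Correct.Framed fr

    -- The child's frame is described in the memory with which the node starts. As it ends below
    -- `top`, it is intact in every later state of the node.
    record Child (t : Decomposition ω) (F org : ℕ) : Set where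
      field
        inside : F + n + ω < top
        holds  : IsFrame t (mem s) F org

    module _ {t F org} (child : Child t F org) where
      open Child child

      frame-cell : ∀ {s′ i j} x → Unch s′ → i ≡ F → j ≡ x → x < n → mem s′ (i + j) ≡ mem s (F + x)
      frame-cell {s′} x unch refl refl x<n = child-cell {s′ = s′} inside unch x<n

      frame-count : ∀ {s′ i j l} c → Unch s′ → i ≡ F → j ≡ n → l ≡ c → c < ω →
        mem s′ (i + j + l) ≡ weigh t (λ _ → 1) c
      frame-count {s′} c unch refl refl refl c<ω = trans (child-count {s′ = s′} inside unch c<ω)
        (IsFrame.counts holds c c<ω)

      frame-start : ∀ {s′ i j l} → Unch s′ → i ≡ F → j ≡ n → l ≡ ω → mem s′ (i + j + l) ≡ org
      frame-start unch refl refl refl = trans (unch _ inside) (IsFrame.start holds)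

    is-m′ : ∀ {s′} → Same 17 s s′ → reg s′ #m ≡ n
    is-m′ s~ = trans (at s~ #m) (Consts.is-m consts)

    is-ω′ : ∀ {s′} → Same 17 s s′ → reg s′ #ω ≡ ω
    is-ω′ s~ = trans (at s~ #ω) (Consts.is-ω consts)

    build-⊕ : ∀ {t₁ t₂ F₁ F₂ org org₂} → Child t₁ F₁ org → Child t₂ F₂ org₂ → reg s #t₁ ≡ F₁ →
      reg s #t₂ ≡ F₂ →
              Exec (frame ⊕Code) s (w * Cost.frameCost ⊕Code) (Built (t₁ ⊕ t₂) s top org)
    build-⊕ {t₁} {t₂} {F₁} {F₂} {org} ch₁ ch₂ is-t₁ is-t₂ = mapExec finish
      (frame-ok (λ x y i c → digit x i c ≤ digit y i c) (λ x y → 1 ≤ m₁′ x × 1 ≤ m₂′ (y ∸ x))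
        (λ x y → (m₁′ x ∸ 1) + (m₂′ (y ∸ x) ∸ 1))
        (weigh t₁ (λ _ → 1)) (weigh t₂ (λ _ → 1)) org
        (λ {s′} {x} {y} {i} {c} → test-ok {s′} {x} {y} {i} {c})
        (λ {s′} {x} {y} → guard-ok {s′} {x} {y})
        (λ p _ x<n y<n _ → cong₂ (λ u v → (u ∸ 1) + (v ∸ 1)) (left≡ p x<n) (right≡ p y<n))
        (λ {s′} s~ unch c≡ c<ω → (λ _ → frame-count ch₁ {s′} _ unch (t₁≡ s~) (is-m′ s~) c≡ c<ω) ,
          λ ())
        (λ {s′} s~ unch c≡ c<ω → (λ ne → ⊥-elim (ne refl)) ,
          (λ _ → frame-count ch₂ {s′} _ unch (t₂≡ s~) (is-m′ s~) c≡ c<ω))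
        (λ {s′} s~ unch → frame-start ch₁ {s′} unch (t₁≡ s~) (is-m′ s~) (is-ω′ s~)))
      where
        open Frame ⊕Code s r ω k n (r * ω) dg top α consts 1≤r 1≤ω 1≤n α<ω digit static
        open Correct using (frame-ok)
        m₁′ m₂′ : ℕ → ℕ
        m₁′ x = mem s (F₁ + x)
        m₂′ x = mem s (F₂ + x)
        t₁≡ : ∀ {s′} → Same 17 s s′ → reg s′ #t₁ ≡ F₁
        t₁≡ s~ = trans (at s~ #t₁) is-t₁
        t₂≡ : ∀ {s′} → Same 17 s s′ → reg s′ #t₂ ≡ F₂
        t₂≡ s~ = trans (at s~ #t₂) is-t₂
        left≡ : ∀ {s′ x y} → Pair s′ x y → x < n → eval (left (var #x)) s′ ≡ m₁′ x
        left≡ {s′} p x<n = frame-cell ch₁ {s′} _ (Pair.unchanged p) (t₁≡ (Pair.consts-x p))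
          (Pair.is-x p) x<n
        right≡ : ∀ {s′ x y} → Pair s′ x y → y < n → eval (right (var #y ⊟ var #x)) s′ ≡ m₂′ (y ∸ x)
        right≡ {s′} {x} {y} p y<n = frame-cell ch₂ {s′} (y ∸ x) (Pair.unchanged p)
          (t₂≡ (Pair.consts-x p))
          (cong₂ _∸_ (Pair.is-y p) (Pair.is-x p)) (≤-<-trans (m∸n≤m y x) y<n)
        test-ok : ∀ {s′ x y i c} → Pair s′ x y → reg s′ #o ≡ i * ω → reg s′ #c ≡ c → x < n → y < n →
          i < r → c < ω →
                  eval (Code.test ⊕Code) s′ ≡ 0 ⇔ digit x i c ≤ digit y i c
        test-ok p o≡ c≡ x<n y<n i<r c<ω
          rewrite source≡ p o≡ x<n y<n i<r c<ω (var #c) c≡ | target≡ p o≡ x<n y<n i<r c<ω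
            (var #c) c≡ = monus-zero _ _
        guard-ok : ∀ {s′ x y} → Pair s′ x y → x < n → y < n →
                   eval (Code.guard ⊕Code) s′ ≡ 0 ⇔ (1 ≤ m₁′ x × 1 ≤ m₂′ (y ∸ x))
        guard-ok p x<n y<n = subst₂ (λ u v → (1 ∸ u) + (1 ∸ v) ≡ 0 ⇔ _) (sym (left≡ p x<n))
          (sym (right≡ p y<n))
          (and⇔ positive⇔ positive⇔)
        ref : ∀ y → y < n → Refines (Feasible f (t₁ ⊕ t₂) y) (Some< n (⊕Sel f m₁′ m₂′ y))
        ref y y<n = ⊕-refines f (IsFrame.table (Child.holds ch₁))
          (IsFrame.table (Child.holds ch₂)) y<n
        finish : ∀ {s′} → Correct.Framed _ _ _ _ _ _ _ _ _ _ _ _ s′ → Built (t₁ ⊕ t₂) s top org s′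
        finish fr = record
          { constants = constants ; unchanged = unchanged
          ; isFrame = record
            { table = λ y y<n → let up , down = ref y y<n in best-transfer up down (table y y<n)
            ; counts = counts
            ; start = start }
          ; overall = some-refine ref overall }
          where open Correct.Framed fr

    module Unary {t F org} (ch : Child t F org) (is-t₂ : reg s #t₂ ≡ F) (a b : Fin ω)
                 (a≡ : reg s #from ≡ toℕ a) (b≡ : reg s #to ≡ toℕ b) where

      m′ : ℕ → ℕ
      m′ x = mem s (F + x)

      t₂≡ : ∀ {s′} → Same 17 s s′ → reg s′ #t₂ ≡ F
      t₂≡ s~ = trans (at s~ #t₂) is-t₂

      a≡′ : ∀ {s′} → Same 17 s s′ → reg s′ #from ≡ toℕ a
      a≡′ s~ = trans (at s~ #from) a≡

      b≡′ : ∀ {s′} → Same 17 s s′ → reg s′ #to ≡ toℕ b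
      b≡′ s~ = trans (at s~ #to) b≡

      count≡ : ∀ {s′ c} e → Same 17 s s′ → Unch s′ → eval e s′ ≡ c → c < ω →
        eval (rightCount e) s′ ≡ weigh t (λ _ → 1) c
      count≡ {s′} e s~ unch e≡ c<ω = frame-count ch {s′} _ unch (t₂≡ s~) (is-m′ s~) e≡ c<ω

      start≡ : ∀ {s′} → Same 17 s s′ → Unch s′ → eval (rightCount (var #ω)) s′ ≡ org
      start≡ {s′} s~ unch = frame-start ch {s′} unch (t₂≡ s~) (is-m′ s~) (is-ω′ s~)

      right≡ : ∀ {q s′ x y} → Fr.Pair q s′ x y → x < n → eval (right (var #x)) s′ ≡ m′ x
      right≡ {q} {s′} p x<n = frame-cell ch {s′} _ (Fr.Pair.unchanged p) (t₂≡ (Fr.Pair.consts-x p))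
        (Fr.Pair.is-x p) x<n

      guard-ok : ∀ {q s′ x y} → Fr.Pair q s′ x y → x < n →
        1 ∸ eval (right (var #x)) s′ ≡ 0 ⇔ 1 ≤ m′ x
      guard-ok {q} p x<n = subst (λ u → 1 ∸ u ≡ 0 ⇔ _) (sym (right≡ {q} p x<n)) positive⇔

      build-recolor : Exec (frame recolorCode) s (w * Cost.frameCost recolorCode)
        (Built (recolor t a b) s top org)
      build-recolor = mapExec finish
        (frame-ok (λ x y i c → digit y i c ≡ rename (toℕ a) (toℕ b) (digit x i) c)
          (λ x y → 1 ≤ m′ x)
          (λ x y → m′ x ∸ 1)
          (λ c → if c ≡ᵇ toℕ a then 0 else weigh t (λ _ → 1) c)
            (λ c → if c ≡ᵇ toℕ b then weigh t (λ _ → 1) (toℕ a) else 0) org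
          (λ {s′} {x} {y} {i} {c} → test-ok {s′} {x} {y} {i} {c})
          (λ p x<n _ → guard-ok {recolorCode} p x<n)
          (λ p _ x<n y<n _ → cong (_∸ 1) (right≡ {recolorCode} p x<n))
          (λ {s′} {c} → old-ok {s′} {c}) (λ {s′} {c} → new-ok {s′} {c}) start≡)
        where
          open Frame recolorCode s r ω k n (r * ω) dg top α consts 1≤r 1≤ω 1≤n α<ω digit static
          open Correct using (frame-ok)
          test-ok : ∀ {s′ x y i c} → Pair s′ x y → reg s′ #o ≡ i * ω → reg s′ #c ≡ c → x < n →
            y < n → i < r → c < ω →
                    eval (Code.test recolorCode) s′ ≡ 0 ⇔ digit y i c ≡ rename (toℕ a)
                      (toℕ b) (digit x i) c
          test-ok {s′} {x} {y} {i} {c} p o≡ refl x<n y<n i<r c<ω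
            rewrite source≡ p o≡ x<n y<n i<r c<ω
              (var #c) refl | target≡ p o≡ x<n y<n i<r c<ω (var #c) refl
                  | source≡ p o≡ x<n y<n i<r (Fin.toℕ<n a) (var #from) (a≡′ (Pair.consts-x p))
                  | a≡′ (Pair.consts-x p) | b≡′ (Pair.consts-x p) =
            ⇔-trans (and⇔ (or⇔ neq⇔ (or⇔ neq⇔ eq⇔))
                    (and⇔ (or⇔ neq⇔ (or⇔ eq⇔ (mk⇔ id id)))
                    (and⇔ (or⇔ eq⇔ (or⇔ neq⇔ eq⇔))
                          (or⇔ eq⇔ (or⇔ eq⇔ eq⇔)))))
                    (rename⇔ (toℕ a) (toℕ b) (reg s′ #c) (digit x i) (digit y i (reg s′ #c)))
          old-ok : ∀ {s′ c} → Same 17 s s′ → Unchanged s′ → reg s′ #c ≡ c → c < ω →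
            (eval (Code.keepIf recolorCode) s′ ≢ 0 →
              eval (rightCount (var #c)) s′ ≡ (if c ≡ᵇ toℕ a then 0 else weigh t (λ _ → 1) c)) ×
            (eval (Code.keepIf recolorCode) s′ ≡ 0 →
              0 ≡ (if c ≡ᵇ toℕ a then 0 else weigh t (λ _ → 1) c))
          old-ok {s′} s~ unch refl c<ω rewrite a≡′ s~ with reg s′ #c ≟ toℕ a
          ... | yes e rewrite e | ≡ᵇ-refl (toℕ a) =
            (λ ne → ⊥-elim (ne (from (eq⇔ {toℕ a}) refl))) , λ _ → refl
          ... | no ne rewrite ≡ᵇ-false ne = (λ _ → count≡ {s′} (var #c) s~ unch refl c<ω) , λ e →
            ⊥-elim (ne (to eq⇔ e))
          new-ok : ∀ {s′ c} → Same 17 s s′ → Unchanged s′ → reg s′ #c ≡ c → c < ω →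
            (eval (Code.addUnless recolorCode) s′ ≢ 0 →
              0 ≡ (if c ≡ᵇ toℕ b then weigh t (λ _ → 1) (toℕ a) else 0)) ×
            (eval (Code.addUnless recolorCode) s′ ≡ 0 →
              eval (rightCount (var #from))
                s′ ≡ (if c ≡ᵇ toℕ b then weigh t (λ _ → 1) (toℕ a) else 0))
          new-ok {s′} s~ unch refl c<ω rewrite b≡′ s~ with reg s′ #c ≟ toℕ b
          ... | yes e rewrite e | ≡ᵇ-refl (toℕ b) =
            (λ ne → ⊥-elim (ne (from (eq⇔ {toℕ b}) refl))) , λ _ →
              count≡ {s′} (var #from) s~ unch (a≡′ s~) (Fin.toℕ<n a)
          ... | no ne rewrite ≡ᵇ-false ne = (λ _ → refl) , λ e → ⊥-elim (ne (to eq⇔ e))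
          ref : ∀ y → y < n → Refines (Feasible f (recolor t a b) y)
            (Some< n (recolorSel f a b m′ y))
          ref y y<n = recolor-refines f (IsFrame.table (Child.holds ch)) y<n
          finish : ∀ {s′} → Correct.Framed _ _ _ _ _ _ _ _ _ _ _ _ s′ →
            Built (recolor t a b) s top org s′
          finish fr = record
            { constants = constants ; unchanged = unchanged
            ; isFrame = record
              { table = λ y y<n → let up , down = ref y y<n in best-transfer up down (table y y<n)
              ; counts = λ c c<ω → trans (counts c c<ω) (sym (weigh-recolor t a b (λ _ → 1) c))
              ; start = start }
            ; overall = some-refine ref overall }
            where open Correct.Framed fr

      build-addEdges : Exec (frame addEdgesCode) s (w * Cost.frameCost addEdgesCode)
        (Built (addEdges t a b) s top org)
      build-addEdges = mapExec finish
        (frame-ok (λ x y i c → digit x i c ≡ digit y i c × CoversNew f t a b (digit x i))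
          (λ x y → 1 ≤ m′ x)
          (λ x y → m′ x ∸ 1)
          (weigh t (λ _ → 1)) (λ _ → 0) org
          (λ {s′} {x} {y} {i} {c} → test-ok {s′} {x} {y} {i} {c})
          (λ p x<n _ → guard-ok {addEdgesCode} p x<n)
          (λ p _ x<n y<n _ → cong (_∸ 1) (right≡ {addEdgesCode} p x<n))
          (λ {s′} s~ unch c≡ c<ω → (λ _ → count≡ {s′} (var #c) s~ unch c≡ c<ω) , λ ())
          (λ _ _ _ _ → (λ _ → refl) , λ _ → refl) start≡)
        where
          open Frame addEdgesCode s r ω k n (r * ω) dg top α consts 1≤r 1≤ω 1≤n α<ω digit static
          open Correct using (frame-ok)
          test-ok : ∀ {s′ x y i c} → Pair s′ x y → reg s′ #o ≡ i * ω → reg s′ #c ≡ c → x < n →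
            y < n → i < r → c < ω →
                    eval (Code.test addEdgesCode) s′ ≡ 0 ⇔
                      (digit x i c ≡ digit y i c × CoversNew f t a b (digit x i))
          test-ok {s′} {x} {y} {i} {c} p o≡ c≡ x<n y<n i<r c<ω
            rewrite source≡ p o≡ x<n y<n i<r c<ω
              (var #c) c≡ | target≡ p o≡ x<n y<n i<r c<ω (var #c) c≡
                  | source≡ p o≡ x<n y<n i<r (Fin.toℕ<n a) (var #from) (a≡′ (Pair.consts-x p))
                  | source≡ p o≡ x<n y<n i<r (Fin.toℕ<n b) (var #to) (b≡′ (Pair.consts-x p))
                  | count≡ {s′} (var #from) (Pair.consts-x p) (Pair.unchanged p)
                    (a≡′ (Pair.consts-x p)) (Fin.toℕ<n a)
                  | count≡ {s′} (var #to) (Pair.consts-x p) (Pair.unchanged p)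
                    (b≡′ (Pair.consts-x p)) (Fin.toℕ<n b)
                  | a≡′ (Pair.consts-x p) | b≡′ (Pair.consts-x p) =
            and⇔ eq⇔ (and⇔ (or⇔ neq⇔ (monus-zero _ _))
              (or⇔ eq⇔ (or⇔ (monus-zero _ _) (monus-zero _ _))))
          ref : ∀ y → y < n → Refines (Feasible f (addEdges t a b) y)
            (Some< n (addEdgesSel f t a b m′ y))
          ref y y<n = addEdges-refines f 1≤ω (IsFrame.table (Child.holds ch)) y<n
          finish : ∀ {s′} → Correct.Framed _ _ _ _ _ _ _ _ _ _ _ _ s′ →
            Built (addEdges t a b) s top org s′
          finish fr = record
            { constants = constants ; unchanged = unchanged
            ; isFrame = record
              { table = λ y y<n → let up , down = ref y y<n in best-transfer up down (table y y<n)
              ; counts = λ c c<ω → trans (counts c c<ω) (+-identityʳ _)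
              ; start = start }
            ; overall = some-refine ref overall }
            where open Correct.Framed fr

-- The loop over the nodes in postorder

-- The operands and child addresses are loaded whatever the node type. At a leaf `#t₁` and `#t₂`
-- hold arbitrary values, but `introCode` does not read them.
dispatch node mainLoop : Program
dispatch =
  ifnz [ var #pc ]
  then (ifnz [ var #pc ] ⊟ lit 1
        then (ifnz [ var #pc ] ⊟ lit 2 then frame addEdgesCode else frame recolorCode)
        else frame ⊕Code)
  else frame introCode
node =
  #from ≔ [ var #pc ⊞ lit 1 ] ⨾
  #to ≔ [ var #pc ⊞ lit 2 ] ⨾
  #t₂ ≔ var #top ⊟ var #fs ⨾
  #t₁ ≔ [ var #t₂ ⊞ var #m ⊞ var #ω ] ⊟ var #fs ⨾
  dispatch ⨾
  #pc ≔ var #pc ⊞ lit 3 ⨾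
  #top ≔ var #top ⊞ var #fs ⨾
  #j ≔ var #j ⊞ lit 1
mainLoop = whilenz (var #size ⊟ var #j) loop node

-- The sum over the node types bounds each of them. The longest chain of tests costs 3 + 5 + 5 = 13;
-- 27 is the loop test (4) with the four loads (23), and 12 the three register updates after the
-- frame.
framesCost dispatchCost nodeCost : ℕ
framesCost   = Cost.frameCost introCode + Cost.frameCost ⊕Code +
               Cost.frameCost recolorCode + Cost.frameCost addEdgesCode
dispatchCost = 13 + (framesCost + 0)
nodeCost     = 27 + (dispatchCost + 12)

Holds : ℕ → (ℕ → ℕ) → ℕ → List ℕ → Set
Holds base m a []       = ⊤
Holds base m a (x ∷ xs) = (a < base × m a ≡ x) × Holds base m (suc a) xs

holds-++ : ∀ {base m a} xs {ys} → Holds base m a (xs ++ ys) → Holds base m a xs ×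
  Holds base m (a + length xs) ys
holds-++ {base} {m} {a} [] {ys} h = tt , subst (λ b → Holds base m b ys) (sym (+-identityʳ a)) h
holds-++ {base} {m} {a} (x ∷ xs) {ys} (h , hs) =
  let h₁ , h₂ = holds-++ xs hs in (h , h₁) ,
    subst (λ b → Holds base m b ys) (sym (+-suc a (length xs))) h₂

module Main {r ω k n dg base : ℕ} {f : Vec Bool r → ℕ} {s₁ : State}
  (stored : Stored r ω k n dg base f (mem s₁))
  (is-r : reg s₁ #r ≡ r) (is-ω : reg s₁ #ω ≡ ω) (is-k : reg s₁ #k ≡ k) (is-m : reg s₁ #m ≡ n)
  (is-l : reg s₁ #l ≡ r * ω) (is-dg : reg s₁ #dg ≡ dg) (is-fs : reg s₁ #fs ≡ n + ω + 1) where

  open Stored stored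
  open Nodes stored

  record Running (s : State) : Set where
    field
      constants : Same 10 s₁ s
      fixed     : ∀ a → a < base → mem s a ≡ mem s₁ a
      base≤top  : base ≤ reg s #top

  record Stepped (t : Decomposition ω) (s : State) (org : ℕ) (s′ : State) : Set where
    field
      running : Running s′
      pc≡     : reg s′ #pc ≡ reg s #pc + 3
      j≡      : reg s′ #j ≡ suc (reg s #j)
      top≡    : reg s′ #top ≡ reg s #top + (n + ω + 1)
      isFrame : IsFrame t (mem s′) (reg s #top) org
      below   : ∀ a → a < reg s #top → mem s′ a ≡ mem s a
      overall : Best (Some< n (Feasible f t)) (reg s′ #gmax)

  -- The net effect of the postorder of a subtree: its frames are pushed from the old `#top` on,
  -- that of `t` last, at `F`, remembering the old `#top` as its start. Cells below the old `#top`
  -- survive, in particular the frame of a left sibling.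
  record Done (t : Decomposition ω) (s s′ : State) : Set where
    field
      running : Running s′
      pc≡     : reg s′ #pc ≡ reg s #pc + length (encode t)
      j≡      : reg s′ #j ≡ reg s #j + size t
      {F}     : ℕ
      top≡    : reg s′ #top ≡ F + (n + ω + 1)
      top≤F   : reg s #top ≤ F
      isFrame : IsFrame t (mem s′) F (reg s #top)
      below   : ∀ a → a < reg s #top → mem s′ a ≡ mem s a
      overall : Best (Some< n (Feasible f t)) (reg s′ #gmax)

  frame-end : ∀ F → suc (F + n + ω) ≡ F + (n + ω + 1)
  frame-end F = trans (cong suc (+-assoc F n ω)) (trans (+-comm 1 _) (+-assoc F (n + ω) 1))

  load : State → State
  load s = ⟨ (((reg s [ #from ↦ mem s (reg s #pc + 1) ]) [ #to ↦ mem s (reg s #pc + 2) ])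
               [ #t₂ ↦ reg s #top ∸ reg s #fs ])
               [ #t₁ ↦ mem s (reg s #top ∸ reg s #fs + reg s #m + reg s #ω) ∸ reg s #fs ] , mem s ⟩

  1≤w : 1 ≤ w
  1≤w = *-mono-≤ 1≤n (*-mono-≤ 1≤n (*-mono-≤ 1≤r 1≤ω))

  node-step : ∀ {s t org u Q} → Running s → reg s #j < reg s #size →
    Exec dispatch (load s) (w * dispatchCost) (Built t (load s) (reg s #top) org) →
    (∀ {s′} → Stepped t s org s′ → Exec mainLoop s′ u Q) →
    Exec mainLoop s (w * nodeCost + u) Q
  node-step {s} {t} {org} {u} {Q} run₀ j<size disp κ =
    repeat (assign⨾ (assign⨾ (assign⨾
      (assign⨾ (disp ▸ λ {s′} b → assign⨾ (assign⨾ (assign (stepped s′ b))))))))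
    where
      open Running run₀
      stepped : ∀ s′ → Built t (load s) (reg s #top) org s′ →
        Stepped t s org ⟨ ((reg s′ [ #pc ↦ reg s′ #pc + 3 ]) [ #top ↦ reg s′ #top + reg s′ #fs ]) [
          #j ↦ reg s′ #j + 1 ] , mem s′ ⟩
      stepped s′ b = record
        { running = record
          { constants = same-put (same-put (same-put (same-trans constants
              (same-trans (same-put (same-put (same-put (same-put same-refl))))
                (same-below 10 B.constants)))))
          ; fixed = λ a a<base → trans (B.unchanged a (<-≤-trans a<base base≤top)) (fixed a a<base)
          ; base≤top = ≤-trans base≤top
            (≤-trans (≤-reflexive (sym (at B.constants #top))) (m≤m+n _ _)) }
        ; pc≡ = cong (_+ 3) (at B.constants #pc)
        ; j≡ = trans (cong (_+ 1) (at B.constants #j)) (+-comm _ 1)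
        ; top≡ = cong₂ _+_ (at B.constants #top)
          (trans (at B.constants #fs) (trans (at constants #fs) is-fs))
        ; isFrame = B.isFrame
        ; below = B.unchanged
        ; overall = B.overall }
        where module B = Built b
      repeat : Exec node s (23 + (w * dispatchCost + 12)) (λ s′ → Stepped t s org s′) →
        Exec mainLoop s (w * nodeCost + u) Q
      repeat (exec h fast q) with κ q
      ... | exec h′ fast′ q′ = exec (run-repeat (λ e → <⇒≱ j<size (m∸n≡0⇒m≤n e)) h h′)
        (≤-trans (+-monoʳ-≤ 4 (+-mono-≤ fast fast′))
          (≤-trans (≤-reflexive (sym (+-assoc 4 (23 + (w * dispatchCost + 12)) u)))
            (+-monoˡ-≤ u (fit w 27 dispatchCost 12 1≤w)))) q′

  ready : ∀ {s α} → Running s → mem s (reg s #pc + 2) ≡ α → Ready (load s) (reg s #top) α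
  ready run₀ a≡ = record
    { consts = record
      { is-r = trans (at constants #r) is-r ; is-ω = trans (at constants #ω) is-ω ;
        is-k = trans (at constants #k) is-k
      ; is-m = trans (at constants #m) is-m ; is-l = trans (at constants #l) is-l ;
        is-dg = trans (at constants #dg) is-dg
      ; is-top = refl ; is-a = a≡ }
    ; fixed = fixed ; base≤top = base≤top }
    where open Running run₀

  record Fetched (s : State) (op u v : ℕ) : Set where
    field
      op≡ : mem s (reg s #pc) ≡ op
      u≡  : mem s (reg s #pc + 1) ≡ u
      v≡  : mem s (reg s #pc + 2) ≡ v

  fetched : ∀ {s op u v} → Running s → Holds base (mem s₁) (reg s #pc) (op ∷ u ∷ v ∷ []) →
    Fetched s op u v
  fetched {s} run₀ ((a< , a≡) , (b< , b≡) , (c< , c≡) , _) = record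
    { op≡ = trans (fixed _ a<) a≡
    ; u≡ = trans (cong (mem s) (+-comm (reg s #pc) 1)) (trans (fixed _ b<) b≡)
    ; v≡ = trans (cong (mem s) (+-comm (reg s #pc) 2)) (trans (fixed _ c<) c≡) }
    where open Running run₀

  dispatch-bound : ∀ {a c} → a ≤ 13 → c ≤ framesCost → a + w * c ≤ w * dispatchCost
  dispatch-bound {a} {c} a≤ c≤ = ≤-trans (+-mono-≤ a≤ (≤-trans (*-monoʳ-≤ w c≤) (m≤m+n _ 0)))
    (fit w 13 framesCost 0 1≤w)

  op-intro : ∀ {s Q} → mem s (reg s #pc) ≡ 0 →
    Exec (frame introCode) s (w * Cost.frameCost introCode) Q →
             Exec dispatch s (w * dispatchCost) Q
  op-intro op x = within (dispatch-bound (≤ᵇ⇒≤ 3 13 tt) (≤ᵇ⇒≤ _ _ tt)) (branch-else op x)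

  op-⊕ : ∀ {s Q} → mem s (reg s #pc) ≡ 1 → Exec (frame ⊕Code) s (w * Cost.frameCost ⊕Code) Q →
         Exec dispatch s (w * dispatchCost) Q
  op-⊕ op x = within (dispatch-bound (≤ᵇ⇒≤ 8 13 tt) (≤ᵇ⇒≤ _ _ tt))
    (branch-then (subst (_≢ 0) (sym op) λ ()) (branch-else (cong (_∸ 1) op) x))

  op-recolor : ∀ {s Q} → mem s (reg s #pc) ≡ 2 →
    Exec (frame recolorCode) s (w * Cost.frameCost recolorCode) Q →
               Exec dispatch s (w * dispatchCost) Q
  op-recolor op x = within (dispatch-bound (≤ᵇ⇒≤ 13 13 tt) (≤ᵇ⇒≤ _ _ tt))
    (branch-then (subst (_≢ 0) (sym op) λ ()) (branch-then (subst (λ z → z ∸ 1 ≢ 0) (sym op) λ ())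
      (branch-else (cong (_∸ 2) op) x)))

  op-addEdges : ∀ {s Q} → mem s (reg s #pc) ≡ 3 →
    Exec (frame addEdgesCode) s (w * Cost.frameCost addEdgesCode) Q →
                Exec dispatch s (w * dispatchCost) Q
  op-addEdges op x = within (dispatch-bound (≤ᵇ⇒≤ 13 13 tt) (≤ᵇ⇒≤ _ _ tt))
    (branch-then (subst (_≢ 0) (sym op) λ ()) (branch-then (subst (λ z → z ∸ 1 ≢ 0) (sym op) λ ())
      (branch-then (subst (λ z → z ∸ 2 ≢ 0) (sym op) λ ()) x)))

  isFrame-transport : ∀ {t m m′ F org} → (∀ a → a < F + (n + ω + 1) → m′ a ≡ m a) →
    IsFrame t m F org → IsFrame t m′ F org
  isFrame-transport {F = F} eq fr = record
    { table = λ y y<n → subst (Best _)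
      (sym (eq _ (below (≤-trans (+-monoʳ-< F y<n) (m≤m+n (F + n) ω))))) (table y y<n)
    ; counts = λ c c<ω → trans (eq _ (below (+-monoʳ-< (F + n) c<ω))) (counts c c<ω)
    ; start = trans (eq _ (subst (F + n + ω <_) (frame-end F) (n<1+n _))) start }
    where open IsFrame fr
          below : ∀ {a} → a < F + n + ω → a < F + (n + ω + 1)
          below {a} a< = subst (a <_) (frame-end F) (<-trans a< (n<1+n _))

  done-t₂ : ∀ {t s s′} (d : Done t s s′) → reg s′ #top ∸ reg s′ #fs ≡ Done.F d
  done-t₂ d = trans (cong₂ _∸_ top≡ (trans (at (Running.constants running) #fs) is-fs))
    (m+n∸n≡m F (n + ω + 1))
    where open Done d

  done-child : ∀ {t s s′} (d : Done t s s′) → Done.F d + n + ω < reg s′ #top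
  done-child d = subst (_ <_) (trans (frame-end F) (sym top≡)) (n<1+n _)
    where open Done d

  -- In continuation-passing style, since the single main loop runs over the
  -- postorder of a subtree as a prefix of whatever follows.
  process : ∀ t {s u Q} → Running s → Holds base (mem s₁) (reg s #pc) (encode t) →
    reg s #j + size t ≤ reg s₁ #size →
            (∀ {s′} → Done t s s′ → Exec mainLoop s′ u Q) →
              Exec mainLoop s (size t * (w * nodeCost) + u) Q

  process-unary : ∀ t t′ {op} (a b : Fin ω) {s u Q} → length (encode t) + 3 ≡ length (encode t′) →
    suc (size t) ≡ size t′ →
    (∀ {s′ org} → mem s′ (reg s′ #pc) ≡ op → {top : ℕ} (rd : Ready s′ top (toℕ b)) {F : ℕ} →
      Build.Child rd (Fin.toℕ<n b) t F org →
      reg s′ #t₂ ≡ F → reg s′ #from ≡ toℕ a →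
        Exec dispatch s′ (w * dispatchCost) (Built t′ s′ top org)) →
    Running s → Holds base (mem s₁) (reg s #pc) (encode t ++ op ∷ toℕ a ∷ toℕ b ∷ []) →
      reg s #j + size t′ ≤ reg s₁ #size →
    (∀ {s′} → Done t′ s s′ → Exec mainLoop s′ u Q) →
      Exec mainLoop s (size t′ * (w * nodeCost) + u) Q

  process (intro v a) {s} {u} run₀ code j≤ κ = within
    (≤-reflexive (cong (_+ u) (sym (+-identityʳ (w * nodeCost)))))
    (node-step run₀ (≤-trans (≤-reflexive (+-comm 1 _))
      (≤-trans j≤ (≤-reflexive (sym (at (Running.constants run₀) #size)))))
      (op-intro (Fetched.op≡ ft)
        (Build.build-intro (ready run₀ (Fetched.v≡ ft)) (Fin.toℕ<n a) refl))
      λ st → κ record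
        { running = Stepped.running st ; pc≡ = Stepped.pc≡ st
        ; j≡ = trans (Stepped.j≡ st) (+-comm 1 _) ; top≡ = Stepped.top≡ st ; top≤F = ≤-refl
        ; isFrame = Stepped.isFrame st ; below = Stepped.below st ; overall = Stepped.overall st })
    where ft = fetched run₀ code
  process (t₁ ⊕ t₂) {s} {u} run₀ code j≤ κ = within (≤-reflexive time≡)
    (process t₁ run₀ code₁ (≤-trans (+-monoʳ-≤ _ (≤-trans (m≤m+n _ _) (n≤1+n _))) j≤) λ {s₂} d₁ →
     let module D₁ = Done d₁
         code₂′ , code₃ = holds-++ (encode t₂)
           (subst (λ a → Holds base (mem s₁) a (encode t₂ ++ 1 ∷ 0 ∷ 0 ∷ [])) (sym D₁.pc≡) code₂₃)
         j₂≡ : reg s₂ #j + size t₂ ≡ reg s #j + (size t₁ + size t₂)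
         j₂≡ = trans (cong (_+ size t₂) D₁.j≡) (+-assoc (reg s #j) (size t₁) (size t₂))
     in process t₂ D₁.running code₂′
       (≤-trans (≤-reflexive j₂≡) (≤-trans (+-monoʳ-≤ _ (n≤1+n _)) j≤)) λ {s₃} d₂ →
     let module D₂ = Done d₂
         ft = fetched D₂.running (subst (λ a → Holds base (mem s₁) a (1 ∷ 0 ∷ 0 ∷ []))
           (sym D₂.pc≡) code₃)
         j₃≡ : reg s₃ #j ≡ reg s #j + (size t₁ + size t₂)
         j₃≡ = trans D₂.j≡ j₂≡
         rd = ready D₂.running (Fetched.v≡ ft)
         kept₁ : ∀ a → a < D₁.F + (n + ω + 1) → mem s₃ a ≡ mem s₂ a
         kept₁ a a< = D₂.below a (subst (a <_) (sym D₁.top≡) a<)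
         fr₁ = isFrame-transport kept₁ D₁.isFrame
         inside₁ : D₁.F + n + ω < reg s₃ #top
         inside₁ = <-≤-trans (done-child d₁)
           (≤-trans D₂.top≤F (≤-trans (m≤m+n _ _) (≤-reflexive (sym D₂.top≡))))
         t₂≡ = done-t₂ d₂
         fs≡ = trans (at (Running.constants D₂.running) #fs) is-fs
         t₁≡ : mem s₃ (reg s₃ #top ∸ reg s₃ #fs + reg s₃ #m + reg s₃ #ω) ∸ reg s₃ #fs ≡ D₁.F
         t₁≡ = trans (cong₂ _∸_ (trans
           (cong (mem s₃) (cong₂ _+_
             (cong₂ _+_ t₂≡ (trans (at (Running.constants D₂.running) #m) is-m))
                                                           (trans (at (Running.constants D₂.running)
                                                             #ω) is-ω)))
                                       (trans (IsFrame.start D₂.isFrame) D₁.top≡)) fs≡)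
                     (m+n∸n≡m D₁.F (n + ω + 1))
         -- The third cell of a union is zero, so `#to` is color 0 here, a legal color by `1≤ω`.
         open Build rd 1≤ω
     in node-step D₂.running
          (≤-trans (≤-reflexive (trans (cong suc j₃≡) (sym (+-suc (reg s #j) (size t₁ + size t₂)))))
                   (≤-trans j≤ (≤-reflexive (sym (at (Running.constants D₂.running) #size)))))
          (op-⊕ (Fetched.op≡ ft) (build-⊕ (record { inside = inside₁ ; holds = fr₁ })
                                           (record { inside = done-child d₂ ; holds = D₂.isFrame })
                                             t₁≡ t₂≡))
          λ st → κ record
            { running = Stepped.running st
            ; pc≡ = trans (Stepped.pc≡ st)
              (trans (cong (_+ 3) (trans D₂.pc≡ (cong (_+ length (encode t₂)) D₁.pc≡)))
                (trans (+-assoc (reg s #pc + length (encode t₁)) (length (encode t₂)) 3)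
                (trans (+-assoc (reg s #pc) (length (encode t₁)) (length (encode t₂) + 3))
                  (cong (reg s #pc +_) (sym len≡)))))
            ; j≡ = trans (Stepped.j≡ st)
              (trans (cong suc j₃≡) (sym (+-suc (reg s #j) (size t₁ + size t₂))))
            ; top≡ = Stepped.top≡ st
            ; top≤F = ≤-trans D₁.top≤F (≤-trans (m≤m+n _ _) (≤-trans (≤-reflexive (sym D₁.top≡))
                (≤-trans D₂.top≤F (≤-trans (m≤m+n _ _) (≤-reflexive (sym D₂.top≡))))))
            ; isFrame = Stepped.isFrame st
            ; below = λ a a< → let a<₂ = <-≤-trans a<
                                     (≤-trans D₁.top≤F (≤-trans (m≤m+n _ _)
                                       (≤-reflexive (sym D₁.top≡)))) in
                trans (Stepped.below st a
                  (<-≤-trans a<₂ (≤-trans D₂.top≤F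
                    (≤-trans (m≤m+n _ _) (≤-reflexive (sym D₂.top≡))))))
                      (trans (D₂.below a a<₂) (D₁.below a a<))
            ; overall = Stepped.overall st })
    where
      code₁₂₃ = holds-++ (encode t₁) code
      code₁ = proj₁ code₁₂₃
      code₂₃ = proj₂ code₁₂₃
      len≡ : length (encode (t₁ ⊕ t₂)) ≡ length (encode t₁) + (length (encode t₂) + 3)
      len≡ = trans (length-++ (encode t₁)) (cong (length (encode t₁) +_) (length-++ (encode t₂)))
      x = w * nodeCost
      time≡ : size t₁ * x + (size t₂ * x + (x + u)) ≡ size (t₁ ⊕ t₂) * x + u
      time≡ = begin
        size t₁ * x + (size t₂ * x + (x + u))  ≡⟨ +-assoc (size t₁ * x) (size t₂ * x) (x + u) ⟨
        size t₁ * x + size t₂ * x + (x + u)    ≡⟨ cong (_+ (x + u))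
          (*-distribʳ-+ x (size t₁) (size t₂)) ⟨
        (size t₁ + size t₂) * x + (x + u)      ≡⟨ +-assoc ((size t₁ + size t₂) * x) x u ⟨
        (size t₁ + size t₂) * x + x + u        ≡⟨ cong (_+ u) (+-comm ((size t₁ + size t₂) * x) x) ⟩
        size (t₁ ⊕ t₂) * x + u                 ∎
        where open ≡-Reasoning
  process (recolor t a b) = process-unary t (recolor t a b) a b (sym (length-++ (encode t))) refl
    λ op rd ch t₂≡ from≡ → op-recolor op
      (Build.Unary.build-recolor rd (Fin.toℕ<n b) ch t₂≡ a b from≡ (Consts.is-a (Ready.consts rd)))
  process (addEdges t a b) = process-unary t (addEdges t a b) a b (sym (length-++ (encode t))) refl
    λ op rd ch t₂≡ from≡ → op-addEdges op
      (Build.Unary.build-addEdges rd (Fin.toℕ<n b) ch t₂≡ a b from≡ (Consts.is-a (Ready.consts rd)))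

  process-unary t t′ {op} a b {s} {u} len≡ size≡ build run₀ code j≤ κ = within (≤-reflexive time≡)
    (process t run₀ (proj₁ codes)
      (≤-trans (+-monoʳ-≤ _ (≤-trans (n≤1+n _) (≤-reflexive size≡))) j≤) λ {s₂} d →
     let module D = Done d
         ft = fetched D.running (subst (λ p → Holds base (mem s₁) p (op ∷ toℕ a ∷ toℕ b ∷ []))
           (sym D.pc≡) (proj₂ codes))
         j₂≡ : suc (reg s₂ #j) ≡ reg s #j + size t′
         j₂≡ = trans (cong suc D.j≡)
           (trans (sym (+-suc (reg s #j) (size t))) (cong (reg s #j +_) size≡))
     in node-step D.running
          (≤-trans (≤-reflexive j₂≡)
            (≤-trans j≤ (≤-reflexive (sym (at (Running.constants D.running) #size)))))
          (build (Fetched.op≡ ft) (ready D.running (Fetched.v≡ ft))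
                 (record { inside = done-child d ; holds = D.isFrame }) (done-t₂ d) (Fetched.u≡ ft))
          λ st → κ record
            { running = Stepped.running st
            ; pc≡ = trans (Stepped.pc≡ st) (trans (cong (_+ 3) D.pc≡)
                (trans (+-assoc (reg s #pc) (length (encode t)) 3) (cong (reg s #pc +_) len≡)))
            ; j≡ = trans (Stepped.j≡ st) j₂≡
            ; top≡ = Stepped.top≡ st
            ; top≤F = ≤-trans D.top≤F (≤-trans (m≤m+n _ _) (≤-reflexive (sym D.top≡)))
            ; isFrame = Stepped.isFrame st
            ; below = λ p p< → trans (Stepped.below st p
              (<-≤-trans p< (≤-trans D.top≤F (≤-trans (m≤m+n _ _) (≤-reflexive (sym D.top≡))))))
                                     (D.below p p<)
            ; overall = Stepped.overall st })
    where
      codes = holds-++ (encode t) code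
      x = w * nodeCost
      time≡ : size t * x + (x + u) ≡ size t′ * x + u
      time≡ = trans (sym (+-assoc (size t * x) x u))
        (cong (_+ u) (trans (+-comm (size t * x) x) (cong (_* x) size≡)))

-- The digit table

-- Each row is the previous one incremented; a carry out of the last digit marks
-- the end of the table.
increment digitLoop : Program
increment =
  #i ≔ [ var #px ] ⊞ var #best ⨾
  (ifnz var #i ⊟ var #k
   then ([ var #px ⊞ var #l ]≔ lit 0 ⨾ #best ≔ lit 1)
   else ([ var #px ⊞ var #l ]≔ var #i ⨾ #best ≔ lit 0)) ⨾
  #px ≔ var #px ⊞ lit 1
digitLoop =
  whilenz lit 1 ⊟ var #best loop
  (#best ≔ lit 1 ⨾ (for #x upto #l loop increment) ⨾ #y ≔ var #y ⊞ lit 1)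

-- N and M are the new and old values of the lower digits, v and x the next digits,
-- and c and c′ the carries into and out of them.
carry-step : ∀ N M c c′ v x P B → N + c * P ≡ M + 1 → v + c′ * B ≡ x + c →
             N + v * P + c′ * (B * P) ≡ M + x * P + 1
carry-step N M c c′ v x P B e₁ e₂ = begin
  N + v * P + c′ * (B * P)  ≡⟨ gather N v P c′ B ⟩
  N + (v + c′ * B) * P      ≡⟨ cong (λ z → N + z * P) e₂ ⟩
  N + (x + c) * P           ≡⟨ spread N x c P ⟩
  N + c * P + x * P         ≡⟨ cong (_+ x * P) e₁ ⟩
  M + 1 + x * P             ≡⟨ swap M x P ⟩
  M + x * P + 1             ∎
  where
    open ≡-Reasoning
    gather : ∀ N v P c′ B → N + v * P + c′ * (B * P) ≡ N + (v + c′ * B) * P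
    gather = solve-∀
    spread : ∀ N x c P → N + (x + c) * P ≡ N + c * P + x * P
    spread = solve-∀
    swap : ∀ M x P → M + 1 + x * P ≡ M + x * P + 1
    swap = solve-∀

module Digits (s₀ : State) (k l dg : ℕ) (is-k : reg s₀ #k ≡ k) (is-l : reg s₀ #l ≡ l) (1≤l : 1 ≤ l)
  (zeros : ∀ j → j < l → mem s₀ (dg + j) ≡ 0) where

  n : ℕ
  n = suc k ^ l

  Row : (ℕ → ℕ) → ℕ → Set
  Row m y = (∀ j → j < l → m (dg + y * l + j) ≤ k) ×
    numeral (suc k) l (λ j → m (dg + y * l + j)) ≡ y

  next-row : ∀ y → dg + y * l + l ≡ dg + suc y * l
  next-row y = trans (+-assoc dg (y * l) l) (cong (dg +_) (+-comm (y * l) l))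

  row-end : ∀ y {j} → j < l → dg + y * l + j < dg + suc y * l
  row-end y {j} j<l = subst (dg + y * l + j <_) (next-row y) (+-monoʳ-< (dg + y * l) j<l)

  row-transport : ∀ {m m′ y} → (∀ a → a < dg + suc y * l → m′ a ≡ m a) → Row m y → Row m′ y
  row-transport {m} {m′} {y} eq (b , v) =
    (λ j j<l → subst (_≤ k) (sym (eq _ (row-end y j<l))) (b j j<l)) ,
    trans (numeral-cong (suc k) l λ j j<l → eq _ (row-end y j<l)) v

  -- `#best` is the carry, and its initial 1 is the increment itself. The invariant says that the
  -- new digits so far, together with the carry weighted by the next power, exceed the old digits so
  -- far by one.
  increment-row : ∀ {s y} → Same 17 s₀ s → reg s #px ≡ dg + y * l → reg s #best ≡ 1 →
    Row (mem s) y →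
    Exec (for #x upto #l loop increment) s (l * 41) (λ s′ →
      Same 20 s s′ × (∀ a → a < dg + suc y * l → mem s′ a ≡ mem s a) × reg s′ #px ≡ dg + suc y * l ×
      reg s′ #best ≤ 1 × (∀ j → j < l → mem s′ (dg + suc y * l + j) ≤ k) ×
      numeral (suc k) l (λ j → mem s′ (dg + suc y * l + j)) + reg s′ #best * n ≡ suc y)
  increment-row {s} {y} s₀~s px≡ best≡ (row≤ , row≡) =
    mapExec (λ (s~ , u , p , b , e , v) → s~ , u , trans p (next-row y) , b , e ,
      trans v (trans (+-comm _ 1) (cong suc row≡)))
      (for-rule I (trans (at s₀~s #l) is-l) body 1≤l
        ((λ _ _ → refl) , trans px≡ (sym (+-identityʳ _)) , ≤-reflexive best≡ ,
          (λ _ ()) , trans (*-identityʳ _) best≡))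
    where
      top = dg + suc y * l
      I : ℕ → State → Set
      I j s′ = (∀ a → a < top → mem s′ a ≡ mem s a) × reg s′ #px ≡ dg + y * l + j ×
        reg s′ #best ≤ 1 ×
               (∀ j′ → j′ < j → mem s′ (top + j′) ≤ k) ×
               numeral (suc k) j (λ j′ → mem s′ (top + j′)) + reg s′ #best * suc k ^ j ≡
               numeral (suc k) j (λ j′ → mem s (dg + y * l + j′)) + 1
      body : ∀ j s′ → j < l → Same 20 s s′ → reg s′ #x ≡ j → I j s′ →
             Exec increment s′ 27 (λ s″ → I (suc j) ⟨ reg s″ [ #x ↦ suc j ] , mem s″ ⟩)
      body j s′ j<l s~ x≡ (unch , px≡′ , c≤1 , e≤ , num≡) =
        assign⨾ (_▸_ {Q = λ s″ → reg s″ #px ≡ reg s′ #px × Σ[ v ∈ ℕ ] (v ≤ k × reg s″ #best ≤ 1 ×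
                        v + reg s″ #best * suc k ≡ d + c × mem s″ ≡ mem s′ [ top + j ↦ v ])}
          (branch
            (λ ne → store⨾ (assign (refl , 0 , z≤n , ≤-refl ,
              sym (trans (overflow ne) (sym (*-identityˡ (suc k)))) ,
                      cong (λ a → mem s′ [ a ↦ 0 ]) addr≡)))
            (λ eq → store⨾ (assign (refl , u , subst (u ≤_) k≡ (m∸n≡0⇒m≤n eq) , z≤n ,
              trans (+-identityʳ u) u≡ ,
                      cong (λ a → mem s′ [ a ↦ u ]) addr≡))))
          λ {s″} (px≡″ , v , v≤k , c′≤1 , sum≡ , m≡) → assign (finish s″ px≡″ v v≤k c′≤1 sum≡ m≡))
        where
          d c u : ℕ
          d = mem s (dg + y * l + j)
          c = reg s′ #best
          u = mem s′ (reg s′ #px) + c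
          k≡ : reg s′ #k ≡ k
          k≡ = trans (at s~ #k) (trans (at s₀~s #k) is-k)
          addr≡ : reg s′ #px + reg s′ #l ≡ top + j
          addr≡ = trans (cong₂ _+_ px≡′ (trans (at s~ #l) (trans (at s₀~s #l) is-l)))
            (trans (+-assoc (dg + y * l) j l) (trans (cong (dg + y * l +_) (+-comm j l))
            (trans (sym (+-assoc (dg + y * l) l j)) (cong (_+ j) (next-row y)))))
          u≡ : u ≡ d + c
          u≡ = cong (_+ c) (trans (cong (mem s′) px≡′) (unch _ (row-end y j<l)))
          -- A digit is at most `k` and the carry at most 1, so exceeding `k` means exactly `k + 1`:
          -- the new digit is 0 and the carry 1.
          overflow : u ∸ reg s′ #k ≢ 0 → d + c ≡ suc k
          overflow ne = ≤-antisym (≤-trans (+-mono-≤ (row≤ j j<l) c≤1) (≤-reflexive (+-comm k 1)))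
            (subst₂ _<_ k≡ u≡ (≰⇒> λ le → ne (m≤n⇒m∸n≡0 le)))
          finish : ∀ s″ → reg s″ #px ≡ reg s′ #px → ∀ v → v ≤ k → reg s″ #best ≤ 1 →
            v + reg s″ #best * suc k ≡ d + c →
                   mem s″ ≡ mem s′ [ top + j ↦ v ] →
                   I (suc j) ⟨ (reg s″ [ #px ↦ reg s″ #px + 1 ]) [ #x ↦ suc j ] , mem s″ ⟩
          finish s″ px≡″ v v≤k c′≤1 sum≡ m≡ =
            (λ a a<top → trans (keep (<⇒≢ (<-≤-trans a<top (m≤m+n top j)))) (unch a a<top)) ,
            trans (cong (_+ 1) (trans px≡″ px≡′))
              (trans (+-assoc _ j 1) (cong (dg + y * l +_) (+-comm j 1))) ,
            c′≤1 ,
            below-suc (λ j′ j′<j → subst (_≤ k) (sym (old j′<j)) (e≤ j′ j′<j))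
              (subst (_≤ k) (sym new) v≤k) ,
            trans (cong₂ (λ N z → N + z * suc k ^ j + reg s″ #best * suc k ^ suc j)
                         (numeral-cong (suc k) j (λ _ → old)) new)
                  (carry-step (numeral (suc k) j (λ j′ → mem s′ (top + j′)))
                    (numeral (suc k) j (λ j′ → mem s (dg + y * l + j′)))
                              c (reg s″ #best) v d (suc k ^ j) (suc k) num≡ sum≡)
            where
              keep : ∀ {a} → a ≢ top + j → mem s″ a ≡ mem s′ a
              keep {a} a≢ = trans (cong (λ f → f a) m≡) (update-other (mem s′) v a≢)
              old : ∀ {j′} → j′ < j → mem s″ (top + j′) ≡ mem s′ (top + j′)
              old j′<j = keep (λ e → <⇒≢ j′<j (+-cancelˡ-≡ top _ _ e))
              new : mem s″ (top + j) ≡ v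
              new = trans (cong (λ f → f (top + j)) m≡) (update-at (mem s′) (top + j) v)

  record Rows (y : ℕ) (s : State) : Set where
    field
      constants : Same 17 s₀ s
      y≡        : reg s #y ≡ y
      px≡       : reg s #px ≡ dg + y * l
      rows      : ∀ y′ → y′ < y → Row (mem s) y′
      below     : ∀ a → a < dg → mem s a ≡ mem s₀ a

  -- The carry out of the last digit appears exactly when row `n - 1` is incremented. At that point
  -- `#y` equals `n`, and the overflowing row has been written just past the table, where the frames
  -- will start and may overwrite it.
  Status : ℕ → State → Set
  Status y s = (reg s #best ≡ 0 × y < n × Row (mem s) y) ⊎ (reg s #best ≡ 1 × y ≡ n)

  -- The fuel is the number of rows still to come, so `Status` decides in each case whether the loop
  -- can stop. A round costs `2 + 41 l + 8`: resetting the carry, incrementing the row, and counting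
  -- the row with the next test.
  rows-loop : ∀ fuel y s → fuel + y ≡ n → Rows y s → Status y s →
    Exec digitLoop s (4 + fuel * (l * 51)) (Rows n)
  rows-loop zero       y s refl R (inj₁ (_ , y<n , _)) = ⊥-elim (<-irrefl refl y<n)
  rows-loop zero       y s refl R (inj₂ (best≡ , _))   = exec
    (run-stop (cong (1 ∸_) best≡)) ≤-refl R
  rows-loop (suc fuel) y s eq   R (inj₂ (_ , y≡n))     = ⊥-elim
    (<⇒≢ (m≤n+m (suc y) fuel) (trans y≡n (trans (sym eq) (sym (+-suc fuel y)))))
  rows-loop (suc fuel) y s eq   R (inj₁ (best≡ , y<n , row)) = repeat
    (assign⨾ (increment-row (same-put constants) px≡ refl row ▸
      λ {s′} (s~ , unch , px≡′ , c≤1 , e≤ , num≡) →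
      let s₀~s′ = same-trans (same-put constants) (same-below 17 s~) in
      assign
      ( record
        { constants = same-put s₀~s′ ;
          y≡ = trans (cong (_+ 1) (trans (at s~ #y) y≡)) (+-comm y 1) ; px≡ = px≡′
        ; rows = below-suc (λ y′ y′<y →
          row-transport {mem s} {mem s′} {y′}
            (λ a a< → unch a (<-≤-trans a< (+-monoʳ-≤ dg (*-monoˡ-≤ l (m<n⇒m<1+n y′<y)))))
              (rows y′ y′<y))
                           (row-transport {mem s} {mem s′} {y} unch row)
        ; below = λ a a<dg → trans (unch a (<-≤-trans a<dg (m≤m+n dg _))) (below a a<dg) }
      , status {s′} e≤ c≤1 num≡ )))
    where
      open Rows R
      status : ∀ {s′} → (∀ j → j < l → mem s′ (dg + suc y * l + j) ≤ k) → reg s′ #best ≤ 1 →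
               numeral (suc k) l (λ j → mem s′ (dg + suc y * l + j)) + reg s′ #best * n ≡ suc y →
                 Status (suc y) s′
      status {s′} e≤ c≤1 num≡ with reg s′ #best
      ... | zero  = inj₁ (refl , subst (_< n) num≡′ (numeral-< k l e≤) , e≤ , num≡′)
        where num≡′ = trans (sym (+-identityʳ _)) num≡
      ... | suc zero = inj₂ (refl ,
        ≤-antisym y<n (subst (n ≤_) num≡
          (≤-trans (m≤m+n n 0) (m≤n+m (n + 0)
            (numeral (suc k) l (λ j → mem s′ (dg + suc y * l + j)))))))
      ... | suc (suc _) = ⊥-elim (<⇒≱ (s≤s (s≤s z≤n)) c≤1)
      repeat : Exec (#best ≔ lit 1 ⨾ (for #x upto #l loop increment) ⨾ #y ≔ var #y ⊞ lit 1) s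
        (2 + (l * 41 + 4))
                    (λ s′ → Rows (suc y) s′ × Status (suc y) s′) →
               Exec digitLoop s (4 + suc fuel * (l * 51)) (Rows n)
      repeat (exec {_} {s′} h fast (R′ , st)) with rows-loop fuel (suc y) s′
        (trans (+-suc fuel y) eq) R′ st
      ... | exec h′ fast′ q = exec (run-repeat (subst (λ z → 1 ∸ z ≢ 0) (sym best≡) λ ()) h h′)
        (≤-trans (+-monoʳ-≤ 4 (+-mono-≤ fast fast′)) bound) q
        where
          open ≤-Reasoning
          bound : 4 + (2 + (l * 41 + 4) + (4 + fuel * (l * 51))) ≤ 4 + suc fuel * (l * 51)
          bound = begin
            4 + (2 + (l * 41 + 4) + (4 + fuel * (l * 51)))    ≡⟨ cong (4 +_)
              (sym (+-assoc (2 + (l * 41 + 4)) 4 _)) ⟩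
            4 + (2 + (l * 41 + 4) + 4 + fuel * (l * 51))      ≤⟨ +-monoʳ-≤ 4
              (+-monoˡ-≤ (fuel * (l * 51))
                 (≤-trans (≤-reflexive (+-assoc (2 + (l * 41)) 4 4)) (fit l 2 41 8 1≤l))) ⟩
            4 + suc fuel * (l * 51) ∎

-- From the decomposition to the graph

order : ∀ {ω} → Decomposition ω → ℕ
order (intro v a)      = 1
order (t₁ ⊕ t₂)        = order t₁ + order t₂
order (recolor t a b)  = order t
order (addEdges t a b) = order t

enumerate : ∀ {ω} (t : Decomposition ω) → Fin (order t) ↔ Vertex t
enumerate (intro v a)      = mk↔ₛ′ (λ _ → v , refl) (λ _ → zero) (λ { (_ , refl) → refl })
  λ { zero → refl }
enumerate (t₁ ⊕ t₂)        = (enumerate t₁ ⊎-↔ enumerate t₂) ↔-∘ Fin.+↔⊎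
enumerate (recolor t a b)  = enumerate t
enumerate (addEdges t a b) = enumerate t

sum-++ : ∀ m n (h : Fin (m + n) → ℕ) → sum h ≡ sum (λ i → h (i ↑ˡ n)) + sum (λ i → h (m ↑ʳ i))
sum-++ zero    n h = refl
sum-++ (suc m) n h = trans (cong (h zero +_) (sum-++ m n (h ∘ suc))) (sym (+-assoc (h zero) _ _))

sumV-enumerate : ∀ {ω} (t : Decomposition ω) g → sumV t g ≡ sum (g ∘ Inverse.to (enumerate t))
sumV-enumerate (intro v a)      g = sym (+-identityʳ _)
sumV-enumerate (t₁ ⊕ t₂)        g = sym (trans (sum-++ (order t₁) (order t₂) _) (cong₂ _+_
  (trans (sum-cong-≗ λ i → cong
    (g ∘ Sum.map (Inverse.to (enumerate t₁)) (Inverse.to (enumerate t₂)))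
      (Fin.splitAt-↑ˡ (order t₁) i (order t₂)))
         (sym (sumV-enumerate t₁ (g ∘ inj₁))))
  (trans (sum-cong-≗ λ i → cong
    (g ∘ Sum.map (Inverse.to (enumerate t₁)) (Inverse.to (enumerate t₂)))
      (Fin.splitAt-↑ʳ (order t₁) (order t₂) i))
         (sym (sumV-enumerate t₂ (g ∘ inj₂))))))
sumV-enumerate (recolor t a b)  g = sumV-enumerate t g
sumV-enumerate (addEdges t a b) g = sumV-enumerate t g

sum-tabulate : ∀ {n} (h : Fin n → ℕ) → Vec.sum (tabulate h) ≡ sum h
sum-tabulate {zero}  h = refl
sum-tabulate {suc n} h = cong (h zero +_) (sum-tabulate (h ∘ suc))

-- The given bijection and the tree's own enumeration differ by a permutation, under which finite
-- sums are invariant. That `n` equals `order t` need not be known beforehand.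
sumV-vertices : ∀ {ω n} (t : Decomposition ω) (π : Fin n ↔ Vertex t) g →
                sumV t g ≡ Vec.sum (tabulate (g ∘ Inverse.to π))
sumV-vertices t π g = begin
  sumV t g                                                          ≡⟨ sumV-enumerate t g ⟩
  sum (g ∘ to (enumerate t))                                        ≡⟨ sum-permute _
    (↔-sym (enumerate t) ↔-∘ π) ⟩
  sum (g ∘ to (enumerate t) ∘ from (enumerate t) ∘ to π)            ≡⟨ sum-cong-≗
    (λ i → cong g (strictlyInverseˡ (enumerate t) (to π i))) ⟩
  sum (g ∘ to π)                                                    ≡⟨ sum-tabulate (g ∘ to π) ⟨
  Vec.sum (tabulate (g ∘ to π))                                     ∎
  where open ≡-Reasoning
        open Inverse

cardinality : ∀ {n} (S : Subset n) → ∣ S ∣ ≡ Vec.sum (tabulate (one ∘ lookup S))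
cardinality []          = refl
cardinality (true ∷ S)  = cong suc (cardinality S)
cardinality (false ∷ S) = cardinality S

bit-lookup : ∀ {r} (m : Vec Bool r) i → bit m (toℕ i) ≡ one (lookup m i)
bit-lookup (b ∷ bs) zero    = refl
bit-lookup (b ∷ bs) (suc i) = bit-lookup bs i

one⇒ : ∀ {b} → 1 ≤ one b → b ≡ true
one⇒ {true} _ = refl

-- A `Feasible` solution without its profile, which the graph knows nothing about. Nothing is lost,
-- as sets of size at most `k` always have a profile.
record Covers {r ω} (f : Vec Bool r → ℕ) (t : Decomposition ω) (k v : ℕ) : Set where
  field
    σ     : Vertex t → Vec Bool r
    cover : ∀ i → i < r → ∀ x z → Edge t x z → 1 ≤ bit (σ x) i ⊎ 1 ≤ bit (σ z) i
    small : ∀ i → i < r → sumV t (λ x → bit (σ x) i) ≤ k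
    diversity : sumV t (f ∘ σ) ≡ v

module Bridge {r ω n} (f : Vec Bool r → ℕ) (D : Decomposition ω) (G : Graph (Fin n))
  (iso : D IsDecompositionOf G) where

  open _≅_ iso
  open Inverse vertices using (strictlyInverseˡ; strictlyInverseʳ) renaming
    (to to vertex; from to index)

  vertex-index : ∀ x → vertex (index x) ≡ x
  vertex-index = strictlyInverseˡ

  at-index : ∀ {P : ℕ → Set} → (∀ (i : Fin r) → P (toℕ i)) → ∀ i → i < r → P i
  at-index {P} h i i<r = subst P (Fin.toℕ-fromℕ< i<r) (h (fromℕ< i<r))

  -- The family of sets is transposed into one membership vector per vertex and carried along the
  -- isomorphism. Its diversity becomes the exact value `v`, because the tables speak of exact
  -- values; `d` enters only in the final comparison.
  toCovers : ∀ {k d} → HasDiverseVertexCovers f G k d → ∃[ v ] (d ≤ v × Covers f D k v)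
  toCovers {k} {d} (S , isCover , size≤ , d≤) = _ , d≤ , record
    { σ = σ
    ; cover = at-index λ i x z e → Sum.map (in-σ i x) (in-σ i z) (isCover i (index x) (index z)
        (Equivalence.from (edges (index x) (index z))
          (subst₂ (Edge D) (sym (vertex-index x)) (sym (vertex-index z)) e)))
    ; small = at-index λ i → ≤-trans
      (≤-reflexive (trans (sumV-vertices D vertices _) (trans (cong Vec.sum (tabulate-cong λ v →
        trans (bit-lookup (σ (vertex v)) i)
          (cong one (trans (lookup∘tabulate (λ j → lookup (S j) (index (vertex v))) i)
            (cong (lookup (S i)) (strictlyInverseʳ v))))))
        (sym (cardinality (S i)))))) (size≤ i)
    ; diversity = trans (sumV-vertices D vertices (f ∘ σ))
      (cong Vec.sum (tabulate-cong λ v → cong (f ∘ membership S) (strictlyInverseʳ v))) }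
    where
      σ : Vertex D → Vec Bool r
      σ x = membership S (index x)
      in-σ : ∀ i x → index x ∈ S i → 1 ≤ bit (σ x) (toℕ i)
      in-σ i x x∈S = ≤-reflexive (sym (trans (bit-lookup (σ x) i)
        (cong one (trans (lookup∘tabulate (λ j → lookup (S j) (index x)) i) ([]=⇒lookup x∈S)))))

  fromCovers : ∀ {k d v} → d ≤ v → Covers f D k v → HasDiverseVertexCovers f G k d
  fromCovers {k} {d} d≤v C = S ,
    (λ i u v e → Sum.map (in-S i u) (in-S i v)
      (cover (toℕ i) (Fin.toℕ<n i) (vertex u) (vertex v) (Equivalence.to (edges u v) e))) ,
    (λ i → ≤-trans (≤-reflexive (trans (cardinality (S i)) (trans (cong Vec.sum (tabulate-cong λ v →
        trans (cong one (lookup∘tabulate (λ v → lookup (σ (vertex v)) i) v))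
          (sym (bit-lookup (σ (vertex v)) i))))
        (sym (sumV-vertices D vertices (λ x → bit (σ x) (toℕ i)))))))
          (small (toℕ i) (Fin.toℕ<n i))) ,
    ≤-trans d≤v (≤-reflexive (trans (sym diversity)
      (trans (sumV-vertices D vertices (f ∘ σ)) (cong Vec.sum (tabulate-cong λ v →
      cong f (sym (trans (tabulate-cong λ i → lookup∘tabulate (λ v → lookup (σ (vertex v)) i) v)
        (tabulate∘lookup (σ (vertex v))))))))))
    where
      open Covers C
      S : Fin r → Subset n
      S i = tabulate (λ v → lookup (σ (vertex v)) i)
      in-S : ∀ i u → 1 ≤ bit (σ (vertex u)) (toℕ i) → u ∈ S i
      in-S i u p = lookup⇒[]= u (S i) (trans (lookup∘tabulate (λ v → lookup (σ (vertex v)) i) u)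
        (one⇒ (subst (1 ≤_) (bit-lookup (σ (vertex u)) i) p)))

-- The complete program and its running time

setup answer solver : Program
setup =
  #ω ≔ [ lit 1 ] ⨾ #k ≔ [ lit 2 ] ⨾ #r ≔ [ lit 3 ] ⨾ #d ≔ [ lit 4 ] ⨾ #size ≔ [ lit 0 ] ⨾
  #from ≔ lit 1 ⨾ #to ≔ lit 0 ⨾
  -- In place of multiplication, `2 ^ r` is obtained by doubling in `#from` and `r * ω` by repeated
  -- addition in `#to`. The former locates the encoded tree behind the value table, the latter is
  -- the row length of the digit table.
  (for #j upto #r loop (#from ≔ var #from ⊞ var #from ⨾ #to ≔ var #to ⊞ var #ω)) ⨾
  #l ≔ var #to ⨾
  #pc ≔ lit 5 ⊞ var #from ⨾
  #dg ≔ var #pc ⊞ (var #size ⊞ var #size ⊞ var #size) ⨾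
  #px ≔ var #dg ⨾ #y ≔ lit 0 ⨾ #best ≔ lit 0
answer =
  #m ≔ var #y ⨾
  #fs ≔ var #m ⊞ var #ω ⊞ lit 1 ⨾
  #top ≔ var #px ⨾
  #j ≔ lit 0 ⨾
  mainLoop ⨾
  -- `#gmax` is shifted by one, so a nonzero difference means that the best diversity is at least
  -- `d`; with no solution at all it is 0 and the answer is negative.
  (ifnz var #gmax ⊟ var #d then (#ans ≔ lit 1) else (#ans ≔ lit 0))
solver = setup ⨾ digitLoop ⨾ answer

contents-end : ∀ xs i → contents xs (length xs + i) ≡ 0
contents-end []       i = refl
contents-end (x ∷ xs) i = contents-end xs i

holds-contents : ∀ {base m} a xs →
  (∀ i → i < length xs → a + i < base × m (a + i) ≡ contents xs i) → Holds base m a xs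
holds-contents a []       h = tt
holds-contents {base} {m} a (x ∷ xs) h =
  subst (λ b → b < base × m b ≡ x) (+-identityʳ a) (h 0 (s≤s z≤n)) ,
  holds-contents (suc a) xs λ i i< →
    subst (λ b → b < base × m b ≡ contents xs i) (+-suc a i) (h (suc i) (s≤s i<))

length-encode : ∀ {ω} (t : Decomposition ω) → length (encode t) ≡ size t + size t + size t
length-encode (intro v a) = refl
length-encode (t₁ ⊕ t₂) = trans (length-++ (encode t₁))
  (trans (cong (length (encode t₁) +_) (length-++ (encode t₂)))
  (trans (cong₂ (λ u v → u + (v + 3)) (length-encode t₁) (length-encode t₂))
    (identity (size t₁) (size t₂))))
  where identity : ∀ m n → m + m + m + (n + n + n + 3) ≡ suc (m + n) + suc (m + n) + suc (m + n)
        identity = solve-∀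
length-encode (recolor t a b)  = trans (length-++ (encode t))
  (trans (cong (_+ 3) (length-encode t)) (identity (size t)))
  where identity : ∀ m → m + m + m + 3 ≡ suc m + suc m + suc m
        identity = solve-∀
length-encode (addEdges t a b) = trans (length-++ (encode t))
  (trans (cong (_+ 3) (length-encode t)) (identity (size t)))
  where identity : ∀ m → m + m + m + 3 ≡ suc m + suc m + suc m
        identity = solve-∀

-- Every decomposition contains a leaf, and its color inhabits `Fin ω`. This supplies the positivity
-- of `ω`, which the theorem does not assume.
colored : ∀ {ω} → Decomposition ω → 1 ≤ ω
colored (intro v a)      = ≤-trans (s≤s z≤n) (Fin.toℕ<n a)
colored (t₁ ⊕ t₂)        = colored t₁
colored (recolor t a b)  = colored t
colored (addEdges t a b) = colored t

size≥1 : ∀ {ω} (t : Decomposition ω) → 1 ≤ size t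
size≥1 (intro v a)      = s≤s z≤n
size≥1 (t₁ ⊕ t₂)        = s≤s z≤n
size≥1 (recolor t a b)  = s≤s z≤n
size≥1 (addEdges t a b) = s≤s z≤n

-- The constants of the setup, the digit table, and the main loop with its surroundings, grouped as
-- in the time bound of the run so that they can be compared summand by summand.
solverCost : ℕ
solverCost = 61 + ((4 + 51) + (12 + ((nodeCost + 4) + 8)))

module Solve {r ω : ℕ} (f : Vec Bool r → ℕ) (D : Decomposition ω) (k d : ℕ) (1≤k : 1 ≤ k)
  (1≤r : 1 ≤ r) where

  xs : List ℕ
  xs = input f D k d

  1≤ω : 1 ≤ ω
  1≤ω = colored D

  l dg n base : ℕ
  l    = r * ω
  dg   = 5 + 2 ^ r + (size D + size D + size D)
  n    = suc k ^ l
  base = dg + n * l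

  1≤l : 1 ≤ l
  1≤l = *-mono-≤ 1≤r 1≤ω

  1≤n : 1 ≤ n
  1≤n = m^n>0 (suc k) l

  table-cell : ∀ i → i < 2 ^ r → contents xs (5 + i) ≡ contents (valueTable r f) i
  table-cell i i< = contents-++ˡ (valueTable r f) (subst (i <_) (sym (length-valueTable r f)) i<)

  beyond-table : ∀ i → contents xs (5 + 2 ^ r + i) ≡ contents (encode D) i
  beyond-table i = trans (cong (λ z → contents (valueTable r f ++ encode D) (z + i))
    (sym (length-valueTable r f)))
    (contents-++ʳ (valueTable r f) i)

  -- The digit table starts right behind the input, where memory is zero. So row 0, the zero
  -- profile, is there without being written.
  blank : ∀ i → contents xs (dg + i) ≡ 0
  blank i = trans (cong (contents xs) (+-assoc (5 + 2 ^ r) (size D + size D + size D) i))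
    (trans (beyond-table (size D + size D + size D + i))
    (trans (cong (λ z → contents (encode D) (z + i)) (sym (length-encode D)))
      (contents-end (encode D) i)))

  record Prepared (s : State) : Set where
    field
      mem≡  : mem s ≡ contents xs
      is-ω  : reg s #ω ≡ ω
      is-k  : reg s #k ≡ k
      is-r  : reg s #r ≡ r
      is-d  : reg s #d ≡ d
      is-s  : reg s #size ≡ size D
      is-l  : reg s #l ≡ l
      is-pc : reg s #pc ≡ 5 + 2 ^ r
      is-dg : reg s #dg ≡ dg
      is-px : reg s #px ≡ dg
      is-y  : reg s #y ≡ 0
      is-b  : reg s #best ≡ 0

  prepare : Exec setup (initial xs) (r * 61) Prepared
  prepare = within (fit r 19 22 20 1≤r)
    (assign⨾ (assign⨾ (assign⨾ (assign⨾ (assign⨾ (assign⨾ (assign⨾ (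
      for-rule I refl body 1≤r (refl , refl , refl) ▸ λ {s} (s~ , m≡ , from≡ , to≡) →
      let pc≡ = cong (5 +_) from≡
          dg≡ = cong₂ _+_ pc≡ (cong₂ _+_ (cong₂ _+_ (at s~ #size) (at s~ #size)) (at s~ #size))
      in assign⨾ (assign⨾ (assign⨾ (assign⨾ (assign⨾ (assign record
        { mem≡ = m≡ ; is-ω = at s~ #ω ; is-k = at s~ #k ; is-r = at s~ #r ; is-d = at s~ #d ;
          is-s = at s~ #size
        ; is-l = to≡ ; is-pc = pc≡ ; is-dg = dg≡ ; is-px = dg≡ ; is-y = refl ;
          is-b = refl })))))))))))))
    where
      I : ℕ → State → Set
      I i s = mem s ≡ contents xs × reg s #from ≡ 2 ^ i × reg s #to ≡ i * ω
      body : ∀ i s → i < r → Same 10 _ s → reg s #j ≡ i → I i s →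
             Exec (#from ≔ var #from ⊞ var #from ⨾ #to ≔ var #to ⊞ var #ω) s 8
                  (λ s′ → I (suc i) ⟨ reg s′ [ #j ↦ suc i ] , mem s′ ⟩)
      body i s i<r s~ j≡ (m≡ , from≡ , to≡) = assign⨾ (assign (m≡ ,
        trans (cong₂ _+_ from≡ from≡) (cong (2 ^ i +_) (sym (+-identityʳ (2 ^ i)))) ,
        trans (cong₂ _+_ to≡ (at s~ #ω)) (+-comm (i * ω) ω)))

  Answered : State → Set
  Answered s = (reg s #ans ≡ 1 × ∃[ v ] (d ≤ v × Covers f D k v)) ⊎
               (reg s #ans ≡ 0 × (∀ v → d ≤ v → Covers f D k v → ⊥))

  solved : Exec solver (initial xs)
    (r * 61 + ((4 + n * (l * 51)) + (12 + ((size D * (n * (n * l) * nodeCost) + 4) + 8))))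
    Answered
  solved = prepare ▸ λ {s} P → let open Prepared P in
    Digits.rows-loop s k l dg is-k is-l 1≤l (λ j _ → trans (cong (λ m → m (dg + j)) mem≡) (blank j))
      n 0 s (+-identityʳ n)
      (record { constants = same-refl ; y≡ = is-y ; px≡ = trans is-px (sym (+-identityʳ dg)) ;
        rows = λ _ () ; below = λ _ _ → refl })
      (inj₁ (is-b , 1≤n ,
        (λ j j<l → subst (_≤ k) (sym (zero-cell mem≡ j)) z≤n) ,
        trans (numeral-cong (suc k) l λ j _ → zero-cell mem≡ j) (numeral-0 (suc k) l)))
    ▸ λ {s′} R → finish P R
    where
      zero-cell : ∀ {m} → m ≡ contents xs → ∀ j → m (dg + 0 * l + j) ≡ 0
      zero-cell refl j = trans (cong (λ z → contents xs (z + j)) (+-identityʳ dg)) (blank j)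
      finish : ∀ {s s′ is-k is-l zeros} (P : Prepared s) →
        Digits.Rows s k l dg is-k is-l 1≤l zeros n s′ →
        Exec answer s′ (12 + ((size D * (n * (n * l) * nodeCost) + 4) + 8)) Answered
      finish {s} {s′} {is-k′} {is-l′} {zeros} P R =
        assign⨾ (assign⨾ (assign⨾ (assign⨾ (
          process D running code (≤-reflexive (sym size≡)) stop ▸ λ {s″} (same₁₀ , best) → branch
            (λ ne → assign (inj₁ (refl , yes-answer same₁₀ best ne)))
            (λ eq → assign (inj₂ (refl , no-answer same₁₀ best eq)))))))
        where
          open Prepared P
          module R = Digits.Rows R
          s₁ : State
          s₁ = ⟨ (((reg s′ [ #m ↦ reg s′ #y ]) [ #fs ↦ reg s′ #y + reg s′ #ω + 1 ]) [ #top ↦ reg s′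
            #px ]) [ #j ↦ 0 ] , mem s′ ⟩
          below : ∀ a → a < dg → mem s′ a ≡ contents xs a
          below a a< = trans (R.below a a<) (cong (λ m → m a) mem≡)
          stored : Stored r ω k n dg base f (mem s₁)
          stored = record
            { 1≤r = 1≤r ; 1≤ω = 1≤ω ; 1≤k = 1≤k ; 1≤n = 1≤n
            ; numbering = record { total = refl ; bounded = λ y y<n → proj₁ (R.rows y y<n) ;
              denotes = λ y y<n → proj₂ (R.rows y y<n) }
            ; digits-end = ≤-refl
            ; values = λ i i< → <-≤-trans (+-monoʳ-< 5 i<)
              (≤-trans (m≤m+n (5 + 2 ^ r) _) (m≤m+n dg _)) ,
                trans (below _ (<-≤-trans (+-monoʳ-< 5 i<) (m≤m+n (5 + 2 ^ r) _)))
                  (table-cell i i<) }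
          ω≡ : reg s′ #ω ≡ ω
          ω≡ = trans (at R.constants #ω) is-ω
          size≡ : reg s′ #size ≡ size D
          size≡ = trans (at R.constants #size) is-s
          pc≡ : reg s′ #pc ≡ 5 + 2 ^ r
          pc≡ = trans (at R.constants #pc) is-pc
          open Main {r} {ω} {k} {n} {dg} {base} {f} {s₁} stored (trans (at R.constants #r) is-r) ω≡
            (trans (at R.constants #k) is-k)
            R.y≡ (trans (at R.constants #l) is-l) (trans (at R.constants #dg) is-dg)
              (cong₂ (λ u v → u + v + 1) R.y≡ ω≡)
          open Nodes stored using (Feasible; locate; module Feasible)
          running : Running s₁
          running = record { constants = same-refl ; fixed = λ _ _ → refl ;
            base≤top = ≤-reflexive (sym R.px≡) }
          code : Holds base (mem s₁) (reg s₁ #pc) (encode D)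
          code = subst (λ a → Holds base (mem s₁) a (encode D)) (sym pc≡)
            (holds-contents (5 + 2 ^ r) (encode D) λ i i< →
            let a<dg = +-monoʳ-< (5 + 2 ^ r) (subst (i <_) (length-encode D) i<) in
            <-≤-trans a<dg (m≤m+n dg _) , trans (below _ a<dg) (beyond-table i))
          stop : ∀ {s″} → Done D s₁ s″ →
            Exec mainLoop s″ 4 (λ s″ → Same 10 s₁ s″ × Best (Some< n (Feasible f D)) (reg s″ #gmax))
          stop d = exec (run-stop (trans
            (cong₂ _∸_ (trans (at (Running.constants (Done.running d)) #size) size≡) (Done.j≡ d))
              (n∸n≡0 (size D))))
            ≤-refl (Running.constants (Done.running d) , Done.overall d)
          is-d′ : ∀ {s″} → Same 10 s₁ s″ → reg s″ #d ≡ d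
          is-d′ s~ = trans (at s~ #d) (trans (at R.constants #d) is-d)
          yes-answer : ∀ {s″} → Same 10 s₁ s″ → Best (Some< n (Feasible f D)) (reg s″ #gmax) →
            reg s″ #gmax ∸ reg s″ #d ≢ 0 →
            ∃[ v ] (d ≤ v × Covers f D k v)
          yes-answer {s″} s~ best ne with reg s″ #gmax | best
          ... | zero  | _ = ⊥-elim (ne (0∸n≡0 (reg s″ #d)))
          ... | suc v | _ , attained = v ,
            ≤-pred (subst (_< suc v) (is-d′ s~) (≰⇒> λ le → ne (m≤n⇒m∸n≡0 le))) ,
              covers (attained v refl)
            where covers : Some< n (Feasible f D) v → Covers f D k v
                  covers (_ , _ , F) = record { Feasible F }
          no-answer : ∀ {s″} → Same 10 s₁ s″ → Best (Some< n (Feasible f D)) (reg s″ #gmax) →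
            reg s″ #gmax ∸ reg s″ #d ≡ 0 →
            ∀ v → d ≤ v → Covers f D k v → ⊥
          -- Any admissible family has a profile and thus takes part in the overall maximum, so its
          -- diversity lies below `#gmax` and hence below `d`.
          no-answer {s″} s~ (bound , _) eq v d≤v C with locate f D (Covers.σ C) (Covers.small C)
          ... | y , y<n , y≡ = <⇒≱ (bound v (y , y<n , record { Covers C ; profile = y≡ }))
            (≤-trans (≤-trans (m∸n≡0⇒m≤n eq) (≤-reflexive (is-d′ s~))) d≤v)

  budget : ℕ
  budget = size D * (k + 1) ^ (2 * r * ω) * (r * ω)

  budget≡ : budget ≡ size D * (n * (n * l))
  budget≡ = trans (cong (λ p → size D * p * l) power)
    (trans (*-assoc (size D) (n * n) l) (cong (size D *_) (*-assoc n n l)))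
    where
      power : (k + 1) ^ (2 * r * ω) ≡ n * n
      power = trans (cong₂ _^_ (+-comm k 1) (trans (*-assoc 2 r ω) (cong (l +_) (+-identityʳ l))))
        (^-distribˡ-+-* (suc k) l l)

  -- Only the main loop needs the full budget. The setup takes a multiple of `r` and the digit table
  -- a multiple of `n * l`, both at most the product of all the positive factors, and so are the
  -- stray constants.
  fast-enough : r * 61 + ((4 + n * (l * 51)) + (12 + ((size D * (n * (n * l) * nodeCost) + 4) + 8)))
    ≤ solverCost * budget
  fast-enough = begin
    r * 61 + ((4 + n * (l * 51)) + (12 + ((size D * (n * (n * l) * nodeCost) + 4) + 8)))
      ≤⟨ *-monoˡ-≤ 61 r≤z ⊕≤ ((const 4 ⊕≤ rows≤) ⊕≤ (const 12 ⊕≤ ((main≤ ⊕≤ const 4) ⊕≤ const 8))) ⟩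
    z * solverCost        ≡⟨ *-comm z solverCost ⟩
    solverCost * z        ≡⟨ cong (solverCost *_) budget≡ ⟨
    solverCost * budget   ∎
    where
      open ≤-Reasoning
      z : ℕ
      z = size D * (n * (n * l))
      infixr 5 _⊕≤_
      _⊕≤_ : ∀ {t u a b} → t ≤ z * a → u ≤ z * b → t + u ≤ z * (a + b)
      _⊕≤_ {a = a} {b} p q = ≤-trans (+-mono-≤ p q) (≤-reflexive (sym (*-distribˡ-+ z a b)))
      1≤z : 1 ≤ z
      1≤z = *-mono-≤ (size≥1 D) (*-mono-≤ 1≤n (*-mono-≤ 1≤n 1≤l))
      const : ∀ a → a ≤ z * a
      const a = m≤n*m a z ⦃ >-nonZero 1≤z ⦄
      nl≤z : n * l ≤ z
      nl≤z = ≤-trans (m≤n*m (n * l) n ⦃ >-nonZero 1≤n ⦄)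
        (m≤n*m (n * (n * l)) (size D) ⦃ >-nonZero (size≥1 D) ⦄)
      r≤z : r ≤ z
      r≤z = ≤-trans (m≤m*n r ω ⦃ >-nonZero 1≤ω ⦄) (≤-trans (m≤n*m l n ⦃ >-nonZero 1≤n ⦄) nl≤z)
      rows≤ : n * (l * 51) ≤ z * 51
      rows≤ = ≤-trans (≤-reflexive (sym (*-assoc n l 51))) (*-monoˡ-≤ 51 nl≤z)
      main≤ : size D * (n * (n * l) * nodeCost) ≤ z * nodeCost
      main≤ = ≤-reflexive (sym (*-assoc (size D) (n * (n * l)) nodeCost))

theorem8 : Σ[ p ∈ Program ] Σ[ c ∈ ℕ ]
    (∀ {r ω n : ℕ} (f : Vec Bool r → ℕ) (D : Decomposition ω) (G : Graph (Fin n)) (k d : ℕ) →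
    D IsDecompositionOf G → 0 < k → 0 < r → 0 < d →
    Σ[ t ∈ ℕ ] Σ[ s ∈ State ]
    (run p (initial (input f D k d)) t s ×
    t ≤ c * (size D * (k + 1) ^ (2 * r * ω) * (r * ω)) ×
    Answers s (HasDiverseVertexCovers f G k d)))
theorem8 = solver , solverCost , λ f D G k d iso 0<k 0<r _ →
  let open Solve f D k d 0<k 0<r
      open Exec solved
      open Bridge f D G iso
  in time , final , halts , ≤-trans fast fast-enough ,
     [ (λ (eq , v , d≤v , C) → inj₁ (eq , fromCovers d≤v C))
     , (λ (eq , no-cover) → inj₂ (eq , λ H → let v , d≤v , C = toCovers H in no-cover v d≤v C)) ]′
       post
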